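{- Let $n,k,t$ be integers with $1\le t\le k\le n$. Then $\theta_f(K(n,k,\ge t))=\binom{n}{k}/f_{n,k,t}$.
   Context: $K(n,k,\ge t)$ is the graph whose vertices are the $k$-element subsets of $[n]=\{1,\dots,n\}$, two distinct subsets being adjacent iff they share at least $t$ elements. For an integer $r\ge 0$ with $t+2r\le n$, let $\mathcal{F}_{n,k,t,r}=\{A\subseteq[n]: |A|=k,\ |A\cap\{1,\dots,t+2r\}|\ge t+r\}$, and let $f_{n,k,t}=\max\{|\mathcal{F}_{n,k,t,r}| : r\ge 0 \text{ integer},\ t+2r\le n\}$. $\theta_f(G)$, the fractional clique covering number, is the fractional chromatic number $\chi_f(\overline{G})=\inf_b\chi_b(\overline{G})/b$ of the complement, where $\chi_b$ is the least number of colours in an assignment of $b$-element colour sets to vertices with adjacent vertices receiving disjoint sets. -}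

module Defs where

open import Data.Nat using (ℕ; zero; suc; _+_; _*_; _≤_; _<_; _⊔_; _≤?_; _<ᵇ_; _≡ᵇ_)
open import Data.Bool using (Bool; true; false; _∧_; not)
open import Data.Fin using (Fin; toℕ)
open import Data.Fin.Subset using (Subset; ∣_∣; _∩_; Empty)
open import Data.Vec using (Vec; []; _∷_; tabulate)
open import Data.List using (List; []; _∷_; _++_; map; filterᵇ; length; foldr; upTo)
open import Data.Product using (Σ; ∃; ∃-syntax; _×_; _,_)
open import Relation.Binary.PropositionalEquality using (_≡_; _≢_)
open import Relation.Nullary using (¬_)

allSubsets : (n : ℕ) → List (Subset n)
allSubsets zero = [] ∷ []
allSubsets (suc n) = map (false ∷_) (allSubsets n) ++ map (true ∷_) (allSubsets n)

-- The initial segment {1,…,s} of [n] (Fin n element i stands for i+1).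
initSeg : (n s : ℕ) → Subset n
initSeg n s = tabulate (λ i → toℕ i <ᵇ s)

inF : (n k t r : ℕ) → Subset n → Bool
inF n k t r A = (∣ A ∣ ≡ᵇ k) ∧ not (∣ A ∩ initSeg n (t + 2 * r) ∣ <ᵇ (t + r))

cardF : (n k t r : ℕ) → ℕ
cardF n k t r = length (filterᵇ (inF n k t r) (allSubsets n))

-- f_{n,k,t} = max { |F_{n,k,t,r}| : r ≥ 0, t + 2r ≤ n }  (r ≤ n suffices)
admissible : (n t r : ℕ) → Bool
admissible n t r = not (n <ᵇ t + 2 * r)

fMax : (n k t : ℕ) → ℕ
fMax n k t = foldr _⊔_ 0 (map (cardF n k t) (filterᵇ (admissible n t) (upTo (suc n))))

KSet : (n k : ℕ) → Set
KSet n k = Σ (Subset n) (λ A → ∣ A ∣ ≡ k)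

KAdj : (n k t : ℕ) → KSet n k → KSet n k → Set
KAdj n k t (A , _) (B , _) = A ≢ B × t ≤ ∣ A ∩ B ∣

Compl : {V : Set} → (V → V → Set) → V → V → Set
Compl Adj u v = u ≢ v × ¬ Adj u v

BFoldColouring : {V : Set} → (V → V → Set) → (b m : ℕ) → Set
BFoldColouring {V} Adj b m =
  Σ (V → Subset m) (λ c → (∀ v → ∣ c v ∣ ≡ b) × (∀ u v → Adj u v → Empty (c u ∩ c v)))

-- χ_f(G) = inf_{b ≥ 1} χ_b(G)/b equals p/q (q > 0), written out over colourings:
-- (i) p/q is a lower bound: every b-fold colouring with m colours has m/b ≥ p/q;
-- (ii) for every ε = 1/N > 0 some b-fold colouring with m colours has m/b < p/q + 1/N.
FracChromaticIs : {V : Set} → (V → V → Set) → (p q : ℕ) → Set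
FracChromaticIs Adj p q =
  (∀ b m → 1 ≤ b → BFoldColouring Adj b m → p * b ≤ m * q)
  × (∀ N → 1 ≤ N → ∃[ b ] ∃[ m ] (1 ≤ b × BFoldColouring Adj b m × m * q * N < (p * N + q) * b))

FracCliqueCoverIs : {V : Set} → (V → V → Set) → (p q : ℕ) → Set
FracCliqueCoverIs Adj p q = FracChromaticIs (Compl Adj) p q

{-# OPTIONS --safe #-}

-- K(n,k,≥t) has a transitive symmetry group, so θ_f is the number of vertices divided by the largest
-- clique: counting colour incidences gives the lower bound, and colouring A by the permutations that
-- carry A into a largest F_{n,k,t,r} attains it.  What remains is the complete intersection theorem
-- of Ahlswede and Khachatrian, proved by their method of pushing.  With k = q + a, t = a + 1 and
-- n = 2q + a + e, let F be a largest t-intersecting family, closed under left shifts and depending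
-- only on the trace on a set L ∪ {p}.  The members A ∋ p of F whose exchange of p for an outside x
-- leaves F can violate the intersection condition only in pairs B, C with |B∩L| + |C∩L| = |L| + a;
-- replacing one half of such a pair by exchanged sets would enlarge F, unless both halves have the
-- same size and (a + e) s ≤ q a, where |L| = a + 2s (under equality a replacement preserves |F|).
-- So F may be taken to depend only on the trace on a prefix [m] with m = t + 2r, r being least with
-- q a ≤ (a + e)(r + 1).  Complementation swaps a and e, and the same argument read from the other end
-- shows that F is symmetric inside [m]; hence F ⊆ F_{n,k,t,r}.
module Submission where

open import Defs
open import Data.Nat
open import Data.Nat.Properties
open import Data.Nat.Combinatorics using (_C_; nCk+nC[k+1]≡[n+1]C[k+1]; nCn≡1; nCk≡nC[n∸k]; k>n⇒nCk≡0)
open import Data.Nat.Tactic.RingSolver using (solve-∀)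
open import Data.Bool using (Bool; true; false; T; _∧_; _∨_; not; if_then_else_)
open import Data.Bool.Properties using (∧-comm; not-involutive)
open import Data.Empty using (⊥; ⊥-elim)
open import Data.Unit using (⊤; tt)
open import Data.Fin using (Fin; zero; suc; toℕ; fromℕ<)
import Data.Fin.Properties as Fin
open import Data.Fin.Subset using (Subset; ∣_∣; _∩_; ∁; Empty)
open import Data.Fin.Subset.Properties using (∩-comm; ∩-idem; x∈p∩q⁺; x∈p∩q⁻)
open import Data.Vec as Vec using ([]; _∷_; lookup; _[_]≔_; insertAt; fromList)
open import Data.Vec.Properties
  using (lookup∘update; lookup∘update′; lookup∘tabulate; tabulate∘lookup; tabulate-cong; lookup-zipWith; lookup-map;
         []=⇒lookup; lookup⇒[]=)
open import Data.List using (List; []; _∷_; _++_; map; filterᵇ; length; foldr; upTo; cartesianProduct)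
open import Data.List.Membership.Propositional using (_∈_)
open import Data.List.Membership.Propositional.Properties using (∈-map⁺; ∈-map⁻; ∈-filter⁺; ∈-filter⁻; ∈-upTo⁺; foldr-selective)
open import Data.List.Relation.Unary.Any using (here; there)
open import Data.Product using (Σ; ∃; _×_; _,_; proj₁; proj₂)
open import Data.Sum using (_⊎_; inj₁; inj₂)
open import Relation.Nullary using (¬_; Dec; yes; no; does)
open import Relation.Nullary.Decidable using (T?)
open import Relation.Binary.Definitions using (tri<; tri≈; tri>)
open import Relation.Binary.PropositionalEquality

-- The numerical criterion comes from a double count. A member of F containing p, with trace of size
-- i on L, can exchange p for N outside elements, and an exchanged set comes from K = k - i members.
-- For trace sizes i + j = |L| + a, the N of one equals the K of the other plus e; hence for i ≠ j,
-- unless both halves are empty, one of the two replacements enlarges F. For i = j = a + s an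
-- element z of L separates the halves: members avoiding z are exchanged, members containing z
-- removed. Averaging over z compares K a with e s, and q = K + s turns this into q a against (a +
-- e) s. From m + 1 upwards equality can occur only at |L| = m + 1. The replacement made there may
-- destroy closure under shifts, and closure must be regained without losing the new invariance; so
-- size, weight on [m + 1] and a shift potential are maximised in turn. The step from m + 1 to m is
-- free because m - a is odd. Maxima are obtained only under double negation, which suffices since
-- the final inequality is decidable. The case a = e = 0 is separate: choosing one set from each
-- complementary pair then always gives a largest family.

⟦_⟧ : Bool → ℕ
⟦ true ⟧ = 1
⟦ false ⟧ = 0

-- Finite sums over lists

∑ : {X : Set} → List X → (X → ℕ) → ℕ
∑ [] f = 0
∑ (x ∷ xs) f = f x + ∑ xs f

module _ {X : Set} where

  ∑-cong : (xs : List X) {f g : X → ℕ} → (∀ x → f x ≡ g x) → ∑ xs f ≡ ∑ xs g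
  ∑-cong [] h = refl
  ∑-cong (x ∷ xs) h = cong₂ _+_ (h x) (∑-cong xs h)

  ∑-mono : (xs : List X) {f g : X → ℕ} → (∀ x → f x ≤ g x) → ∑ xs f ≤ ∑ xs g
  ∑-mono [] h = z≤n
  ∑-mono (x ∷ xs) h = +-mono-≤ (h x) (∑-mono xs h)

  ∑-+ : (xs : List X) (f g : X → ℕ) → ∑ xs (λ x → f x + g x) ≡ ∑ xs f + ∑ xs g
  ∑-+ [] f g = refl
  ∑-+ (x ∷ xs) f g = trans (cong (f x + g x +_) (∑-+ xs f g)) (interchange (f x) (g x) (∑ xs f) (∑ xs g))
    where
    interchange : ∀ a b c d → a + b + (c + d) ≡ a + c + (b + d)
    interchange = solve-∀

  ∑-*ʳ : (xs : List X) (f : X → ℕ) (c : ℕ) → ∑ xs (λ x → f x * c) ≡ ∑ xs f * c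
  ∑-*ʳ [] f c = refl
  ∑-*ʳ (x ∷ xs) f c = trans (cong (f x * c +_) (∑-*ʳ xs f c)) (sym (*-distribʳ-+ c (f x) (∑ xs f)))

  ∑-*ˡ : (xs : List X) (c : ℕ) (f : X → ℕ) → ∑ xs (λ x → c * f x) ≡ c * ∑ xs f
  ∑-*ˡ [] c f = sym (*-zeroʳ c)
  ∑-*ˡ (x ∷ xs) c f = trans (cong (c * f x +_) (∑-*ˡ xs c f)) (sym (*-distribˡ-+ c (f x) (∑ xs f)))

  ∑-zero : (xs : List X) → ∑ xs (λ _ → 0) ≡ 0
  ∑-zero [] = refl
  ∑-zero (x ∷ xs) = ∑-zero xs

  ∑-++ : (xs ys : List X) (f : X → ℕ) → ∑ (xs ++ ys) f ≡ ∑ xs f + ∑ ys f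
  ∑-++ [] ys f = refl
  ∑-++ (x ∷ xs) ys f = trans (cong (f x +_) (∑-++ xs ys f)) (sym (+-assoc (f x) _ _))

  ∑-map : {Y : Set} (g : Y → X) (ys : List Y) (f : X → ℕ) → ∑ (map g ys) f ≡ ∑ ys (λ y → f (g y))
  ∑-map g [] f = refl
  ∑-map g (y ∷ ys) f = cong (f (g y) +_) (∑-map g ys f)

  ∑-pigeonhole : (xs : List X) (f g : X → ℕ) → ∑ xs f < ∑ xs g → ∃ λ x → f x < g x
  ∑-pigeonhole (x ∷ xs) f g h with f x <? g x
  ... | yes p = x , p
  ... | no p = ∑-pigeonhole xs f g
                 (+-cancelˡ-< (f x) _ _ (<-≤-trans h (+-monoˡ-≤ (∑ xs g) (≮⇒≥ p))))

  length-filterᵇ : (P : X → Bool) (xs : List X) → length (filterᵇ P xs) ≡ ∑ xs (λ x → ⟦ P x ⟧)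
  length-filterᵇ P [] = refl
  length-filterᵇ P (x ∷ xs) with P x
  ... | true = cong suc (length-filterᵇ P xs)
  ... | false = length-filterᵇ P xs

∑-swap : {X Y : Set} (xs : List X) (ys : List Y) (f : X → Y → ℕ) →
  ∑ xs (λ x → ∑ ys (f x)) ≡ ∑ ys (λ y → ∑ xs (λ x → f x y))
∑-swap [] ys f = sym (∑-zero ys)
∑-swap (x ∷ xs) ys f = trans (cong (∑ ys (f x) +_) (∑-swap xs ys f)) (sym (∑-+ ys (f x) _))

-- Sums over `Fin n` and over all subsets; reindexing by an involution

fins : (n : ℕ) → List (Fin n)
fins zero = []
fins (suc n) = zero ∷ map suc (fins n)

∑-fins-suc : ∀ n (f : Fin (suc n) → ℕ) → ∑ (fins (suc n)) f ≡ f zero + ∑ (fins n) (λ i → f (suc i))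
∑-fins-suc n f = cong (f zero +_) (∑-map suc (fins n) f)

term≤∑-fins : ∀ {n} (f : Fin n → ℕ) (i : Fin n) → f i ≤ ∑ (fins n) f
term≤∑-fins f zero = m≤m+n (f zero) _
term≤∑-fins {suc n} f (suc i) = subst (f (suc i) ≤_) (sym (∑-fins-suc n f))
  (≤-trans (term≤∑-fins (λ j → f (suc j)) i) (m≤n+m _ (f zero)))

∑-subsets-suc : ∀ n (f : Subset (suc n) → ℕ) → ∑ (allSubsets (suc n)) f ≡
  ∑ (allSubsets n) (λ A → f (false ∷ A)) + ∑ (allSubsets n) (λ A → f (true ∷ A))
∑-subsets-suc n f = trans (∑-++ (map (false ∷_) (allSubsets n)) _ f)
  (cong₂ _+_ (∑-map (false ∷_) (allSubsets n) f) (∑-map (true ∷_) (allSubsets n) f))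

term≤∑-subsets : ∀ {n} (f : Subset n → ℕ) (A : Subset n) → f A ≤ ∑ (allSubsets n) f
term≤∑-subsets f [] = m≤m+n (f []) 0
term≤∑-subsets {suc n} f (false ∷ A) = subst (f (false ∷ A) ≤_) (sym (∑-subsets-suc n f))
  (≤-trans (term≤∑-subsets (λ B → f (false ∷ B)) A) (m≤m+n _ _))
term≤∑-subsets {suc n} f (true ∷ A) = subst (f (true ∷ A) ≤_) (sym (∑-subsets-suc n f))
  (≤-trans (term≤∑-subsets (λ B → f (true ∷ B)) A) (m≤n+m _ _))

δ : ∀ {n} → Subset n → Subset n → ℕ
δ [] [] = 1
δ (false ∷ A) (false ∷ B) = δ A B
δ (false ∷ A) (true ∷ B) = 0
δ (true ∷ A) (false ∷ B) = 0
δ (true ∷ A) (true ∷ B) = δ A B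

δ≡0⊎≡ : ∀ {n} (A B : Subset n) → (δ A B ≡ 0) ⊎ A ≡ B
δ≡0⊎≡ [] [] = inj₂ refl
δ≡0⊎≡ (false ∷ A) (true ∷ B) = inj₁ refl
δ≡0⊎≡ (true ∷ A) (false ∷ B) = inj₁ refl
δ≡0⊎≡ (false ∷ A) (false ∷ B) with δ≡0⊎≡ A B
... | inj₁ p = inj₁ p
... | inj₂ p = inj₂ (cong (false ∷_) p)
δ≡0⊎≡ (true ∷ A) (true ∷ B) with δ≡0⊎≡ A B
... | inj₁ p = inj₁ p
... | inj₂ p = inj₂ (cong (true ∷_) p)

δ-refl : ∀ {n} (A : Subset n) → δ A A ≡ 1
δ-refl [] = refl
δ-refl (false ∷ A) = δ-refl A
δ-refl (true ∷ A) = δ-refl A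

∑-δˡ : ∀ {n} (A : Subset n) (f : Subset n → ℕ) → ∑ (allSubsets n) (λ B → δ A B * f B) ≡ f A
∑-δˡ [] f = trans (+-identityʳ _) (+-identityʳ _)
∑-δˡ {suc n} (false ∷ A) f = trans (∑-subsets-suc n _)
  (trans (cong₂ _+_ (∑-δˡ A (λ B → f (false ∷ B))) (∑-zero (allSubsets n))) (+-identityʳ _))
∑-δˡ {suc n} (true ∷ A) f = trans (∑-subsets-suc n _)
  (trans (cong₂ _+_ (∑-zero (allSubsets n)) (∑-δˡ A (λ B → f (true ∷ B)))) refl)

δ-adjoint : ∀ {n} (g : Subset n → Subset n) → (∀ A → g (g A) ≡ A) → ∀ A B → δ (g A) B ≡ δ (g B) A
δ-adjoint g inv A B with δ≡0⊎≡ (g A) B | δ≡0⊎≡ (g B) A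
... | inj₁ p | inj₁ q = trans p (sym q)
... | inj₂ refl | _ = trans (δ-refl (g A)) (sym (trans (cong (λ Z → δ Z A) (inv A)) (δ-refl A)))
... | inj₁ p | inj₂ refl = trans (trans (cong (λ Z → δ Z B) (inv B)) (δ-refl B)) (sym (δ-refl (g B)))

-- Each value `f (g A)` is spread out as a sum against `δ (g A)`, the sums are swapped, and for an
-- involution `g A ≡ B` is equivalent to `g B ≡ A`.
∑-involution : ∀ {n} (g : Subset n → Subset n) → (∀ A → g (g A) ≡ A) → (f : Subset n → ℕ) →
  ∑ (allSubsets n) (λ A → f (g A)) ≡ ∑ (allSubsets n) f
∑-involution {n} g inv f = begin
  ∑ S (λ A → f (g A))                        ≡⟨ ∑-cong S (λ A → sym (∑-δˡ (g A) f)) ⟩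
  ∑ S (λ A → ∑ S (λ B → δ (g A) B * f B))    ≡⟨ ∑-swap S S _ ⟩
  ∑ S (λ B → ∑ S (λ A → δ (g A) B * f B))    ≡⟨ ∑-cong S (λ B → ∑-cong S (λ A → cong (_* f B) (δ-adjoint g inv A B))) ⟩
  ∑ S (λ B → ∑ S (λ A → δ (g B) A * f B))    ≡⟨ ∑-cong S (λ B → ∑-δˡ (g B) (λ _ → f B)) ⟩
  ∑ S f                                      ∎
  where
  open ≡-Reasoning
  S = allSubsets n

-- Cardinalities of intersections, and the exchange `sw` of two elements

subset-ext : ∀ {n} {A B : Subset n} → (∀ i → lookup A i ≡ lookup B i) → A ≡ B
subset-ext {A = A} {B} h = trans (sym (tabulate∘lookup A)) (trans (tabulate-cong h) (tabulate∘lookup B))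

card-∑ : ∀ {n} (A : Subset n) → ∣ A ∣ ≡ ∑ (fins n) (λ i → ⟦ lookup A i ⟧)
card-∑ [] = refl
card-∑ {suc n} (true ∷ A) = trans (cong suc (card-∑ A)) (sym (∑-fins-suc n (λ i → ⟦ lookup (true ∷ A) i ⟧)))
card-∑ {suc n} (false ∷ A) = trans (card-∑ A) (sym (∑-fins-suc n (λ i → ⟦ lookup (false ∷ A) i ⟧)))

card-∩-∑ : ∀ {n} (A B : Subset n) → ∣ A ∩ B ∣ ≡ ∑ (fins n) (λ i → ⟦ lookup A i ∧ lookup B i ⟧)
card-∩-∑ {n} A B = trans (card-∑ (A ∩ B)) (∑-cong (fins n) (λ i → cong ⟦_⟧ (lookup-zipWith _∧_ i A B)))

lookup-∁ : ∀ {n} (A : Subset n) i → lookup (∁ A) i ≡ not (lookup A i)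
lookup-∁ A i = lookup-map i not A

∁-involutive : ∀ {n} (A : Subset n) → ∁ (∁ A) ≡ A
∁-involutive A = subset-ext (λ i → trans (lookup-∁ (∁ A) i) (trans (cong not (lookup-∁ A i)) (not-involutive _)))

card-∩-mono : ∀ {n} (A B Z D : Subset n) → (∀ i → lookup A i ≡ true → lookup B i ≡ true → lookup Z i ∧ lookup D i ≡ true) →
  ∣ A ∩ B ∣ ≤ ∣ Z ∩ D ∣
card-∩-mono {n} A B Z D h = subst₂ _≤_ (sym (card-∩-∑ A B)) (sym (card-∩-∑ Z D)) (∑-mono (fins n) pointwise)
  where
  pointwise : ∀ i → ⟦ lookup A i ∧ lookup B i ⟧ ≤ ⟦ lookup Z i ∧ lookup D i ⟧
  pointwise i with lookup A i in a | lookup B i in b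
  ... | false | _ = z≤n
  ... | true | false = z≤n
  ... | true | true rewrite h i a b = ≤-refl

-- The old contribution at `i` is added on one side and the new one on the other, which avoids
-- truncated subtraction.
card-∩-update : ∀ {n} (A B : Subset n) i b →
  ∣ (A [ i ]≔ b) ∩ B ∣ + ⟦ lookup A i ∧ lookup B i ⟧ ≡ ∣ A ∩ B ∣ + ⟦ b ∧ lookup B i ⟧
card-∩-update (a ∷ A) (c ∷ B) zero b = trans (swapHead b c) (trans (+-comm-middle ⟦ b ∧ c ⟧ ∣ A ∩ B ∣ ⟦ a ∧ c ⟧) (cong (_+ ⟦ b ∧ c ⟧) (sym (card-∷ (a ∧ c) (A ∩ B)))))
  where
  card-∷ : ∀ {n} x (Z : Subset n) → ∣ x ∷ Z ∣ ≡ ⟦ x ⟧ + ∣ Z ∣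
  card-∷ true Z = refl
  card-∷ false Z = refl
  swapHead : ∀ b c → ∣ (b ∧ c) ∷ (A ∩ B) ∣ + ⟦ a ∧ c ⟧ ≡ ⟦ b ∧ c ⟧ + ∣ A ∩ B ∣ + ⟦ a ∧ c ⟧
  swapHead b c = cong (_+ ⟦ a ∧ c ⟧) (card-∷ (b ∧ c) (A ∩ B))
  +-comm-middle : ∀ x y z → x + y + z ≡ z + y + x
  +-comm-middle = solve-∀
card-∩-update (a ∷ A) (c ∷ B) (suc i) b with a ∧ c
... | true = cong suc (card-∩-update A B i b)
... | false = card-∩-update A B i b

-- Abstract, so that applications unify syntactically.
abstract
  sw : ∀ {n} → Fin n → Fin n → Subset n → Subset n
  sw i j A = (A [ i ]≔ lookup A j) [ j ]≔ lookup A i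

  sw-at-snd : ∀ {n} (i j : Fin n) A → lookup (sw i j A) j ≡ lookup A i
  sw-at-snd i j A = lookup∘update j (A [ i ]≔ lookup A j) _

  update-at-other : ∀ {n} (i j : Fin n) (A : Subset n) → lookup (A [ i ]≔ lookup A j) j ≡ lookup A j
  update-at-other i j A with j Fin.≟ i
  ... | yes refl = lookup∘update i A _
  ... | no p = lookup∘update′ p A _

  sw-at-fst : ∀ {n} (i j : Fin n) A → lookup (sw i j A) i ≡ lookup A j
  sw-at-fst i j A with i Fin.≟ j
  ... | yes refl = sw-at-snd i i A
  ... | no p = trans (lookup∘update′ p (A [ i ]≔ lookup A j) _) (lookup∘update i A _)

  sw-elsewhere : ∀ {n} (i j : Fin n) A x → x ≢ i → x ≢ j → lookup (sw i j A) x ≡ lookup A x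
  sw-elsewhere i j A x p q = trans (lookup∘update′ q (A [ i ]≔ lookup A j) _) (lookup∘update′ p A _)

  card-sw-∩ : ∀ {n} (i j : Fin n) A B →
    ∣ sw i j A ∩ B ∣ + (⟦ lookup A i ∧ lookup B i ⟧ + ⟦ lookup A j ∧ lookup B j ⟧) ≡
    ∣ A ∩ B ∣ + (⟦ lookup A j ∧ lookup B i ⟧ + ⟦ lookup A i ∧ lookup B j ⟧)
  card-sw-∩ i j A B = combine (∣ sw i j A ∩ B ∣) (∣ (A [ i ]≔ lookup A j) ∩ B ∣) (∣ A ∩ B ∣)
      (⟦ lookup A i ∧ lookup B i ⟧) (⟦ lookup A j ∧ lookup B j ⟧) (⟦ lookup A j ∧ lookup B i ⟧) (⟦ lookup A i ∧ lookup B j ⟧) first second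
    where
    first : ∣ (A [ i ]≔ lookup A j) ∩ B ∣ + ⟦ lookup A i ∧ lookup B i ⟧ ≡ ∣ A ∩ B ∣ + ⟦ lookup A j ∧ lookup B i ⟧
    first = card-∩-update A B i (lookup A j)
    second : ∣ sw i j A ∩ B ∣ + ⟦ lookup A j ∧ lookup B j ⟧ ≡ ∣ (A [ i ]≔ lookup A j) ∩ B ∣ + ⟦ lookup A i ∧ lookup B j ⟧
    second = subst (λ b → ∣ sw i j A ∩ B ∣ + ⟦ b ∧ lookup B j ⟧ ≡ ∣ (A [ i ]≔ lookup A j) ∩ B ∣ + ⟦ lookup A i ∧ lookup B j ⟧)
      (update-at-other i j A) (card-∩-update (A [ i ]≔ lookup A j) B j (lookup A i))
    combine : ∀ s m c ii jj ji ij → m + ii ≡ c + ji → s + jj ≡ m + ij → s + (ii + jj) ≡ c + (ji + ij)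
    combine s m c ii jj ji ij h₁ h₂ = begin
      s + (ii + jj)   ≡⟨ lem s ii jj ⟩
      s + jj + ii     ≡⟨ cong (_+ ii) h₂ ⟩
      m + ij + ii     ≡⟨ lem′ m ij ii ⟩
      m + ii + ij     ≡⟨ cong (_+ ij) h₁ ⟩
      c + ji + ij     ≡⟨ +-assoc c ji ij ⟩
      c + (ji + ij)   ∎
      where
      open ≡-Reasoning
      lem : ∀ a b c → a + (b + c) ≡ a + c + b
      lem = solve-∀
      lem′ : ∀ a b c → a + b + c ≡ a + c + b
      lem′ = solve-∀

sw-involutive : ∀ {n} (i j : Fin n) A → sw i j (sw i j A) ≡ A
sw-involutive i j A = subset-ext at
  where
  at : ∀ x → lookup (sw i j (sw i j A)) x ≡ lookup A x
  at x with x Fin.≟ i | x Fin.≟ j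
  ... | yes refl | _ = trans (sw-at-fst i j (sw i j A)) (sw-at-snd i j A)
  ... | no p | yes refl = trans (sw-at-snd i j (sw i j A)) (sw-at-fst i j A)
  ... | no p | no q = trans (sw-elsewhere i j (sw i j A) x p q) (sw-elsewhere i j A x p q)

sw-comm : ∀ {n} (i j : Fin n) A → sw i j A ≡ sw j i A
sw-comm i j A = subset-ext at
  where
  at : ∀ x → lookup (sw i j A) x ≡ lookup (sw j i A) x
  at x with x Fin.≟ i | x Fin.≟ j
  ... | yes refl | _ = trans (sw-at-fst i j A) (sym (sw-at-snd j i A))
  ... | no p | yes refl = trans (sw-at-snd i j A) (sym (sw-at-fst j i A))
  ... | no p | no q = trans (sw-elsewhere i j A x p q) (sym (sw-elsewhere j i A x q p))

sw-fixes : ∀ {n} (i j : Fin n) A → lookup A i ≡ lookup A j → sw i j A ≡ A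
sw-fixes i j A h = subset-ext at
  where
  at : ∀ x → lookup (sw i j A) x ≡ lookup A x
  at x with x Fin.≟ i | x Fin.≟ j
  ... | yes refl | _ = trans (sw-at-fst i j A) (sym h)
  ... | no p | yes refl = trans (sw-at-snd i j A) h
  ... | no p | no q = sw-elsewhere i j A x p q

sw-∁ : ∀ {n} (i j : Fin n) A → ∁ (sw i j A) ≡ sw i j (∁ A)
sw-∁ i j A = subset-ext at
  where
  at : ∀ x → lookup (∁ (sw i j A)) x ≡ lookup (sw i j (∁ A)) x
  at x with x Fin.≟ i | x Fin.≟ j
  ... | yes refl | _ = trans (lookup-∁ (sw i j A) x) (trans (cong not (sw-at-fst i j A)) (sym (trans (sw-at-fst i j (∁ A)) (lookup-∁ A j))))
  ... | no p | yes refl = trans (lookup-∁ (sw i j A) x) (trans (cong not (sw-at-snd i j A)) (sym (trans (sw-at-snd i j (∁ A)) (lookup-∁ A i))))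
  ... | no p | no q = trans (lookup-∁ (sw i j A) x) (trans (cong not (sw-elsewhere i j A x p q)) (sym (trans (sw-elsewhere i j (∁ A) x p q) (lookup-∁ A x))))

-- Conjugation of transpositions. It changes the partner of `p` in an exchange, so that invariance
-- under exchanges of outside elements carries facts from one partner to another.
sw-conj : ∀ {n} (p x y : Fin n) A → x ≢ p → y ≢ p → sw x y (sw p x A) ≡ sw p y (sw x y A)
sw-conj p x y A x≢p y≢p = subset-ext at
  where
  at : ∀ z → lookup (sw x y (sw p x A)) z ≡ lookup (sw p y (sw x y A)) z
  at z with z Fin.≟ x | z Fin.≟ y | z Fin.≟ p
  ... | yes refl | yes refl | _ = trans (sw-at-fst z z _) (trans (sw-at-snd p z A) (sym (trans (sw-at-snd p z _) (sw-elsewhere z z A p (≢-sym x≢p) (≢-sym x≢p)))))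
  ... | yes refl | no z≢y | yes z≡p = ⊥-elim (x≢p z≡p)
  ... | yes refl | no z≢y | no _ = trans (sw-at-fst z y _) (trans (sw-elsewhere p z A y y≢p (≢-sym z≢y))
            (sym (trans (sw-elsewhere p y _ z x≢p z≢y) (sw-at-fst z y A))))
  ... | no z≢x | yes refl | _ = trans (sw-at-snd x z _) (trans (sw-at-snd p x A)
            (sym (trans (sw-at-snd p z _) (sw-elsewhere x z A p (≢-sym x≢p) (≢-sym y≢p)))))
  ... | no z≢x | no z≢y | yes refl = trans (sw-elsewhere x y _ z z≢x z≢y) (trans (sw-at-fst z x A)
            (sym (trans (sw-at-fst z y _) (sw-at-snd x y A))))
  ... | no z≢x | no z≢y | no z≢p = trans (sw-elsewhere x y _ z z≢x z≢y) (trans (sw-elsewhere p x A z z≢p z≢x)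
            (sym (trans (sw-elsewhere p y _ z z≢p z≢y) (sw-elsewhere x y A z z≢x z≢y))))

sw-disjoint : ∀ {n} (i j x y : Fin n) A → x ≢ i → x ≢ j → y ≢ i → y ≢ j → sw i j (sw x y A) ≡ sw x y (sw i j A)
sw-disjoint i j x y A xi xj yi yj = subset-ext at
  where
  at : ∀ z → lookup (sw i j (sw x y A)) z ≡ lookup (sw x y (sw i j A)) z
  at z with z Fin.≟ i | z Fin.≟ j | z Fin.≟ x | z Fin.≟ y
  ... | yes refl | _ | _ | _ = trans (sw-at-fst z j _) (trans (sw-elsewhere x y A j (≢-sym xj) (≢-sym yj))
          (sym (trans (sw-elsewhere x y _ z (≢-sym xi) (≢-sym yi)) (sw-at-fst z j A))))
  ... | no _ | yes refl | _ | _ = trans (sw-at-snd i z _) (trans (sw-elsewhere x y A i (≢-sym xi) (≢-sym yi))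
          (sym (trans (sw-elsewhere x y _ z (≢-sym xj) (≢-sym yj)) (sw-at-snd i z A))))
  ... | no zi | no zj | yes refl | _ = trans (sw-elsewhere i j _ z zi zj) (trans (sw-at-fst z y A)
          (sym (trans (sw-at-fst z y _) (sw-elsewhere i j A y yi yj))))
  ... | no zi | no zj | no _ | yes refl = trans (sw-elsewhere i j _ z zi zj) (trans (sw-at-snd x z A)
          (sym (trans (sw-at-snd x z _) (sw-elsewhere i j A x xi xj))))
  ... | no zi | no zj | no zx | no zy = trans (sw-elsewhere i j _ z zi zj) (trans (sw-elsewhere x y A z zx zy)
          (sym (trans (sw-elsewhere x y _ z zx zy) (sw-elsewhere i j A z zi zj))))

-- Boolean bookkeeping

∧-elim : ∀ {a b} → a ∧ b ≡ true → a ≡ true × b ≡ true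
∧-elim {true} {true} _ = refl , refl

∧-intro : ∀ {a b} → a ≡ true → b ≡ true → a ∧ b ≡ true
∧-intro refl refl = refl

∨-elim : ∀ {a b} → a ∨ b ≡ true → a ≡ true ⊎ b ≡ true
∨-elim {true} _ = inj₁ refl
∨-elim {false} h = inj₂ h

∨-introˡ : ∀ {a b} → a ≡ true → a ∨ b ≡ true
∨-introˡ refl = refl

∨-introʳ : ∀ {a b} → b ≡ true → a ∨ b ≡ true
∨-introʳ {true} _ = refl
∨-introʳ {false} h = h

not-elim : ∀ {a} → not a ≡ true → a ≡ false
not-elim {false} _ = refl

not-intro : ∀ {a} → a ≡ false → not a ≡ true
not-intro refl = refl

true≢false : ∀ {a} → a ≡ true → a ≡ false → ⊥
true≢false refl ()

≢true⇒false : ∀ {a} → (a ≡ true → ⊥) → a ≡ false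
≢true⇒false {true} h = ⊥-elim (h refl)
≢true⇒false {false} h = refl

≢false⇒true : ∀ {a} → (a ≡ false → ⊥) → a ≡ true
≢false⇒true {true} h = refl
≢false⇒true {false} h = ⊥-elim (h refl)

true⊎false : ∀ b → b ≡ true ⊎ b ≡ false
true⊎false true = inj₁ refl
true⊎false false = inj₂ refl

≡-by-cases : ∀ {a b : Bool} → (a ≡ true → b ≡ true) → (b ≡ true → a ≡ true) → a ≡ b
≡-by-cases {true} f g = sym (f refl)
≡-by-cases {false} {true} f g = g refl
≡-by-cases {false} {false} f g = refl

-- The effect of an exchange on intersection sizes

card-sw-∩-≤ : ∀ {n} (i j : Fin n) A B → lookup A i ≡ true → lookup A j ≡ false →
  lookup B i ≡ true ⊎ lookup B j ≡ false → ∣ sw i j A ∩ B ∣ ≤ ∣ A ∩ B ∣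
card-sw-∩-≤ i j A B Ai Aj h with lookup A i | lookup A j | lookup B i | lookup B j | card-sw-∩ i j A B
card-sw-∩-≤ i j A B refl refl (inj₁ refl) | _ | _ | _ | true | eq = ≤-reflexive (+-cancelʳ-≡ 1 _ _ eq)
card-sw-∩-≤ i j A B refl refl (inj₁ refl) | _ | _ | _ | false | eq = ≤-trans (m≤m+n _ 1) (≤-reflexive (trans eq (+-identityʳ _)))
card-sw-∩-≤ i j A B refl refl (inj₂ refl) | _ | _ | b | _ | eq = ≤-trans (m≤m+n _ _) (≤-reflexive (trans eq (+-identityʳ _)))

card-sw-∩-suc : ∀ {n} (i j : Fin n) A B → lookup A i ≡ true → lookup A j ≡ false →
  lookup B i ≡ true → lookup B j ≡ false → suc ∣ sw i j A ∩ B ∣ ≡ ∣ A ∩ B ∣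
card-sw-∩-suc i j A B Ai Aj Bi Bj with lookup A i | lookup A j | lookup B i | lookup B j | card-sw-∩ i j A B
card-sw-∩-suc i j A B refl refl refl refl | _ | _ | _ | _ | eq = trans (+-comm 1 _) (trans eq (+-identityʳ _))

card-sw-∩-≡ : ∀ {n} (i j : Fin n) A B → lookup B i ≡ lookup B j → ∣ sw i j A ∩ B ∣ ≡ ∣ A ∩ B ∣
card-sw-∩-≡ i j A B h with lookup B i | lookup B j | card-sw-∩ i j A B
... | b | _ | eq with h
... | refl = +-cancelʳ-≡ (⟦ lookup A i ∧ b ⟧ + ⟦ lookup A j ∧ b ⟧) _ _
               (trans eq (cong (∣ A ∩ B ∣ +_) (+-comm ⟦ lookup A j ∧ b ⟧ ⟦ lookup A i ∧ b ⟧)))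

card-sw-∩-sw : ∀ {n} (i j : Fin n) A B → ∣ sw i j A ∩ sw i j B ∣ ≡ ∣ A ∩ B ∣
card-sw-∩-sw i j A B = combine (∣ sw i j A ∩ sw i j B ∣) (∣ A ∩ sw i j B ∣) (∣ A ∩ B ∣)
    ⟦ lookup A i ∧ lookup B j ⟧ ⟦ lookup A j ∧ lookup B i ⟧ ⟦ lookup A j ∧ lookup B j ⟧ ⟦ lookup A i ∧ lookup B i ⟧
    first second
  where
  first : ∣ sw i j A ∩ sw i j B ∣ + (⟦ lookup A i ∧ lookup B j ⟧ + ⟦ lookup A j ∧ lookup B i ⟧) ≡
          ∣ A ∩ sw i j B ∣ + (⟦ lookup A j ∧ lookup B j ⟧ + ⟦ lookup A i ∧ lookup B i ⟧)
  first = subst₂ (λ x y → ∣ sw i j A ∩ sw i j B ∣ + (⟦ lookup A i ∧ x ⟧ + ⟦ lookup A j ∧ y ⟧) ≡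
                          ∣ A ∩ sw i j B ∣ + (⟦ lookup A j ∧ x ⟧ + ⟦ lookup A i ∧ y ⟧))
          (sw-at-fst i j B) (sw-at-snd i j B) (card-sw-∩ i j A (sw i j B))
  second : ∣ A ∩ sw i j B ∣ + (⟦ lookup A i ∧ lookup B i ⟧ + ⟦ lookup A j ∧ lookup B j ⟧) ≡
           ∣ A ∩ B ∣ + (⟦ lookup A i ∧ lookup B j ⟧ + ⟦ lookup A j ∧ lookup B i ⟧)
  second = trans (cong₂ _+_ (cong ∣_∣ (∩-comm A (sw i j B)))
                            (cong₂ (λ x y → ⟦ x ⟧ + ⟦ y ⟧) (∧-comm (lookup A i) _) (∧-comm (lookup A j) _)))
           (trans (card-sw-∩ i j B A) (cong₂ _+_ (cong ∣_∣ (∩-comm B A))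
             (trans (cong₂ (λ x y → ⟦ x ⟧ + ⟦ y ⟧) (∧-comm (lookup B j) _) (∧-comm (lookup B i) _)) refl)))
  combine : ∀ s m c p q r u → s + (p + q) ≡ m + (r + u) → m + (u + r) ≡ c + (p + q) → s ≡ c
  combine s m c p q r u h₁ h₂ = +-cancelʳ-≡ (p + q) s c (trans h₁ (trans (cong (m +_) (+-comm r u)) h₂))

card-sw : ∀ {n} (i j : Fin n) A → ∣ sw i j A ∣ ≡ ∣ A ∣
card-sw i j A = trans (sym (cong ∣_∣ (∩-idem (sw i j A)))) (trans (card-sw-∩-sw i j A A) (cong ∣_∣ (∩-idem A)))

-- Families of subsets

Family : ℕ → Set
Family n = Subset n → Bool

Intersecting : ∀ {n} → ℕ → ℕ → Family n → Set
Intersecting k t F = (∀ A → F A ≡ true → ∣ A ∣ ≡ k) × (∀ A B → F A ≡ true → F B ≡ true → t ≤ ∣ A ∩ B ∣)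

weight : ∀ {n} → (Subset n → ℕ) → Family n → ℕ
weight {n} w F = ∑ (allSubsets n) (λ A → ⟦ F A ⟧ * w A)

size : ∀ {n} → Family n → ℕ
size = weight (λ _ → 1)

∑-subsets-mono-< : ∀ {n} {f g : Subset n → ℕ} (A₀ : Subset n) → (∀ A → f A ≤ g A) → f A₀ < g A₀ →
  ∑ (allSubsets n) f < ∑ (allSubsets n) g
∑-subsets-mono-< {n} {f} {g} A₀ le lt = begin-strict
  ∑ S f                                 <⟨ n<1+n _ ⟩
  1 + ∑ S f                             ≡⟨ cong (_+ ∑ S f) (sym (∑-δˡ A₀ (λ _ → 1))) ⟩
  ∑ S (λ A → δ A₀ A * 1) + ∑ S f        ≡⟨ sym (∑-+ S _ f) ⟩
  ∑ S (λ A → δ A₀ A * 1 + f A)          ≤⟨ ∑-mono S pointwise ⟩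
  ∑ S g                                 ∎
  where
  open ≤-Reasoning
  S = allSubsets n
  pointwise : ∀ A → δ A₀ A * 1 + f A ≤ g A
  pointwise A with δ≡0⊎≡ A₀ A
  ... | inj₁ p rewrite p = le A
  ... | inj₂ refl rewrite δ-refl A₀ = lt

size-positive : ∀ {n} (F : Family n) A → F A ≡ true → 1 ≤ size F
size-positive F A h = ≤-trans (≤-reflexive (cong (λ b → ⟦ b ⟧ * 1) (sym h))) (term≤∑-subsets (λ B → ⟦ F B ⟧ * 1) A)

size-mono : ∀ {n} {F G : Family n} → (∀ A → F A ≡ true → G A ≡ true) → size F ≤ size G
size-mono {n} {F} {G} h = ∑-mono (allSubsets n) pointwise
  where
  pointwise : ∀ A → ⟦ F A ⟧ * 1 ≤ ⟦ G A ⟧ * 1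
  pointwise A with F A in eq
  ... | false = z≤n
  ... | true rewrite h A eq = ≤-refl

weight-≤ : ∀ {n} (w : Subset n → ℕ) (F : Family n) → weight w F ≤ ∑ (allSubsets n) w
weight-≤ {n} w F = ∑-mono (allSubsets n) (λ A → ⟦⟧*≤ (F A) (w A))
  where
  ⟦⟧*≤ : ∀ b m → ⟦ b ⟧ * m ≤ m
  ⟦⟧*≤ true m = ≤-reflexive (+-identityʳ m)
  ⟦⟧*≤ false m = z≤n

weight-mono : ∀ {n} (F : Family n) {v w : Subset n → ℕ} → (∀ A → F A ≡ true → v A ≤ w A) → weight v F ≤ weight w F
weight-mono {n} F {v} {w} h = ∑-mono (allSubsets n) pointwise
  where
  pointwise : ∀ A → ⟦ F A ⟧ * v A ≤ ⟦ F A ⟧ * w A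
  pointwise A with F A in eq
  ... | false = z≤n
  ... | true = *-monoʳ-≤ 1 (h A eq)

weight-const : ∀ {n} (F : Family n) {w : Subset n → ℕ} c → (∀ A → F A ≡ true → w A ≡ c) → weight w F ≡ size F * c
weight-const {n} F {w} c h = trans (∑-cong (allSubsets n) pointwise) (∑-*ʳ (allSubsets n) (λ A → ⟦ F A ⟧ * 1) c)
  where
  pointwise : ∀ A → ⟦ F A ⟧ * w A ≡ ⟦ F A ⟧ * 1 * c
  pointwise A with F A in eq
  ... | false = refl
  ... | true = cong (λ x → x + 0) (h A eq)

-- Shifts and pushes are both of this form.
replace : ∀ {n} → Family n → Family n → Family n → Family n
replace F R U A = (F A ∧ not (R A)) ∨ U A

replace-elim : ∀ {n} (F R U : Family n) A → replace F R U A ≡ true → (F A ≡ true × R A ≡ false) ⊎ U A ≡ true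
replace-elim F R U A h with ∨-elim h
... | inj₁ p = inj₁ (proj₁ (∧-elim p) , not-elim (proj₂ (∧-elim {F A} p)))
... | inj₂ q = inj₂ q

replace-old : ∀ {n} (F R U : Family n) A → F A ≡ true → R A ≡ false → replace F R U A ≡ true
replace-old F R U A p q = ∨-introˡ (∧-intro p (not-intro q))

replace-new : ∀ {n} (F R U : Family n) A → U A ≡ true → replace F R U A ≡ true
replace-new F R U A = ∨-introʳ

replace-intersecting : ∀ {n k t} (F R U : Family n) → Intersecting k t F →
  (∀ A → U A ≡ true → ∣ A ∣ ≡ k) →
  (∀ A Z → U A ≡ true → F Z ≡ true → R Z ≡ false → t ≤ ∣ A ∩ Z ∣) →
  (∀ A Z → U A ≡ true → U Z ≡ true → t ≤ ∣ A ∩ Z ∣) →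
  Intersecting k t (replace F R U)
replace-intersecting {k = k} {t} F R U (Fk , Ft) Uk UF UU = card , meet
  where
  card : ∀ A → replace F R U A ≡ true → ∣ A ∣ ≡ k
  card A h with replace-elim F R U A h
  ... | inj₁ (p , _) = Fk A p
  ... | inj₂ q = Uk A q
  meet : ∀ A B → replace F R U A ≡ true → replace F R U B ≡ true → t ≤ ∣ A ∩ B ∣
  meet A B h h′ with replace-elim F R U A h | replace-elim F R U B h′
  ... | inj₁ (p , _) | inj₁ (q , _) = Ft A B p q
  ... | inj₁ (p , p′) | inj₂ q = subst (λ Z → t ≤ ∣ Z ∣) (∩-comm B A) (UF B A q p p′)
  ... | inj₂ p | inj₁ (q , q′) = UF A B p q q′
  ... | inj₂ p | inj₂ q = UU A B p q

weight-replace : ∀ {n} (w : Subset n → ℕ) (F R U : Family n) →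
  (∀ A → R A ≡ true → F A ≡ true) → (∀ A → U A ≡ true → F A ≡ false) →
  weight w (replace F R U) + weight w R ≡ weight w F + weight w U
weight-replace {n} w F R U R⊆F U∩F = trans (sym (∑-+ S _ _)) (trans (∑-cong S pointwise) (∑-+ S _ _))
  where
  S = allSubsets n
  pointwise : ∀ A → ⟦ replace F R U A ⟧ * w A + ⟦ R A ⟧ * w A ≡ ⟦ F A ⟧ * w A + ⟦ U A ⟧ * w A
  pointwise A with F A in f | R A in r | U A in u
  ... | true | true | false = sym (+-identityʳ (w A + 0))
  ... | true | false | false = refl
  ... | false | false | true = +-identityʳ (w A + 0)
  ... | false | false | false = refl
  ... | false | true | _ = ⊥-elim (true≢false (R⊆F A r) f)
  ... | true | _ | true = ⊥-elim (true≢false f (U∩F A u))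

weight-∘sw : ∀ {n} (w : Subset n → ℕ) (F : Family n) i j → weight w (λ A → F (sw i j A)) ≡ weight (λ A → w (sw i j A)) F
weight-∘sw {n} w F i j = trans
  (∑-cong (allSubsets n) (λ A → cong (λ B → ⟦ F (sw i j A) ⟧ * w B) (sym (sw-involutive i j A))))
  (∑-involution (sw i j) (sw-involutive i j) (λ A → ⟦ F A ⟧ * w (sw i j A)))

-- Left shifts

Movable : ∀ {n} → Family n → Fin n → Fin n → Family n
Movable F i j A = (F A ∧ lookup A j) ∧ (not (lookup A i) ∧ not (F (sw i j A)))

-- The Erdős-Ko-Rado compression from `j` to `i`.
shift : ∀ {n} → Family n → Fin n → Fin n → Family n
shift F i j = replace F (Movable F i j) (λ A → Movable F i j (sw i j A))

module _ {n} (F : Family n) (i j : Fin n) where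

  movable-elim : ∀ A → Movable F i j A ≡ true →
    (F A ≡ true × lookup A j ≡ true) × (lookup A i ≡ false × F (sw i j A) ≡ false)
  movable-elim A h with ∧-elim {F A ∧ lookup A j} h
  ... | p , q = ∧-elim p , (not-elim (proj₁ (∧-elim q)) , not-elim (proj₂ (∧-elim {not (lookup A i)} q)))

  movable-intro : ∀ A → F A ≡ true → lookup A j ≡ true → lookup A i ≡ false → F (sw i j A) ≡ false → Movable F i j A ≡ true
  movable-intro A p q r s = ∧-intro (∧-intro p q) (∧-intro (not-intro r) (not-intro s))

  movable-sw-elim : ∀ A → Movable F i j (sw i j A) ≡ true →
    (F (sw i j A) ≡ true × lookup A i ≡ true) × (lookup A j ≡ false × F A ≡ false)
  movable-sw-elim A h with movable-elim (sw i j A) h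
  ... | (p , q) , (r , s) = (p , trans (sym (sw-at-snd i j A)) q) ,
                            (trans (sym (sw-at-fst i j A)) r , subst (λ B → F B ≡ false) (sw-involutive i j A) s)

  -- The delicate pair is a moved set and a set `Z` that stayed. The move costs a common element
  -- only if `Z` contains `j` but not `i`; then `Z` stayed because its own exchange lies in `F`, and
  -- the two sets are compared after exchanging both.
  shift-intersecting : ∀ {k t} → Intersecting k t F → Intersecting k t (shift F i j)
  shift-intersecting {k} {t} IF@(Fk , Ft) =
    replace-intersecting F (Movable F i j) (λ A → Movable F i j (sw i j A)) IF card meet meet′
    where
    card : ∀ A → Movable F i j (sw i j A) ≡ true → ∣ A ∣ ≡ k
    card A h = trans (sym (card-sw i j A)) (Fk (sw i j A) (proj₁ (proj₁ (movable-sw-elim A h))))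
    meet : ∀ A Z → Movable F i j (sw i j A) ≡ true → F Z ≡ true → Movable F i j Z ≡ false → t ≤ ∣ A ∩ Z ∣
    meet A Z u c m with movable-sw-elim A u | true⊎false (lookup Z i) | true⊎false (lookup Z j)
    ... | (p , q) , (r , s) | inj₁ Zi | _ = ≤-trans (Ft (sw i j A) Z p c) (card-sw-∩-≤ i j A Z q r (inj₁ Zi))
    ... | (p , q) , (r , s) | inj₂ Zi | inj₂ Zj = ≤-trans (Ft (sw i j A) Z p c) (card-sw-∩-≤ i j A Z q r (inj₂ Zj))
    ... | (p , q) , (r , s) | inj₂ Zi | inj₁ Zj = ≤-trans (Ft (sw i j A) (sw i j Z) p swC) (≤-reflexive (card-sw-∩-sw i j A Z))
      where
      swC : F (sw i j Z) ≡ true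
      swC = ≢false⇒true (λ z → true≢false (movable-intro Z c Zj Zi z) m)
    meet′ : ∀ A Z → Movable F i j (sw i j A) ≡ true → Movable F i j (sw i j Z) ≡ true → t ≤ ∣ A ∩ Z ∣
    meet′ A Z u v = subst (t ≤_) (card-sw-∩-sw i j A Z)
      (Ft (sw i j A) (sw i j Z) (proj₁ (proj₁ (movable-sw-elim A u))) (proj₁ (proj₁ (movable-sw-elim Z v))))

  weight-shift : ∀ w → weight w (shift F i j) + weight w (Movable F i j) ≡
                       weight w F + weight (λ A → w (sw i j A)) (Movable F i j)
  weight-shift w = trans
    (weight-replace w F (Movable F i j) (λ A → Movable F i j (sw i j A))
      (λ A h → proj₁ (proj₁ (movable-elim A h))) (λ A h → proj₂ (proj₂ (movable-sw-elim A h))))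
    (cong (weight w F +_) (weight-∘sw w (Movable F i j) i j))

  weight-shift-≥ : ∀ w → (∀ A → lookup A j ≡ true → lookup A i ≡ false → w A ≤ w (sw i j A)) →
    weight w F ≤ weight w (shift F i j)
  weight-shift-≥ w h = +-cancelʳ-≤ (weight w (Movable F i j)) _ _
    (≤-trans (+-monoʳ-≤ (weight w F) (weight-mono (Movable F i j)
        (λ A m → h A (proj₂ (proj₁ (movable-elim A m))) (proj₁ (proj₂ (movable-elim A m))))))
      (≤-reflexive (sym (weight-shift w))))

  weight-shift-> : ∀ w → (∀ A → lookup A j ≡ true → lookup A i ≡ false → w A < w (sw i j A)) →
    ∀ A₀ → Movable F i j A₀ ≡ true → weight w F < weight w (shift F i j)
  weight-shift-> w h A₀ m₀ = +-cancelʳ-< (weight w (Movable F i j)) _ _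
    (<-≤-trans (+-monoʳ-< (weight w F) strict) (≤-reflexive (sym (weight-shift w))))
    where
    pointwise : ∀ A → ⟦ Movable F i j A ⟧ * w A ≤ ⟦ Movable F i j A ⟧ * w (sw i j A)
    pointwise A with Movable F i j A in m
    ... | false = z≤n
    ... | true = *-monoʳ-≤ 1 (<⇒≤ (h A (proj₂ (proj₁ (movable-elim A m))) (proj₁ (proj₂ (movable-elim A m)))))
    at₀ : ⟦ Movable F i j A₀ ⟧ * w A₀ < ⟦ Movable F i j A₀ ⟧ * w (sw i j A₀)
    at₀ = subst (λ b → ⟦ b ⟧ * w A₀ < ⟦ b ⟧ * w (sw i j A₀)) (sym m₀)
            (*-monoʳ-< 1 (h A₀ (proj₂ (proj₁ (movable-elim A₀ m₀))) (proj₁ (proj₂ (movable-elim A₀ m₀)))))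
    strict : weight w (Movable F i j) < weight (λ A → w (sw i j A)) (Movable F i j)
    strict = ∑-subsets-mono-< A₀ pointwise at₀

-- Exchanges of one element `p` for elements outside a set `L`

anyᶠ : ∀ {n} → (Fin n → Bool) → Bool
anyᶠ {zero} P = false
anyᶠ {suc n} P = P zero ∨ anyᶠ (λ i → P (suc i))

anyᶠ-elim : ∀ {n} (P : Fin n → Bool) → anyᶠ P ≡ true → ∃ λ i → P i ≡ true
anyᶠ-elim {suc n} P h with ∨-elim {P zero} h
... | inj₁ p = zero , p
... | inj₂ q with anyᶠ-elim (λ i → P (suc i)) q
... | i , r = suc i , r

anyᶠ-intro : ∀ {n} (P : Fin n → Bool) i → P i ≡ true → anyᶠ P ≡ true
anyᶠ-intro P zero h = ∨-introˡ h
anyᶠ-intro P (suc i) h = ∨-introʳ {P zero} (anyᶠ-intro (λ i → P (suc i)) i h)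

∑-fins-1 : ∀ n → ∑ (fins n) (λ _ → 1) ≡ n
∑-fins-1 zero = refl
∑-fins-1 (suc n) = trans (∑-fins-suc n (λ _ → 1)) (cong suc (∑-fins-1 n))

∑-fins-≟ : ∀ {n} (p : Fin n) → ∑ (fins n) (λ i → ⟦ does (i Fin.≟ p) ⟧) ≡ 1
∑-fins-≟ {suc n} zero = trans (∑-fins-suc n (λ i → ⟦ does (i Fin.≟ zero) ⟧)) (cong suc (∑-zero (fins n)))
∑-fins-≟ {suc n} (suc p) = trans (∑-fins-suc n (λ i → ⟦ does (i Fin.≟ suc p) ⟧)) (∑-fins-≟ p)

-- For a uniform family: membership depends only on the trace on `L`, since transpositions generate
-- all permutations of the outside.
InvariantOff : ∀ {n} → Subset n → Family n → Set
InvariantOff L F = ∀ x y A → lookup L x ≡ false → lookup L y ≡ false → F A ≡ true → F (sw x y A) ≡ true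

-- What closure under left shifts gives when L ∪ {p} is a prefix with last element p, freed from the
-- order of Fin n so that it also applies after complementation.
record Compressed {n} (L : Subset n) (p : Fin n) (F : Family n) : Set where
  field
    invariant : ∀ x y A → lookup L x ≡ false → x ≢ p → lookup L y ≡ false → y ≢ p → F A ≡ true → F (sw x y A) ≡ true
    into-L : ∀ x z A → lookup L x ≡ false → lookup L z ≡ true → lookup A x ≡ true → lookup A z ≡ false →
      F A ≡ true → F (sw x z A) ≡ true
    into-p : ∀ x A → lookup L x ≡ false → x ≢ p → lookup A x ≡ true → lookup A p ≡ false →
      F A ≡ true → F (sw x p A) ≡ true

module Push {n k t : ℕ} (F : Family n) (IF : Intersecting k t F) (L : Subset n) (p : Fin n)
            (Lp : lookup L p ≡ false) (CF : Compressed L p F) where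

  open Compressed CF

  Out : Fin n → Bool
  Out x = not (lookup L x) ∧ not (does (x Fin.≟ p))

  Out-elim : ∀ x → Out x ≡ true → lookup L x ≡ false × x ≢ p
  Out-elim x h with x Fin.≟ p
  ... | no x≢p = not-elim (proj₁ (∧-elim h)) , x≢p
  ... | yes _ = ⊥-elim (true≢false (proj₂ (∧-elim {not (lookup L x)} h)) refl)

  Out-intro : ∀ x → lookup L x ≡ false → x ≢ p → Out x ≡ true
  Out-intro x h q with x Fin.≟ p
  ... | no _ = ∧-intro (not-intro h) refl
  ... | yes r = ⊥-elim (q r)

  -- The members of F that witness its dependence on p.
  D : Family n
  D A = F A ∧ (lookup A p ∧ anyᶠ (λ x → Out x ∧ (not (lookup A x) ∧ not (F (sw p x A)))))

  D-elim : ∀ A → D A ≡ true → (F A ≡ true × lookup A p ≡ true) ×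
    (∃ λ x → Out x ≡ true × lookup A x ≡ false × F (sw p x A) ≡ false)
  D-elim A h with ∧-elim {F A} h
  ... | f , g with ∧-elim {lookup A p} g
  ... | Ap , a with anyᶠ-elim _ a
  ... | x , b with ∧-elim {Out x} b
  ... | o , c with ∧-elim {not (lookup A x)} c
  ... | d , e = (f , Ap) , (x , o , not-elim d , not-elim e)

  D⊆F : ∀ A → D A ≡ true → F A ≡ true
  D⊆F A h = proj₁ (proj₁ (D-elim A h))

  D∋p : ∀ A → D A ≡ true → lookup A p ≡ true
  D∋p A h = proj₂ (proj₁ (D-elim A h))

  D-intro : ∀ A x → F A ≡ true → lookup A p ≡ true → Out x ≡ true → lookup A x ≡ false → F (sw p x A) ≡ false → D A ≡ true
  D-intro A x f Ap o Ax g = ∧-intro f (∧-intro Ap (anyᶠ-intro _ x (∧-intro o (∧-intro (not-intro Ax) (not-intro g)))))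

  -- Outside elements missing from `A` are interchangeable by `invariant`, so the failure at the
  -- witness `x` is a failure at every `y`.
  D-all : ∀ A y → D A ≡ true → Out y ≡ true → lookup A y ≡ false → F (sw p y A) ≡ false
  D-all A y h o Ay with D-elim A h
  ... | _ , (x , ox , Ax , nf) = ≢true⇒false λ f → true≢false (moved f) nf
    where
    moved : F (sw p y A) ≡ true → F (sw p x A) ≡ true
    moved f with Out-elim x ox | Out-elim y o
    ... | Lx , x≢p | Ly , y≢p = subst (λ B → F B ≡ true)
      (trans (sw-conj p y x A y≢p x≢p) (cong (sw p x) (sw-fixes y x A (trans Ay (sym Ax)))))
      (invariant y x (sw p y A) Ly y≢p Lx x≢p f)

  -- The exchange carries a witness along; if the witness is itself `x` or `y`, the other one takes
  -- over.
  D-invariant : ∀ x y A → Out x ≡ true → Out y ≡ true → D A ≡ true → D (sw x y A) ≡ true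
  D-invariant x y A ox oy h with D-elim A h | Out-elim x ox | Out-elim y oy
  ... | (f , Ap) , (z , oz , Az , nf) | Lx , x≢p | Ly , y≢p = witness
    where
    f′ : F (sw x y A) ≡ true
    f′ = invariant x y A Lx x≢p Ly y≢p f
    Ap′ : lookup (sw x y A) p ≡ true
    Ap′ = trans (sw-elsewhere x y A p (≢-sym x≢p) (≢-sym y≢p)) Ap
    pulled : ∀ w → sw x y (sw p w (sw x y A)) ≡ sw p z A → F (sw p w (sw x y A)) ≡ false
    pulled w eq = ≢true⇒false λ g → true≢false (subst (λ B → F B ≡ true) eq (invariant x y _ Lx x≢p Ly y≢p g)) nf
    witness : D (sw x y A) ≡ true
    witness with z Fin.≟ x | z Fin.≟ y
    ... | yes refl | _ = D-intro (sw z y A) y f′ Ap′ oy (trans (sw-at-snd z y A) Az) (pulled y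
           (trans (sw-comm z y _) (trans (sw-conj p y z (sw z y A) y≢p x≢p)
             (cong (sw p z) (trans (sw-comm y z _) (sw-involutive z y A))))))
    ... | no _ | yes refl = D-intro (sw x z A) x f′ Ap′ ox (trans (sw-at-fst x z A) Az) (pulled x
           (trans (sw-conj p x z (sw x z A) x≢p y≢p) (cong (sw p z) (sw-involutive x z A))))
    ... | no z≢x | no z≢y = D-intro (sw x y A) z f′ Ap′ oz (trans (sw-elsewhere x y A z z≢x z≢y) Az) (pulled z
           (trans (sw-disjoint x y p z (sw x y A) (≢-sym x≢p) (≢-sym y≢p) z≢x z≢y) (cong (sw p z) (sw-involutive x y A))))

  Invariant : Family n → Set
  Invariant I = ∀ x y A → Out x ≡ true → Out y ≡ true → I A ≡ true → I (sw x y A) ≡ true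

  -- The shape of a pair in `D` that an exchange can spoil; for `t = a + 1` the traces on `L` have
  -- total size `∣ L ∣ + a`.
  Conflict : Subset n → Subset n → Set
  Conflict B Z = (∣ B ∩ L ∣ + ∣ Z ∩ L ∣ + 1 ≡ ∣ L ∣ + t) × (∀ z → lookup L z ≡ true → lookup B z ≡ true ⊎ lookup Z z ≡ true)

  -- With `∣ B ∩ Z ∣ ≡ t` there is nothing to spare. In `Z`, an element of `L` missing from both
  -- sets could replace `p`, and `x` could replace a common outside element; either would give a
  -- member of `F` meeting `B` in only `t - 1` elements. So `L` is covered, all common elements lie
  -- in `L` or equal `p`, and the count follows.
  conflict : ∀ B Z x → D B ≡ true → D Z ≡ true → Out x ≡ true → lookup B x ≡ false → lookup Z x ≡ false →
    ∣ B ∩ Z ∣ ≡ t → Conflict B Z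
  conflict B Z x dB dC ox Bx Zx eq = counted , covered
    where
    Bp = D∋p B dB
    Zp = D∋p Z dC
    fB = D⊆F B dB
    fC = D⊆F Z dC
    x≢p = proj₂ (Out-elim x ox)
    Lx = proj₁ (Out-elim x ox)
    smaller : ∀ u v → lookup Z u ≡ true → lookup Z v ≡ false → lookup B u ≡ true → lookup B v ≡ false →
      F (sw u v Z) ≡ true → ⊥
    smaller u v Cu Cv Bu Bv g = <-irrefl refl (begin-strict
      t                   ≤⟨ proj₂ IF (sw u v Z) B g fB ⟩
      ∣ sw u v Z ∩ B ∣     <⟨ ≤-reflexive (card-sw-∩-suc u v Z B Cu Cv Bu Bv) ⟩
      ∣ Z ∩ B ∣            ≡⟨ cong ∣_∣ (∩-comm Z B) ⟩
      ∣ B ∩ Z ∣            ≡⟨ eq ⟩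
      t                   ∎)
      where open ≤-Reasoning
    covered : ∀ z → lookup L z ≡ true → lookup B z ≡ true ⊎ lookup Z z ≡ true
    covered z Lz with true⊎false (lookup B z) | true⊎false (lookup Z z)
    ... | inj₁ b | _ = inj₁ b
    ... | inj₂ _ | inj₁ c = inj₂ c
    ... | inj₂ b | inj₂ c = ⊥-elim (smaller p z Zp c Bp b (into-L p z Z Lp Lz Zp c fC))
    disjoint : ∀ y → Out y ≡ true → lookup B y ∧ lookup Z y ≡ false
    disjoint y oy = ≢true⇒false λ h → smaller y x (proj₂ (∧-elim {lookup B y} h)) Zx (proj₁ (∧-elim h)) Bx
      (invariant y x Z (proj₁ (Out-elim y oy)) (proj₂ (Out-elim y oy)) Lx x≢p fC)
    pointwise : ∀ z → ⟦ lookup B z ∧ lookup L z ⟧ + ⟦ lookup Z z ∧ lookup L z ⟧ + ⟦ does (z Fin.≟ p) ⟧ ≡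
                      ⟦ lookup L z ⟧ + ⟦ lookup B z ∧ lookup Z z ⟧
    pointwise z with z Fin.≟ p
    pointwise z | yes refl rewrite Bp | Zp | Lp = refl
    pointwise z | no z≢p with lookup L z in Lz
    ... | false rewrite disjoint z (Out-intro z Lz z≢p) with lookup B z | lookup Z z
    ... | true | true = refl
    ... | true | false = refl
    ... | false | true = refl
    ... | false | false = refl
    pointwise z | no z≢p | true with lookup B z in Bz | lookup Z z in Zz | covered z Lz
    ... | true | true | _ = refl
    ... | true | false | _ = refl
    ... | false | true | _ = refl
    ... | false | false | inj₁ ()
    ... | false | false | inj₂ ()
    counted : ∣ B ∩ L ∣ + ∣ Z ∩ L ∣ + 1 ≡ ∣ L ∣ + t
    counted = begin
      ∣ B ∩ L ∣ + ∣ Z ∩ L ∣ + 1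
        ≡⟨ cong₂ _+_ (cong₂ _+_ (card-∩-∑ B L) (card-∩-∑ Z L)) (sym (∑-fins-≟ p)) ⟩
      ∑ N b + ∑ N c + ∑ N (λ z → ⟦ does (z Fin.≟ p) ⟧)
        ≡⟨ cong (_+ ∑ N (λ z → ⟦ does (z Fin.≟ p) ⟧)) (sym (∑-+ N b c)) ⟩
      ∑ N (λ z → b z + c z) + ∑ N (λ z → ⟦ does (z Fin.≟ p) ⟧)
        ≡⟨ sym (∑-+ N _ _) ⟩
      ∑ N (λ z → b z + c z + ⟦ does (z Fin.≟ p) ⟧)
        ≡⟨ ∑-cong N pointwise ⟩
      ∑ N (λ z → ⟦ lookup L z ⟧ + ⟦ lookup B z ∧ lookup Z z ⟧)
        ≡⟨ ∑-+ N _ _ ⟩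
      ∑ N (λ z → ⟦ lookup L z ⟧) + ∑ N (λ z → ⟦ lookup B z ∧ lookup Z z ⟧)
        ≡⟨ cong₂ _+_ (sym (card-∑ L)) (sym (card-∩-∑ B Z)) ⟩
      ∣ L ∣ + ∣ B ∩ Z ∣
        ≡⟨ cong (∣ L ∣ +_) eq ⟩
      ∣ L ∣ + t ∎
      where
      open ≡-Reasoning
      N = fins n
      b c : Fin n → ℕ
      b z = ⟦ lookup B z ∧ lookup L z ⟧
      c z = ⟦ lookup Z z ∧ lookup L z ⟧

  -- The sum is the number of elements available in exchange for `p`; below it is called `N`.
  out-count : ∀ A → lookup A p ≡ true →
    ∑ (fins n) (λ x → ⟦ Out x ∧ not (lookup A x) ⟧) + ∣ L ∣ + ∣ A ∣ ≡ n + ∣ A ∩ L ∣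
  out-count A Ap = begin
    ∑ N o + ∣ L ∣ + ∣ A ∣                           ≡⟨ cong₂ _+_ (cong (∑ N o +_) (card-∑ L)) (card-∑ A) ⟩
    ∑ N o + ∑ N l + ∑ N a                          ≡⟨ cong (_+ ∑ N a) (sym (∑-+ N o l)) ⟩
    ∑ N (λ x → o x + l x) + ∑ N a                  ≡⟨ sym (∑-+ N _ a) ⟩
    ∑ N (λ x → o x + l x + a x)                    ≡⟨ ∑-cong N pointwise ⟩
    ∑ N (λ x → 1 + ⟦ lookup A x ∧ lookup L x ⟧)    ≡⟨ ∑-+ N (λ _ → 1) _ ⟩
    ∑ N (λ _ → 1) + ∑ N (λ x → ⟦ lookup A x ∧ lookup L x ⟧) ≡⟨ cong₂ _+_ (∑-fins-1 n) (sym (card-∩-∑ A L)) ⟩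
    n + ∣ A ∩ L ∣                                  ∎
    where
    open ≡-Reasoning
    N = fins n
    o l a : Fin n → ℕ
    o x = ⟦ Out x ∧ not (lookup A x) ⟧
    l x = ⟦ lookup L x ⟧
    a x = ⟦ lookup A x ⟧
    pointwise : ∀ x → o x + l x + a x ≡ 1 + ⟦ lookup A x ∧ lookup L x ⟧
    pointwise x with x Fin.≟ p
    pointwise x | yes refl rewrite Ap | Lp = refl
    pointwise x | no _ with lookup L x | lookup A x
    ... | true | true = refl
    ... | true | false = refl
    ... | false | true = refl
    ... | false | false = refl

  in-count : ∀ A → lookup A p ≡ false → ∑ (fins n) (λ x → ⟦ Out x ∧ lookup A x ⟧) + ∣ A ∩ L ∣ ≡ ∣ A ∣
  in-count A Ap = trans (cong (∑ (fins n) (λ x → ⟦ Out x ∧ lookup A x ⟧) +_) (card-∩-∑ A L))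
    (trans (sym (∑-+ (fins n) _ _)) (trans (∑-cong (fins n) pointwise) (sym (card-∑ A))))
    where
    pointwise : ∀ x → ⟦ Out x ∧ lookup A x ⟧ + ⟦ lookup A x ∧ lookup L x ⟧ ≡ ⟦ lookup A x ⟧
    pointwise x with x Fin.≟ p
    pointwise x | yes refl rewrite Ap | Lp = refl
    pointwise x | no _ with lookup L x | lookup A x
    ... | true | true = refl
    ... | true | false = refl
    ... | false | true = refl
    ... | false | false = refl

  Lifted : Family n → Family n
  Lifted I A = not (lookup A p) ∧ anyᶠ (λ x → Out x ∧ (lookup A x ∧ I (sw p x A)))

  module Lift (I : Family n) (I⊆D : ∀ A → I A ≡ true → D A ≡ true) (inv : Invariant I) where

    U : Family n
    U = Lifted I

    U-elim : ∀ A → U A ≡ true → lookup A p ≡ false × (∃ λ x → Out x ≡ true × lookup A x ≡ true × I (sw p x A) ≡ true)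
    U-elim A h with ∧-elim {not (lookup A p)} h
    ... | f , a with anyᶠ-elim _ a
    ... | x , b with ∧-elim {Out x} b
    ... | o , c with ∧-elim {lookup A x} c
    ... | d , e = not-elim f , (x , o , d , e)

    U-intro : ∀ A x → lookup A p ≡ false → Out x ≡ true → lookup A x ≡ true → I (sw p x A) ≡ true → U A ≡ true
    U-intro A x Ap o Ax i = ∧-intro (not-intro Ap) (anyᶠ-intro _ x (∧-intro o (∧-intro Ax i)))

    U-all : ∀ A y → U A ≡ true → Out y ≡ true → lookup A y ≡ true → I (sw p y A) ≡ true
    U-all A y h oy Ay with U-elim A h
    ... | _ , (x , ox , Ax , i) = subst (λ B → I B ≡ true)
      (trans (sw-conj p x y A (proj₂ (Out-elim x ox)) (proj₂ (Out-elim y oy))) (cong (sw p y) (sw-fixes x y A (trans Ax (sym Ay)))))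
      (inv x y (sw p x A) ox oy i)

    U-∉F : ∀ A → U A ≡ true → F A ≡ false
    U-∉F A h with U-elim A h
    ... | Ap , (x , ox , Ax , i) = subst (λ B → F B ≡ false) (sw-involutive p x A)
      (D-all (sw p x A) x (I⊆D _ i) ox (trans (sw-at-snd p x A) Ap))

    U-card : ∀ A → U A ≡ true → ∣ A ∣ ≡ k
    U-card A h with U-elim A h
    ... | _ , (x , _ , _ , i) = trans (sym (card-sw p x A)) (proj₁ IF _ (D⊆F _ (I⊆D _ i)))

    module _ (R : Family n)
             (independent : ∀ B Z → I B ≡ true → D Z ≡ true → R Z ≡ false ⊎ I Z ≡ true → Conflict B Z → ⊥) where

      -- Exchanging `p` for `x` costs a common element only if `Z` contains `p` but not `x`. If `Z`
      -- is not in `D`, its own exchange lies in `F` and both sets are compared after exchange. If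
      -- it is in `D`, falling below `t` would make `B` and `Z` a conflict, which `independent`
      -- excludes.
      meets : ∀ A Z → U A ≡ true → F Z ≡ true → (D Z ≡ true → R Z ≡ false ⊎ I Z ≡ true) → t ≤ ∣ A ∩ Z ∣
      meets A Z u fC kept with U-elim A u
      ... | Ap , (x , ox , Ax , i) = byCases (true⊎false (lookup Z p)) (true⊎false (lookup Z x))
        where
        B = sw p x A
        dB = I⊆D B i
        fB = D⊆F B dB
        easy : lookup Z x ≡ true ⊎ lookup Z p ≡ false → t ≤ ∣ A ∩ Z ∣
        easy h = ≤-trans (proj₂ IF B Z fB fC)
          (≤-trans (≤-reflexive (cong (λ E → ∣ E ∩ Z ∣) (sw-comm p x A))) (card-sw-∩-≤ x p A Z Ax Ap h))
        byCases : lookup Z p ≡ true ⊎ lookup Z p ≡ false → lookup Z x ≡ true ⊎ lookup Z x ≡ false → t ≤ ∣ A ∩ Z ∣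
        byCases (inj₂ Zp) _ = easy (inj₂ Zp)
        byCases (inj₁ _) (inj₁ Zx) = easy (inj₁ Zx)
        byCases (inj₁ Zp) (inj₂ Zx) with true⊎false (D Z)
        ... | inj₂ nd = ≤-trans (proj₂ IF B (sw p x Z) fB swC) (≤-reflexive (card-sw-∩-sw p x A Z))
          where
          swC : F (sw p x Z) ≡ true
          swC = ≢false⇒true (λ z → true≢false (D-intro Z x fC Zp ox Zx z) nd)
        ... | inj₁ dC = ≮⇒≥ λ lt → independent B Z i dC (kept dC)
            (conflict B Z x dB dC ox (trans (sw-at-snd p x A) Ap) Zx
              (≤-antisym (subst (_≤ t) suc-eq lt) (proj₂ IF B Z fB fC)))
          where
          suc-eq : suc ∣ A ∩ Z ∣ ≡ ∣ B ∩ Z ∣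
          suc-eq = trans (cong (λ E → suc ∣ E ∩ Z ∣) (sym (sw-involutive p x A)))
            (card-sw-∩-suc p x B Z (trans (sw-at-fst p x A) Ax) (trans (sw-at-snd p x A) Ap) Zp Zx)

      -- Undoing the exchange in `Z` gives a member of `I` with no further element of `A`, as `p` is
      -- not in `A`. For this case `independent` also covers `Z` in `I`.
      meets′ : ∀ A Z → U A ≡ true → U Z ≡ true → t ≤ ∣ A ∩ Z ∣
      meets′ A Z u v with U-elim Z v
      ... | Zp , (y , oy , Zy , i) = ≤-trans (meets A (sw p y Z) u (D⊆F _ (I⊆D _ i)) (λ _ → inj₂ i))
                                              (card-∩-mono A (sw p y Z) A Z sub)
        where
        sub : ∀ z → lookup A z ≡ true → lookup (sw p y Z) z ≡ true → lookup A z ∧ lookup Z z ≡ true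
        sub z Az Sz with z Fin.≟ p | z Fin.≟ y
        ... | yes refl | _ = ⊥-elim (true≢false Az (proj₁ (U-elim A u)))
        ... | no _ | yes refl = ∧-intro Az Zy
        ... | no z≢p | no z≢y = ∧-intro Az (trans (sym (sw-elsewhere p y Z z z≢p z≢y)) Sz)

      replaced-intersecting : Intersecting k t (replace F R U)
      replaced-intersecting = replace-intersecting F R U IF U-card
        (λ A Z u fC r → meets A Z u fC (λ _ → inj₁ r)) meets′

    U-card-∩L : ∀ i → (∀ A → I A ≡ true → ∣ A ∩ L ∣ ≡ i) → ∀ A → U A ≡ true → ∣ A ∩ L ∣ ≡ i
    U-card-∩L i h A u with U-elim A u
    ... | _ , (x , ox , _ , j) = trans (sym (card-sw-∩-≡ p x A L (trans Lp (sym (proj₁ (Out-elim x ox)))))) (h _ j)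

    -- Counts pairs of a member of `I` and an element exchanged for `p`: each member has `N` such
    -- elements, and each lifted set has `K` outside elements, every one of which leads back to `I`
    -- by invariance.
    double-count : ∀ i N K → (∀ A → I A ≡ true → ∣ A ∩ L ∣ ≡ i) → N + ∣ L ∣ + k ≡ n + i → K + i ≡ k →
      size I * N ≡ size U * K
    double-count i N K h eqN eqK = begin
      size I * N
        ≡⟨ sym (weight-const I N constO) ⟩
      ∑ S (λ A → ⟦ I A ⟧ * ∑ X (λ x → ⟦ Out x ∧ not (lookup A x) ⟧))
        ≡⟨ ∑-cong S (λ A → sym (∑-*ˡ X ⟦ I A ⟧ _)) ⟩
      ∑ S (λ A → ∑ X (λ x → ⟦ I A ⟧ * ⟦ Out x ∧ not (lookup A x) ⟧))
        ≡⟨ ∑-swap S X _ ⟩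
      ∑ X (λ x → ∑ S (λ A → ⟦ I A ⟧ * ⟦ Out x ∧ not (lookup A x) ⟧))
        -- Substituting `sw p x A` for `A` counts the same pair at the lifted set instead of at the
        -- member of `I`.
        ≡⟨ ∑-cong X (λ x → sym (∑-involution (sw p x) (sw-involutive p x) (λ A → ⟦ I A ⟧ * ⟦ Out x ∧ not (lookup A x) ⟧))) ⟩
      ∑ X (λ x → ∑ S (λ A → ⟦ I (sw p x A) ⟧ * ⟦ Out x ∧ not (lookup (sw p x A) x) ⟧))
        ≡⟨ ∑-cong X (λ x → ∑-cong S (pointwise x)) ⟩
      ∑ X (λ x → ∑ S (λ A → ⟦ U A ⟧ * ⟦ Out x ∧ lookup A x ⟧))
        ≡⟨ sym (∑-swap S X _) ⟩
      ∑ S (λ A → ∑ X (λ x → ⟦ U A ⟧ * ⟦ Out x ∧ lookup A x ⟧))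
        ≡⟨ ∑-cong S (λ A → ∑-*ˡ X ⟦ U A ⟧ _) ⟩
      ∑ S (λ A → ⟦ U A ⟧ * ∑ X (λ x → ⟦ Out x ∧ lookup A x ⟧))
        ≡⟨ weight-const U K constI ⟩
      size U * K ∎
      where
      open ≡-Reasoning
      S = allSubsets n
      X = fins n
      out inn : Subset n → ℕ
      out A = ∑ X (λ x → ⟦ Out x ∧ not (lookup A x) ⟧)
      inn A = ∑ X (λ x → ⟦ Out x ∧ lookup A x ⟧)
      constO : ∀ A → I A ≡ true → out A ≡ N
      constO A j = +-cancelʳ-≡ (∣ L ∣ + k) (out A) N (trans (sym (+-assoc (out A) ∣ L ∣ k))
        (trans (cong (λ m → out A + ∣ L ∣ + m) (sym (proj₁ IF A (D⊆F A (I⊆D A j)))))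
        (trans (out-count A (D∋p A (I⊆D A j))) (trans (cong (n +_) (h A j)) (trans (sym eqN) (+-assoc N ∣ L ∣ k))))))
      constI : ∀ A → U A ≡ true → inn A ≡ K
      constI A u = +-cancelʳ-≡ i (inn A) K (trans (cong (inn A +_) (sym (U-card-∩L i h A u)))
        (trans (in-count A (proj₁ (U-elim A u))) (trans (U-card A u) (sym eqK))))
      pointwise : ∀ x A → ⟦ I (sw p x A) ⟧ * ⟦ Out x ∧ not (lookup (sw p x A) x) ⟧ ≡ ⟦ U A ⟧ * ⟦ Out x ∧ lookup A x ⟧
      pointwise x A = trans (⟦⟧-∧ (I (sw p x A)) _) (trans (cong ⟦_⟧ (≡-by-cases forth back)) (sym (⟦⟧-∧ (U A) _)))
        where
        ⟦⟧-∧ : ∀ b c → ⟦ b ⟧ * ⟦ c ⟧ ≡ ⟦ b ∧ c ⟧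
        ⟦⟧-∧ true c = +-identityʳ ⟦ c ⟧
        ⟦⟧-∧ false c = refl
        forth : I (sw p x A) ∧ (Out x ∧ not (lookup (sw p x A) x)) ≡ true → U A ∧ (Out x ∧ lookup A x) ≡ true
        forth g with ∧-elim {I (sw p x A)} g
        ... | j , g′ with ∧-elim {Out x} g′
        ... | o , c = ∧-intro (U-intro A x Ap o Ax j) (∧-intro o Ax)
          where
          Ap = trans (sym (sw-at-snd p x A)) (not-elim c)
          Ax = trans (sym (sw-at-fst p x A)) (D∋p _ (I⊆D _ j))
        back : U A ∧ (Out x ∧ lookup A x) ≡ true → I (sw p x A) ∧ (Out x ∧ not (lookup (sw p x A) x)) ≡ true
        back g with ∧-elim {U A} g
        ... | u , g′ with ∧-elim {Out x} g′
        ... | o , Ax = ∧-intro (U-all A x u o Ax) (∧-intro o (not-intro (trans (sw-at-snd p x A) (proj₁ (U-elim A u)))))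

    U-moved : ∀ x y A → Out x ≡ true → Out y ≡ true → U A ≡ true → lookup A x ≡ true → U (sw x y A) ≡ true
    U-moved x y A ox oy u Ax with Out-elim x ox | Out-elim y oy
    ... | _ , x≢p | _ , y≢p = U-intro (sw x y A) y
      (trans (sw-elsewhere x y A p (≢-sym x≢p) (≢-sym y≢p)) (proj₁ (U-elim A u))) oy (trans (sw-at-snd x y A) Ax)
      (subst (λ B → I B ≡ true) (sw-conj p x y A x≢p y≢p) (inv x y (sw p x A) ox oy (U-all A x u ox Ax)))

    U-invariant : Invariant U
    U-invariant x y A ox oy u with true⊎false (lookup A x) | true⊎false (lookup A y)
    ... | inj₁ Ax | _ = U-moved x y A ox oy u Ax
    ... | inj₂ _ | inj₁ Ay = subst (λ B → U B ≡ true) (sw-comm y x A) (U-moved y x A oy ox u Ay)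
    ... | inj₂ Ax | inj₂ Ay = subst (λ B → U B ≡ true) (sym (sw-fixes x y A (trans Ax (sym Ay)))) u

    module _ (R : Family n) (R⊆D : ∀ A → R A ≡ true → D A ≡ true) (invR : Invariant R)
             (D∖R⊆I : ∀ A → D A ≡ true → R A ≡ false → I A ≡ true) (I∩R : ∀ A → I A ≡ true → R A ≡ false) where

      -- Here `D` is the disjoint union of `I` and `R`. Members of `R` lacked an exchange and are
      -- removed; for members of `I` the missing exchanges are added. Exchanges into `p` are already
      -- available by `into-p`.
      replaced-exchange-p : ∀ y A → lookup L y ≡ false → y ≢ p → replace F R U A ≡ true → replace F R U (sw p y A) ≡ true
      replaced-exchange-p y A Ly y≢p fA with true⊎false (lookup A p) | true⊎false (lookup A y) | replace-elim F R U A fA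
      ... | inj₁ Ap | inj₁ Ay | _ = subst (λ B → replace F R U B ≡ true) (sym (sw-fixes p y A (trans Ap (sym Ay)))) fA
      ... | inj₂ Ap | inj₂ Ay | _ = subst (λ B → replace F R U B ≡ true) (sym (sw-fixes p y A (trans Ap (sym Ay)))) fA
      ... | inj₁ Ap | inj₂ Ay | inj₂ u = ⊥-elim (true≢false Ap (proj₁ (U-elim A u)))
      ... | inj₁ Ap | inj₂ Ay | inj₁ (f , r) = byD (true⊎false (D A))
        where
        Sp = trans (sw-at-fst p y A) Ay
        byD : D A ≡ true ⊎ D A ≡ false → replace F R U (sw p y A) ≡ true
        byD (inj₁ d) = replace-new F R U _ (U-intro (sw p y A) y Sp (Out-intro y Ly y≢p) (trans (sw-at-snd p y A) Ap)
          (subst (λ B → I B ≡ true) (sym (sw-involutive p y A)) (D∖R⊆I A d r)))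
        byD (inj₂ d) = replace-old F R U _ (≢false⇒true λ g → true≢false (D-intro A y f Ap (Out-intro y Ly y≢p) Ay g) d)
          (≢true⇒false λ r′ → true≢false (D∋p _ (R⊆D _ r′)) Sp)
      ... | inj₂ Ap | inj₁ Ay | inj₂ u = replace-old F R U _ (D⊆F _ (I⊆D _ i)) (I∩R _ i)
        where i = U-all A y u (Out-intro y Ly y≢p) Ay
      ... | inj₂ Ap | inj₁ Ay | inj₁ (f , r) = replace-old F R U _
        (subst (λ B → F B ≡ true) (sw-comm y p A) (into-p y A Ly y≢p Ay Ap f))
        (≢true⇒false λ r′ → true≢false f (subst (λ B → F B ≡ false) (sw-involutive p y A)
          (D-all (sw p y A) y (R⊆D _ r′) (Out-intro y Ly y≢p) (trans (sw-at-snd p y A) Ap))))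

      replaced-invariant : InvariantOff L (replace F R U)
      replaced-invariant x y A Lx Ly fA with x Fin.≟ p | y Fin.≟ p
      ... | yes refl | yes refl = subst (λ B → replace F R U B ≡ true) (sym (sw-fixes x x A refl)) fA
      ... | yes refl | no y≢p = replaced-exchange-p y A Ly y≢p fA
      ... | no x≢p | yes refl = subst (λ B → replace F R U B ≡ true) (sw-comm y x A) (replaced-exchange-p x A Lx x≢p fA)
      ... | no x≢p | no y≢p with replace-elim F R U A fA
      ...   | inj₂ u = replace-new F R U _ (U-invariant x y A (Out-intro x Lx x≢p) (Out-intro y Ly y≢p) u)
      ...   | inj₁ (f , r) = replace-old F R U _ (invariant x y A Lx x≢p Ly y≢p f)
              (≢true⇒false λ r′ → true≢false (subst (λ B → R B ≡ true) (sw-involutive x y A)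
                (invR x y _ (Out-intro x Lx x≢p) (Out-intro y Ly y≢p) r′)) r)

-- Counting exchanges: what maximality of size forces

does-elim : {P : Set} (P? : Dec P) → does P? ≡ true → P
does-elim (yes p) _ = p

does-intro : {P : Set} (P? : Dec P) → P → does P? ≡ true
does-intro (yes _) _ = refl
does-intro (no ¬p) p = ⊥-elim (¬p p)

size-witness : ∀ {n} (F : Family n) → 1 ≤ size F → ∃ λ A → F A ≡ true
size-witness {n} F h with ∑-pigeonhole (allSubsets n) (λ _ → 0) (λ A → ⟦ F A ⟧ * 1)
                            (subst (_< size F) (sym (∑-zero (allSubsets n))) h)
... | A , lt = A , positive lt
  where
  positive : ∀ {b} → 0 < ⟦ b ⟧ * 1 → b ≡ true
  positive {true} _ = refl

card-∩-≤ : ∀ {n} (A B : Subset n) → ∣ A ∩ B ∣ ≤ ∣ B ∣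
card-∩-≤ A B = ≤-trans (card-∩-mono A B B B (λ i _ b → ∧-intro b b)) (≤-reflexive (cong ∣_∣ (∩-idem B)))

size-split : ∀ {n} (F P : Family n) → size (λ A → F A ∧ P A) + size (λ A → F A ∧ not (P A)) ≡ size F
size-split {n} F P = trans (sym (∑-+ (allSubsets n) _ _)) (∑-cong (allSubsets n) (λ A → pointwise (F A) (P A)))
  where
  pointwise : ∀ f b → ⟦ f ∧ b ⟧ * 1 + ⟦ f ∧ not b ⟧ * 1 ≡ ⟦ f ⟧ * 1
  pointwise true true = refl
  pointwise true false = refl
  pointwise false b = refl

complement-count : ∀ {n} (L A : Subset n) → ∑ (fins n) (λ z → ⟦ lookup L z ∧ not (lookup A z) ⟧) + ∣ A ∩ L ∣ ≡ ∣ L ∣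
complement-count {n} L A = trans (cong (∑ (fins n) (λ z → ⟦ lookup L z ∧ not (lookup A z) ⟧) +_) (card-∩-∑ A L))
  (trans (sym (∑-+ (fins n) _ _)) (trans (∑-cong (fins n) (λ z → pointwise (lookup L z) (lookup A z))) (sym (card-∑ L))))
  where
  pointwise : ∀ l b → ⟦ l ∧ not b ⟧ + ⟦ b ∧ l ⟧ ≡ ⟦ l ⟧
  pointwise true true = refl
  pointwise true false = refl
  pointwise false true = refl
  pointwise false false = refl

-- Here `d` and `d′` are the sizes of two conflicting halves, `u` and `u′` those of their exchanged
-- sets. If neither replacement gained, `d * K′ < d * K′` would follow, strict because of `e ≥ 1`.
pair-arithmetic : ∀ d d′ u u′ K K′ e → d * (K′ + e) ≡ u * K → d′ * (K + e) ≡ u′ * K′ → u ≤ d′ → u′ ≤ d → 1 ≤ d → 1 ≤ e → ⊥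
pair-arithmetic d d′ u u′ K K′ e h h′ u≤ u′≤ d≥1 e≥1 = <-irrefl refl (begin-strict
  d * K′               <⟨ m<m+n (d * K′) (*-mono-≤ d≥1 e≥1) ⟩
  d * K′ + d * e       ≡⟨ sym (*-distribˡ-+ d K′ e) ⟩
  d * (K′ + e)         ≡⟨ h ⟩
  u * K                ≤⟨ *-monoˡ-≤ K u≤ ⟩
  d′ * K               ≤⟨ *-monoʳ-≤ d′ (m≤m+n K e) ⟩
  d′ * (K + e)         ≡⟨ h′ ⟩
  u′ * K′              ≤⟨ *-monoˡ-≤ K′ u′≤ ⟩
  d * K′               ∎)
  where open ≤-Reasoning

module Gain {n : ℕ} (q a e : ℕ) (n≡ : n ≡ q + q + a + e) (e≥1 : 1 ≤ e)
            (F : Family n) (IF : Intersecting (q + a) (suc a) F)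
            (maximum : ∀ (F′ : Family n) → Intersecting (q + a) (suc a) F′ → size F′ ≤ size F)
            (L : Subset n) (p : Fin n) (Lp : lookup L p ≡ false) (CF : Compressed L p F) where

  open Push F IF L p Lp CF

  ℓ : ℕ
  ℓ = ∣ L ∣

  no-gain : (R U : Family n) → (∀ A → R A ≡ true → F A ≡ true) → (∀ A → U A ≡ true → F A ≡ false) →
    Intersecting (q + a) (suc a) (replace F R U) → size U ≤ size R
  no-gain R U R⊆F U∩F I′ = +-cancelˡ-≤ (size F) _ _ (≤-trans (≤-reflexive (sym (weight-replace (λ _ → 1) F R U R⊆F U∩F)))
    (+-monoˡ-≤ (size R) (maximum _ I′)))

  Level : ℕ → Family n
  Level i A = D A ∧ does (∣ A ∩ L ∣ ≟ i)

  Level⊆D : ∀ i A → Level i A ≡ true → D A ≡ true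
  Level⊆D i A h = proj₁ (∧-elim h)

  Level-card : ∀ i A → Level i A ≡ true → ∣ A ∩ L ∣ ≡ i
  Level-card i A h = does-elim (∣ A ∩ L ∣ ≟ i) (proj₂ (∧-elim {D A} h))

  Level-intro : ∀ i A → D A ≡ true → ∣ A ∩ L ∣ ≡ i → Level i A ≡ true
  Level-intro i A d h = ∧-intro d (does-intro (∣ A ∩ L ∣ ≟ i) h)

  Level-invariant : ∀ i → Invariant (Level i)
  Level-invariant i x y A ox oy h = Level-intro i (sw x y A) (D-invariant x y A ox oy (Level⊆D i A h))
    (trans (card-sw-∩-≡ x y A L (trans (proj₁ (Out-elim x ox)) (sym (proj₁ (Out-elim y oy))))) (Level-card i A h))

  -- The witness `x` for `D` is one available exchange and, once made, one available return; hence
  -- both numbers are positive.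
  degrees : ∀ A i → D A ≡ true → ∣ A ∩ L ∣ ≡ i →
    ∃ λ N → ∃ λ K → N + ℓ + (q + a) ≡ n + i × K + i ≡ q + a × 1 ≤ N × 1 ≤ K
  degrees A i d h with D-elim A d
  ... | (f , Ap) , (x , ox , Ax , _) =
    ∑ (fins n) out , ∑ (fins n) inn ,
    trans (cong (∑ (fins n) out + ℓ +_) (sym (proj₁ IF A f))) (trans (out-count A Ap) (cong (n +_) h)) ,
    trans (cong (∑ (fins n) inn +_) (trans (sym h) (sym (card-sw-∩-≡ p x A L (trans Lp (sym (proj₁ (Out-elim x ox))))))))
      (trans (in-count (sw p x A) (trans (sw-at-fst p x A) Ax)) (trans (card-sw p x A) (proj₁ IF A f))) ,
    ≤-trans (≤-reflexive (sym (cong ⟦_⟧ (∧-intro ox (not-intro Ax))))) (term≤∑-fins out x) ,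
    ≤-trans (≤-reflexive (sym (cong ⟦_⟧ (∧-intro ox (trans (sw-at-snd p x A) Ap))))) (term≤∑-fins inn x)
    where
    out inn : Fin n → ℕ
    out z = ⟦ Out z ∧ not (lookup A z) ⟧
    inn z = ⟦ Out z ∧ lookup (sw p x A) z ⟧

  module LevelLift (i : ℕ) = Lift (Level i) (Level⊆D i) (Level-invariant i)

  -- Members of trace size `i` conflict only with those of trace size `j`, and all of the latter are
  -- removed; by `i ≢ j` the former do not conflict with each other.
  pair-no-gain : ∀ i j → i + j ≡ ℓ + a → i ≢ j → size (Lifted (Level i)) ≤ size (Level j)
  pair-no-gain i j i+j i≢j = no-gain (Level j) (Lifted (Level i)) (λ A h → D⊆F A (Level⊆D j A h)) U-∉F
    (replaced-intersecting (Level j) independent)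
    where
    open LevelLift i
    independent : ∀ B Z → Level i B ≡ true → D Z ≡ true → Level j Z ≡ false ⊎ Level i Z ≡ true → Conflict B Z → ⊥
    independent B Z b c kept (eq , _) = excluded kept
      where
      C≡j : ∣ Z ∩ L ∣ ≡ j
      C≡j = +-cancelˡ-≡ i _ _ (suc-injective (trans (sym (+-comm (i + ∣ Z ∩ L ∣) 1))
        (trans (cong (λ m → m + ∣ Z ∩ L ∣ + 1) (sym (Level-card i B b))) (trans eq (trans (+-suc ℓ a) (cong suc (sym i+j)))))))
      excluded : Level j Z ≡ false ⊎ Level i Z ≡ true → ⊥
      excluded (inj₁ r) = true≢false (Level-intro j Z c C≡j) r
      excluded (inj₂ r) = i≢j (trans (sym (Level-card i Z r)) C≡j)

  degrees-sum : ∀ i j N K′ → i + j ≡ ℓ + a → N + ℓ + (q + a) ≡ n + i → K′ + j ≡ q + a → N ≡ K′ + e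
  degrees-sum i j N K′ i+j eqN eqK′ = +-cancelʳ-≡ (ℓ + (q + a) + j) N (K′ + e) (begin
    N + (ℓ + (q + a) + j)          ≡⟨ lem₁ N ℓ (q + a) j ⟩
    N + ℓ + (q + a) + j            ≡⟨ cong (_+ j) eqN ⟩
    n + i + j                      ≡⟨ +-assoc n i j ⟩
    n + (i + j)                    ≡⟨ cong₂ _+_ n≡ i+j ⟩
    q + q + a + e + (ℓ + a)        ≡⟨ lem₂ q a e ℓ ⟩
    (q + a) + e + (ℓ + (q + a))    ≡⟨ cong (λ m → m + e + (ℓ + (q + a))) (sym eqK′) ⟩
    K′ + j + e + (ℓ + (q + a))     ≡⟨ lem₃ K′ j e (ℓ + (q + a)) ⟩
    K′ + e + (ℓ + (q + a) + j)     ∎)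
    where
    open ≡-Reasoning
    lem₁ : ∀ x y z w → x + (y + z + w) ≡ x + y + z + w
    lem₁ = solve-∀
    lem₂ : ∀ q a e l → q + q + a + e + (l + a) ≡ (q + a) + e + (l + (q + a))
    lem₂ = solve-∀
    lem₃ : ∀ x y z w → x + y + z + w ≡ x + z + (w + y)
    lem₃ = solve-∀

  -- If the other half is empty, the exchanged sets are pure gain; otherwise both replacements are
  -- available and one of them gains.
  pair-empty : ∀ A i j → D A ≡ true → ∣ A ∩ L ∣ ≡ i → i + j ≡ ℓ + a → i ≢ j → ⊥
  pair-empty A i j dA Ai i+j i≢j with degrees A i dA Ai
  ... | N , K , eqN , eqK , N≥1 , _ = contradicted (size (Level j)) refl
    where
    di≥1 : 1 ≤ size (Level i)
    di≥1 = size-positive (Level i) A (Level-intro i A dA Ai)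
    countᵢ = LevelLift.double-count i i N K (Level-card i) eqN eqK
    contradicted : ∀ d′ → size (Level j) ≡ d′ → ⊥
    contradicted zero eq = <⇒≢ (*-mono-≤ di≥1 N≥1) (sym (trans countᵢ (cong (_* K)
      (n≤0⇒n≡0 (≤-trans (pair-no-gain i j i+j i≢j) (≤-reflexive eq))))))
    contradicted (suc _) eq with size-witness (Level j) (≤-trans (s≤s z≤n) (≤-reflexive (sym eq)))
    ... | Z , cj with degrees Z j (Level⊆D j Z cj) (Level-card j Z cj)
    ... | N′ , K′ , eqN′ , eqK′ , _ , _ = pair-arithmetic (size (Level i)) (size (Level j)) _ _ K K′ e
      (trans (cong (size (Level i) *_) (sym (degrees-sum i j N K′ i+j eqN eqK′))) countᵢ)
      (trans (cong (size (Level j) *_) (sym (degrees-sum j i N′ K j+i eqN′ eqK)))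
             (LevelLift.double-count j j N′ K′ (Level-card j) eqN′ eqK′))
      (pair-no-gain i j i+j i≢j) (pair-no-gain j i j+i (≢-sym i≢j)) di≥1 e≥1
      where
      j+i : j + i ≡ ℓ + a
      j+i = trans (+-comm j i) i+j

  -- Only trace sizes with `2i = ∣ L ∣ + a` survive `pair-empty`; in particular `D` is empty when
  -- `∣ L ∣ - a` is odd.
  D-middle : ∀ A → D A ≡ true → ∃ λ s → ℓ ≡ a + s + s × ∣ A ∩ L ∣ ≡ a + s
  D-middle A dA with ∣ A ∩ L ∣ ≟ ℓ + a ∸ ∣ A ∩ L ∣
  ... | no i≢j = ⊥-elim (pair-empty A _ _ dA refl (m+[n∸m]≡n (≤-trans (card-∩-≤ A L) (m≤m+n ℓ a))) i≢j)
  ... | yes i≡j = s , ℓ≡ , i≡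
    where
    i = ∣ A ∩ L ∣
    2i : i + i ≡ ℓ + a
    2i = trans (cong (i +_) i≡j) (m+[n∸m]≡n (≤-trans (card-∩-≤ A L) (m≤m+n ℓ a)))
    a≤i : a ≤ i
    a≤i = +-cancelˡ-≤ ℓ a i (≤-trans (≤-reflexive (sym 2i)) (+-monoˡ-≤ i (card-∩-≤ A L)))
    s = i ∸ a
    i≡ : i ≡ a + s
    i≡ = sym (m+[n∸m]≡n a≤i)
    ℓ≡ : ℓ ≡ a + s + s
    ℓ≡ = +-cancelʳ-≡ a ℓ (a + s + s) (trans (sym 2i) (trans (cong₂ _+_ i≡ i≡) (lem a s)))
      where
      lem : ∀ a s → a + s + (a + s) ≡ a + s + s + a
      lem = solve-∀

  module Middle (s : ℕ) (ℓ≡ : ℓ ≡ a + s + s) where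

    M : Family n
    M = Level (a + s)

    Without With : Fin n → Family n
    Without z A = M A ∧ not (lookup A z)
    With z A = M A ∧ lookup A z

    M-∋z : ∀ z x y A → lookup L z ≡ true → Out x ≡ true → Out y ≡ true → lookup (sw x y A) z ≡ lookup A z
    M-∋z z x y A Lz ox oy = sw-elsewhere x y A z
      (λ z≡x → true≢false Lz (trans (cong (lookup L) z≡x) (proj₁ (Out-elim x ox))))
      (λ z≡y → true≢false Lz (trans (cong (lookup L) z≡y) (proj₁ (Out-elim y oy))))

    Without-invariant : ∀ z → lookup L z ≡ true → Invariant (Without z)
    Without-invariant z Lz x y A ox oy h = ∧-intro (Level-invariant (a + s) x y A ox oy (proj₁ (∧-elim h)))
      (trans (cong not (M-∋z z x y A Lz ox oy)) (proj₂ (∧-elim {M A} h)))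

    With-invariant : ∀ z → lookup L z ≡ true → Invariant (With z)
    With-invariant z Lz x y A ox oy h = ∧-intro (Level-invariant (a + s) x y A ox oy (proj₁ (∧-elim h)))
      (trans (M-∋z z x y A Lz ox oy) (proj₂ (∧-elim {M A} h)))

    Without⊆D : ∀ z A → Without z A ≡ true → D A ≡ true
    Without⊆D z A h = Level⊆D (a + s) A (proj₁ (∧-elim h))

    With⊆D : ∀ z A → With z A ≡ true → D A ≡ true
    With⊆D z A h = Level⊆D (a + s) A (proj₁ (∧-elim h))

    Without-card : ∀ z A → Without z A ≡ true → ∣ A ∩ L ∣ ≡ a + s
    Without-card z A h = Level-card (a + s) A (proj₁ (∧-elim h))

    module _ (z : Fin n) (Lz : lookup L z ≡ true) where

      open Lift (Without z) (Without⊆D z) (Without-invariant z Lz) public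

      -- A conflict covers `L`, so two conflicting members cannot both avoid `z`.
      middle-independent : ∀ B Z → Without z B ≡ true → D Z ≡ true → With z Z ≡ false ⊎ Without z Z ≡ true → Conflict B Z → ⊥
      middle-independent B Z b c kept (eq , cover) = excluded kept
        where
        C≡ : ∣ Z ∩ L ∣ ≡ a + s
        C≡ = +-cancelˡ-≡ (a + s) _ _ (suc-injective (trans (sym (+-comm (a + s + ∣ Z ∩ L ∣) 1))
          (trans (cong (λ m → m + ∣ Z ∩ L ∣ + 1) (sym (Without-card z B b)))
          (trans eq (trans (+-suc ℓ a) (cong suc (trans (cong (_+ a) ℓ≡) (lem a s))))))))
          where
          lem : ∀ a s → a + s + s + a ≡ a + s + (a + s)
          lem = solve-∀
        Zz : lookup Z z ≡ true
        Zz with cover z Lz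
        ... | inj₁ Bz = ⊥-elim (true≢false Bz (not-elim (proj₂ (∧-elim {M B} b))))
        ... | inj₂ Zz = Zz
        excluded : With z Z ≡ false ⊎ Without z Z ≡ true → ⊥
        excluded (inj₁ r) = true≢false (∧-intro (Level-intro (a + s) Z c C≡) Zz) r
        excluded (inj₂ r) = true≢false Zz (not-elim (proj₂ (∧-elim {M Z} r)))

      middle-intersecting : Intersecting (q + a) (suc a) (replace F (With z) (Lifted (Without z)))
      middle-intersecting = replaced-intersecting (With z) middle-independent

    -- Each member of `M` is counted once for each of the `s` elements of `L` that it misses.
    sum-Without : ∑ (fins n) (λ z → ⟦ lookup L z ⟧ * size (Without z)) ≡ size M * s
    sum-Without = begin
      ∑ X (λ z → ⟦ lookup L z ⟧ * size (Without z))
        ≡⟨ ∑-cong X (λ z → sym (∑-*ˡ S ⟦ lookup L z ⟧ _)) ⟩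
      ∑ X (λ z → ∑ S (λ A → ⟦ lookup L z ⟧ * (⟦ Without z A ⟧ * 1)))
        ≡⟨ ∑-swap X S _ ⟩
      ∑ S (λ A → ∑ X (λ z → ⟦ lookup L z ⟧ * (⟦ Without z A ⟧ * 1)))
        ≡⟨ ∑-cong S (λ A → ∑-cong X (λ z → pointwise (lookup L z) (M A) (lookup A z))) ⟩
      ∑ S (λ A → ∑ X (λ z → ⟦ M A ⟧ * ⟦ lookup L z ∧ not (lookup A z) ⟧))
        ≡⟨ ∑-cong S (λ A → ∑-*ˡ X ⟦ M A ⟧ _) ⟩
      weight (λ A → ∑ X (λ z → ⟦ lookup L z ∧ not (lookup A z) ⟧)) M
        ≡⟨ weight-const M s count ⟩
      size M * s ∎
      where
      open ≡-Reasoning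
      X = fins n
      S = allSubsets n
      pointwise : ∀ l m b → ⟦ l ⟧ * (⟦ m ∧ not b ⟧ * 1) ≡ ⟦ m ⟧ * ⟦ l ∧ not b ⟧
      pointwise true true true = refl
      pointwise true true false = refl
      pointwise true false b = refl
      pointwise false true b = refl
      pointwise false false b = refl
      count : ∀ A → M A ≡ true → ∑ X (λ z → ⟦ lookup L z ∧ not (lookup A z) ⟧) ≡ s
      count A m = +-cancelʳ-≡ (a + s) _ s (trans (cong (∑ X (λ z → ⟦ lookup L z ∧ not (lookup A z) ⟧) +_) (sym (Level-card (a + s) A m)))
        (trans (complement-count L A) (trans ℓ≡ (+-comm (a + s) s))))

    -- Averaging over `z` in `L`. The factor `K` clears the denominator of the ratio `N / K` between
    -- lifted sets and members. The slack `c` is 0 for a strict gain and 1 for no loss.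
    middle-pigeonhole : ∀ c N K → N + ℓ + (q + a) ≡ n + (a + s) → K + (a + s) ≡ q + a →
      ℓ * (K * size M) < size M * s * (N + K) + ℓ * c →
      ∃ λ z → lookup L z ≡ true × K * size M < K * (size (Lifted (Without z)) + size (Without z)) + c
    middle-pigeonhole c N K eqN eqK lt with ∑-pigeonhole (fins n) f g (subst₂ _<_ (sym sum-f) (sym sum-g) lt)
      where
      f g : Fin n → ℕ
      f z = ⟦ lookup L z ⟧ * (K * size M)
      g z = ⟦ lookup L z ⟧ * (K * (size (Lifted (Without z)) + size (Without z)) + c)
      sum-f : ∑ (fins n) f ≡ ℓ * (K * size M)
      sum-f = trans (∑-*ʳ (fins n) (λ z → ⟦ lookup L z ⟧) (K * size M)) (cong (_* (K * size M)) (sym (card-∑ L)))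
      pointwise : ∀ z → g z ≡ ⟦ lookup L z ⟧ * size (Without z) * (N + K) + ⟦ lookup L z ⟧ * c
      pointwise z with lookup L z in Lz
      ... | false = refl
      ... | true = trans (*-identityˡ _) (trans (cong (_+ c) (begin
          K * (u + d)            ≡⟨ *-distribˡ-+ K u d ⟩
          K * u + K * d          ≡⟨ cong (_+ K * d) (trans (*-comm K u) (sym (double-count z Lz (a + s) N K (Without-card z) eqN eqK))) ⟩
          d * N + K * d          ≡⟨ lem d N K ⟩
          1 * d * (N + K)        ∎)) (cong (1 * d * (N + K) +_) (sym (*-identityˡ c))))
        where
        open ≡-Reasoning
        u = size (Lifted (Without z))
        d = size (Without z)
        lem : ∀ d N K → d * N + K * d ≡ 1 * d * (N + K)
        lem = solve-∀
      sum-g : ∑ (fins n) g ≡ size M * s * (N + K) + ℓ * c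
      sum-g = trans (∑-cong (fins n) pointwise) (trans (∑-+ (fins n) _ _) (cong₂ _+_
        (trans (∑-*ʳ (fins n) _ (N + K)) (cong (_* (N + K)) sum-Without))
        (trans (∑-*ʳ (fins n) _ c) (cong (_* c) (sym (card-∑ L))))))
    ... | z , h = z , inside (lookup L z) h
      where
      inside : ∀ b {x y} → ⟦ b ⟧ * x < ⟦ b ⟧ * y → b ≡ true × x < y
      inside true {x} {y} h = refl , subst₂ _<_ (+-identityʳ x) (+-identityʳ y) h

  -- Replacing nothing by nothing meets the hypotheses of `replaced-invariant`, whose case analysis
  -- is thereby reused.
  no-witness : (∀ A → D A ≡ true → ⊥) → InvariantOff L F
  no-witness empty x y A Lx Ly f = unreplace (replaced-invariant ∅ (λ _ ()) (λ _ _ _ _ _ ())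
      (λ B d _ → ⊥-elim (empty B d)) (λ _ ()) x y A Lx Ly (replace-old F ∅ (Lifted ∅) A f refl))
    where
    ∅ : Family n
    ∅ _ = false
    open Lift ∅ (λ _ ()) (λ _ _ _ _ _ ())
    unreplace : ∀ {B} → replace F ∅ (Lifted ∅) B ≡ true → F B ≡ true
    unreplace {B} h with replace-elim F ∅ (Lifted ∅) B h
    ... | inj₁ (g , _) = g
    ... | inj₂ u with U-elim B u
    ... | _ , (_ , _ , _ , ())

  middle-degrees : ∀ s A → ℓ ≡ a + s + s → D A ≡ true → ∣ A ∩ L ∣ ≡ a + s →
    ∃ λ K → K + e + ℓ + (q + a) ≡ n + (a + s) × K + (a + s) ≡ q + a × q ≡ K + s × 1 ≤ K
  middle-degrees s A ℓ≡ dA Ai with degrees A (a + s) dA Ai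
  ... | N , K , eqN , eqK , _ , K≥1 = K ,
    subst (λ m → m + ℓ + (q + a) ≡ n + (a + s)) (degrees-sum (a + s) (a + s) N K 2i eqN eqK) eqN , eqK ,
    +-cancelʳ-≡ a q (K + s) (trans (sym eqK) (lem′ K a s)) , K≥1
    where
    lem : ∀ a s → a + s + (a + s) ≡ a + s + s + a
    lem = solve-∀
    lem′ : ∀ K a s → K + (a + s) ≡ K + s + a
    lem′ = solve-∀
    2i : a + s + (a + s) ≡ ℓ + a
    2i = trans (lem a s) (cong (_+ a) (sym ℓ≡))

  -- As `q = K + s`, cancelling `s * a` turns the condition on `q` into the one needed for
  -- averaging.
  middle-≤ : ∀ s K → q ≡ K + s → q * a ≤ (a + e) * s → K * a ≤ e * s
  middle-≤ s K refl h = +-cancelʳ-≤ (s * a) _ _ (≤-trans (≤-reflexive (sym (*-distribʳ-+ a K s)))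
    (≤-trans h (≤-reflexive (lem a e s))))
    where
    lem : ∀ a e s → (a + e) * s ≡ e * s + s * a
    lem = solve-∀

  middle-< : ∀ s K → q ≡ K + s → q * a < (a + e) * s → K * a < e * s
  middle-< s K refl h = +-cancelʳ-< (s * a) _ _ (≤-<-trans (≤-reflexive (sym (*-distribʳ-+ a K s)))
    (<-≤-trans h (≤-reflexive (lem a e s))))
    where
    lem : ∀ a e s → (a + e) * s ≡ e * s + s * a
    lem = solve-∀

  -- Once expanded, the two sides of the averaging bound share `s * (K + K)` and differ only in
  -- `K * a` against `e * s`.
  expandˡ : ∀ s K d → ℓ ≡ a + s + s → ℓ * (K * d) ≡ d * (K * a + s * (K + K))
  expandˡ s K d eq = trans (cong (_* (K * d)) eq) (lem a s K d)
    where
    lem : ∀ a s K d → (a + s + s) * (K * d) ≡ d * (K * a + s * (K + K))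
    lem = solve-∀

  expandʳ : ∀ s K d → d * s * (K + e + K) ≡ d * (e * s + s * (K + K))
  expandʳ s K d = lem e s K d
    where
    lem : ∀ e s K d → d * s * (K + e + K) ≡ d * (e * s + s * (K + K))
    lem = solve-∀

  -- A member of `D` would make the middle level nonempty, and some `z` would then allow a strict
  -- gain. The hypothesis is vacuous when no `s` fits `ℓ`.
  push-strict : (∀ s → ℓ ≡ a + s + s → q * a < (a + e) * s) → InvariantOff L F
  push-strict gap = no-witness empty
    where
    empty : ∀ A → D A ≡ true → ⊥
    empty A dA with D-middle A dA
    ... | s , ℓ≡ , Ai with middle-degrees s A ℓ≡ dA Ai
    ... | K , eqN , eqK , q≡ , K≥1 = final (middle-pigeonhole 0 (K + e) K eqN eqK bound)
      where
      open Middle s ℓ≡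
      M≥1 : 1 ≤ size M
      M≥1 = size-positive M A (Level-intro (a + s) A dA Ai)
      bound : ℓ * (K * size M) < size M * s * (K + e + K) + ℓ * 0
      bound = begin-strict
        ℓ * (K * size M)                         ≡⟨ expandˡ s K (size M) ℓ≡ ⟩
        size M * (K * a + s * (K + K))           <⟨ *-monoʳ-< (size M) {{>-nonZero M≥1}} (+-monoˡ-< (s * (K + K)) (middle-< s K q≡ (gap s ℓ≡))) ⟩
        size M * (e * s + s * (K + K))           ≡⟨ sym (expandʳ s K (size M)) ⟩
        size M * s * (K + e + K)                 ≤⟨ m≤m+n _ _ ⟩
        size M * s * (K + e + K) + ℓ * 0         ∎
        where open ≤-Reasoning
      final : (∃ λ z → lookup L z ≡ true × K * size M < K * (size (Lifted (Without z)) + size (Without z)) + 0) → ⊥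
      final (z , Lz , lt) = <⇒≱ (*-cancelˡ-< K _ _ (subst (K * size M <_) (+-identityʳ _) lt))
        (≤-trans (+-monoˡ-≤ (size (Without z)) (no-gain (With z) (Lifted (Without z)) (λ B w → D⊆F B (With⊆D z B w))
                    (U-∉F z Lz) (middle-intersecting z Lz)))
                 (≤-reflexive (size-split M (λ B → lookup B z))))

  -- A suitable `z` still gives a replacement that loses nothing. All sets removed or added have
  -- trace size `a + s` on `L`, so the weight does not drop either.
  push-tie : ∀ s → ℓ ≡ a + s + s → 1 ≤ ℓ → q * a ≤ (a + e) * s →
    ∃ λ F′ → Intersecting (q + a) (suc a) F′ × size F ≤ size F′ ×
             weight (λ A → ∣ A ∩ L ∣) F ≤ weight (λ A → ∣ A ∩ L ∣) F′ × InvariantOff L F′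
  push-tie s ℓ≡ ℓ≥1 gap = byM (1 ≤? size M)
    where
    open Middle s ℓ≡
    w : Subset n → ℕ
    w A = ∣ A ∩ L ∣
    D⊆M : ∀ A → D A ≡ true → M A ≡ true
    D⊆M A dA with D-middle A dA
    ... | s′ , ℓ≡′ , Ai = Level-intro (a + s) A dA (trans Ai (cong (a +_) (double s′ s
        (+-cancelˡ-≡ a _ _ (trans (sym (+-assoc a s′ s′)) (trans (sym ℓ≡′) (trans ℓ≡ (+-assoc a s s))))))))
      where
      double : ∀ x y → x + x ≡ y + y → x ≡ y
      double x y h with <-cmp x y
      ... | tri≈ _ x≡y _ = x≡y
      ... | tri< x<y _ _ = ⊥-elim (<⇒≢ (+-mono-< x<y x<y) h)
      ... | tri> _ _ y<x = ⊥-elim (<⇒≢ (+-mono-< y<x y<x) (sym h))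
    byM : Dec (1 ≤ size M) → _
    byM (no none) = F , IF , ≤-refl , ≤-refl , no-witness (λ A dA → none (size-positive M A (D⊆M A dA)))
    byM (yes M≥1) with size-witness M M≥1
    ... | A , mA with middle-degrees s A ℓ≡ (Level⊆D (a + s) A mA) (Level-card (a + s) A mA)
    ... | K , eqN , eqK , q≡ , K≥1 = final (middle-pigeonhole 1 (K + e) K eqN eqK bound)
      where
      bound : ℓ * (K * size M) < size M * s * (K + e + K) + ℓ * 1
      bound = begin-strict
        ℓ * (K * size M)                         ≡⟨ expandˡ s K (size M) ℓ≡ ⟩
        size M * (K * a + s * (K + K))           ≤⟨ *-monoʳ-≤ (size M) (+-monoˡ-≤ (s * (K + K)) (middle-≤ s K q≡ gap)) ⟩
        size M * (e * s + s * (K + K))           ≡⟨ sym (expandʳ s K (size M)) ⟩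
        size M * s * (K + e + K)                 <⟨ m<m+n _ (≤-trans ℓ≥1 (≤-reflexive (sym (*-identityʳ ℓ)))) ⟩
        size M * s * (K + e + K) + ℓ * 1         ∎
        where open ≤-Reasoning
      final : (∃ λ z → lookup L z ≡ true × K * size M < K * (size (Lifted (Without z)) + size (Without z)) + 1) → _
      final (z , Lz , lt) = replace F (With z) U′ , middle-intersecting z Lz ,
          grows (λ _ → 1) 1 (λ _ _ → refl) (λ _ _ → refl) ,
          grows w (a + s) (λ B h → Level-card (a + s) B (proj₁ (∧-elim h))) (U-card-∩L z Lz (a + s) (Without-card z)) ,
          replaced-invariant z Lz (With z) (With⊆D z) (With-invariant z Lz)
            (λ B d r → ∧-intro (D⊆M B d) (not-intro (≢true⇒false λ Bz → true≢false (∧-intro (D⊆M B d) Bz) r)))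
            (λ B i → ≢true⇒false λ h → true≢false (proj₂ (∧-elim {M B} h)) (not-elim (proj₂ (∧-elim {M B} i))))
        where
        U′ = Lifted (Without z)
        With≤U : size (With z) ≤ size U′
        With≤U = +-cancelʳ-≤ (size (Without z)) _ _ (≤-trans (≤-reflexive (size-split M (λ B → lookup B z)))
          (*-cancelˡ-≤ K {{>-nonZero K≥1}} (s≤s⁻¹ (≤-trans lt (≤-reflexive (+-comm _ 1))))))
        grows : ∀ v c → (∀ B → With z B ≡ true → v B ≡ c) → (∀ B → U′ B ≡ true → v B ≡ c) →
          weight v F ≤ weight v (replace F (With z) U′)
        grows v c onR onU = +-cancelʳ-≤ (weight v (With z)) _ _ (≤-trans
          (+-monoʳ-≤ (weight v F) (≤-trans (≤-reflexive (weight-const (With z) c onR))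
             (≤-trans (*-monoˡ-≤ c With≤U) (≤-reflexive (sym (weight-const U′ c onU))))))
          (≤-reflexive (sym (weight-replace v F (With z) U′ (λ B h → D⊆F B (With⊆D z B h)) (U-∉F z Lz)))))

-- `P` is not assumed decidable, so a maximiser is only handed to a continuation into `⊥`: whenever
-- a better family turns up the climb restarts from it, and `b` bounds the weight still to be
-- gained.
maximise : ∀ {n} (P : Family n → Set) (w : Subset n → ℕ) (F : Family n) → P F →
  (∀ G → P G → (∀ H → P H → weight w H ≤ weight w G) → ⊥) → ⊥
maximise {n} P w F pF k = climb (∑ (allSubsets n) w) F pF (m≤n+m _ _)
  where
  climb : ∀ b G → P G → ∑ (allSubsets n) w ≤ weight w G + b → ⊥
  climb zero G pG h = k G pG (λ H _ → ≤-trans (weight-≤ w H) (≤-trans h (≤-reflexive (+-identityʳ _))))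
  climb (suc b) G pG h = k G pG (λ H pH → ≮⇒≥ λ lt → climb b H pH (≤-trans h
    (≤-trans (≤-reflexive (+-suc (weight w G) b)) (+-monoˡ-≤ b lt))))

-- Prefixes of the ground set and descent along them

T-true : ∀ {b} → T b → b ≡ true
T-true {true} _ = refl

true-T : ∀ {b} → b ≡ true → T b
true-T refl = _

module _ {n : ℕ} where

  initSeg-∈ : ∀ s (x : Fin n) → toℕ x < s → lookup (initSeg n s) x ≡ true
  initSeg-∈ s x h = trans (lookup∘tabulate (λ i → toℕ i <ᵇ s) x) (T-true (<⇒<ᵇ h))

  ∈-initSeg : ∀ s (x : Fin n) → lookup (initSeg n s) x ≡ true → toℕ x < s
  ∈-initSeg s x h = <ᵇ⇒< (toℕ x) s (true-T (trans (sym (lookup∘tabulate (λ i → toℕ i <ᵇ s) x)) h))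

  initSeg-∉ : ∀ s (x : Fin n) → s ≤ toℕ x → lookup (initSeg n s) x ≡ false
  initSeg-∉ s x h = ≢true⇒false λ e → <⇒≱ (∈-initSeg s x e) h

  ∉-initSeg : ∀ s (x : Fin n) → lookup (initSeg n s) x ≡ false → s ≤ toℕ x
  ∉-initSeg s x h = ≮⇒≥ λ lt → true≢false (initSeg-∈ s x lt) h

  ∁-∈ : ∀ (L : Subset n) x → lookup (∁ L) x ≡ true → lookup L x ≡ false
  ∁-∈ L x h = not-elim (trans (sym (lookup-∁ L x)) h)

  ∁-∉ : ∀ (L : Subset n) x → lookup (∁ L) x ≡ false → lookup L x ≡ true
  ∁-∉ L x h = ≢false⇒true λ e → true≢false (trans (lookup-∁ L x) (cong not e)) h

  ∈-∁ : ∀ (L : Subset n) x → lookup L x ≡ false → lookup (∁ L) x ≡ true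
  ∈-∁ L x h = trans (lookup-∁ L x) (cong not h)

  ∉-∁ : ∀ (L : Subset n) x → lookup L x ≡ true → lookup (∁ L) x ≡ false
  ∉-∁ L x h = trans (lookup-∁ L x) (cong not h)

card-initSeg : ∀ n s → s ≤ n → ∣ initSeg n s ∣ ≡ s
card-initSeg zero zero _ = refl
card-initSeg (suc n) zero _ = card-initSeg n zero z≤n
card-initSeg (suc n) (suc s) (s≤s h) = cong suc (card-initSeg n s h)

Shifted : ∀ {n} → Family n → Set
Shifted F = ∀ i j A → toℕ i < toℕ j → lookup A j ≡ true → lookup A i ≡ false → F A ≡ true → F (sw i j A) ≡ true

toℕ-≢ : ∀ {n} {x y : Fin n} → x ≢ y → toℕ x ≢ toℕ y
toℕ-≢ x≢y e = x≢y (Fin.toℕ-injective e)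

-- Position `ℓ` is the first one after the prefix of length `ℓ`, so exchanges from beyond into `L`
-- or into `p` are left shifts.
shifted-compressed : ∀ {n} (F : Family n) ℓ (p : Fin n) → toℕ p ≡ ℓ → Shifted F →
  InvariantOff (initSeg n (suc ℓ)) F → Compressed (initSeg n ℓ) p F
shifted-compressed {n} F ℓ p refl sh off = record
  { invariant = λ x y A Lx x≢p Ly y≢p → off x y A (beyond x Lx x≢p) (beyond y Ly y≢p)
  ; into-L = λ x z A Lx Lz Ax Az f → subst (λ B → F B ≡ true) (sw-comm z x A)
      (sh z x A (<-≤-trans (∈-initSeg ℓ z Lz) (∉-initSeg ℓ x Lx)) Ax Az f)
  ; into-p = λ x A Lx x≢p Ax Ap f → subst (λ B → F B ≡ true) (sw-comm p x A)
      (sh p x A (≤∧≢⇒< (∉-initSeg ℓ x Lx) (≢-sym (toℕ-≢ x≢p))) Ax Ap f)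
  }
  where
  beyond : ∀ x → lookup (initSeg n ℓ) x ≡ false → x ≢ p → lookup (initSeg n (suc ℓ)) x ≡ false
  beyond x Lx x≢p = initSeg-∉ (suc ℓ) x (≤∧≢⇒< (∉-initSeg ℓ x Lx) (≢-sym (toℕ-≢ x≢p)))

Maximum : ∀ {n} → ℕ → ℕ → Family n → Set
Maximum {n} k t F = ∀ (G : Family n) → Intersecting k t G → size G ≤ size F

module _ {n : ℕ} (q a e : ℕ) (n≡ : n ≡ q + q + a + e) (e≥1 : 1 ≤ e) (F : Family n)
         (IF : Intersecting (q + a) (suc a) F) (maximum : Maximum (q + a) (suc a) F) (sh : Shifted F) where

  -- Each step drops the last element of the prefix by `push-strict`; the inequality is demanded
  -- only at lengths of the form `a + 2s`.
  descend : ∀ j d → j + d ≤ n → (∀ s → d ≤ a + s + s → a + s + s < j + d → q * a < (a + e) * s) →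
    InvariantOff (initSeg n (j + d)) F → InvariantOff (initSeg n d) F
  descend zero d _ _ off = off
  descend (suc j) d le gap off = descend j d (<⇒≤ le) (λ s h h′ → gap s h (<-trans h′ (n<1+n _)))
    (Gain.push-strict q a e n≡ e≥1 F IF maximum (initSeg n (j + d)) p
      (initSeg-∉ (j + d) p (≤-reflexive (sym p≡)))
      (shifted-compressed F (j + d) p p≡ sh off)
      (λ s eq → gap s (≤-trans (m≤n+m d j) (≤-reflexive (card≡ s eq))) (s≤s (≤-reflexive (sym (card≡ s eq))))))
    where
    card≡ : ∀ s → ∣ initSeg n (j + d) ∣ ≡ a + s + s → j + d ≡ a + s + s
    card≡ s eq = trans (sym (card-initSeg n (j + d) (<⇒≤ le))) eq
    p : Fin n
    p = fromℕ< le
    p≡ : toℕ p ≡ j + d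
    p≡ = Fin.toℕ-fromℕ< le

-- Complementation

_ᶜ : ∀ {n} → Family n → Family n
(F ᶜ) A = F (∁ A)

size-ᶜ : ∀ {n} (F : Family n) → size (F ᶜ) ≡ size F
size-ᶜ F = ∑-involution ∁ ∁-involutive (λ A → ⟦ F A ⟧ * 1)

card-∁ : ∀ {n} (A : Subset n) → ∣ ∁ A ∣ + ∣ A ∣ ≡ n
card-∁ [] = refl
card-∁ (true ∷ A) = trans (+-suc _ _) (cong suc (card-∁ A))
card-∁ (false ∷ A) = cong suc (card-∁ A)

-- Inclusion-exclusion for the union of `A` and `B`, whose complement is `∁ A ∩ ∁ B`.
card-∁∩∁ : ∀ {n} (A B : Subset n) → ∣ ∁ A ∩ ∁ B ∣ + (∣ A ∣ + ∣ B ∣) ≡ n + ∣ A ∩ B ∣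
card-∁∩∁ [] [] = refl
card-∁∩∁ (true ∷ A) (true ∷ B) = trans (lem (∣ ∁ A ∩ ∁ B ∣) (∣ A ∣) (∣ B ∣)) (trans (cong (2 +_) (card-∁∩∁ A B)) (cong suc (sym (+-suc _ _))))
  where
  lem : ∀ x y z → x + (suc y + suc z) ≡ 2 + (x + (y + z))
  lem = solve-∀
card-∁∩∁ (true ∷ A) (false ∷ B) = trans (+-suc _ _) (cong suc (card-∁∩∁ A B))
card-∁∩∁ (false ∷ A) (true ∷ B) = trans (lem (∣ ∁ A ∩ ∁ B ∣) (∣ A ∣) (∣ B ∣)) (cong suc (card-∁∩∁ A B))
  where
  lem : ∀ x y z → x + (y + suc z) ≡ 1 + (x + (y + z))
  lem = solve-∀
card-∁∩∁ (false ∷ A) (false ∷ B) = cong suc (card-∁∩∁ A B)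

-- Complements have size `n - k = q + e`, and two of them meet in at least `n - 2k + t = e + 1`
-- elements.
intersecting-ᶜ : ∀ {n} (q a e : ℕ) → n ≡ q + q + a + e → (F : Family n) →
  Intersecting (q + a) (suc a) F → Intersecting (q + e) (suc e) (F ᶜ)
intersecting-ᶜ {n} q a e refl F (Fk , Ft) = card , meet
  where
  card : ∀ A → F (∁ A) ≡ true → ∣ A ∣ ≡ q + e
  card A f = +-cancelˡ-≡ (q + a) _ _ (trans (cong (_+ ∣ A ∣) (sym (Fk _ f))) (trans (card-∁ A) (lem q a e)))
    where
    lem : ∀ q a e → q + q + a + e ≡ q + a + (q + e)
    lem = solve-∀
  meet : ∀ A B → F (∁ A) ≡ true → F (∁ B) ≡ true → suc e ≤ ∣ A ∩ B ∣
  meet A B f g = +-cancelʳ-≤ (q + a + (q + a)) _ _ (begin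
    suc e + (q + a + (q + a))                                     ≡⟨ lem q a e ⟩
    q + q + a + e + suc a                                         ≤⟨ +-monoʳ-≤ _ (Ft _ _ f g) ⟩
    q + q + a + e + ∣ ∁ A ∩ ∁ B ∣                                  ≡⟨ sym (card-∁∩∁ (∁ A) (∁ B)) ⟩
    ∣ ∁ (∁ A) ∩ ∁ (∁ B) ∣ + (∣ ∁ A ∣ + ∣ ∁ B ∣)
      ≡⟨ cong₂ _+_ (cong₂ (λ Z D → ∣ Z ∩ D ∣) (∁-involutive A) (∁-involutive B)) (cong₂ _+_ (Fk _ f) (Fk _ g)) ⟩
    ∣ A ∩ B ∣ + (q + a + (q + a))                                 ∎)
    where
    open ≤-Reasoning
    lem : ∀ q a e → suc e + (q + a + (q + a)) ≡ q + q + a + e + suc a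
    lem = solve-∀

module _ {n : ℕ} (q a e : ℕ) (n≡ : n ≡ q + q + a + e) (a≥1 : 1 ≤ a) (F : Family n)
         (IF : Intersecting (q + a) (suc a) F) (maximum : Maximum (q + a) (suc a) F) (sh : Shifted F) where

  n≡ᶜ : n ≡ q + q + e + a
  n≡ᶜ = trans n≡ (lem q a e)
    where
    lem : ∀ q a e → q + q + a + e ≡ q + q + e + a
    lem = solve-∀

  maximum-ᶜ : Maximum (q + e) (suc e) (F ᶜ)
  maximum-ᶜ G IG = subst₂ _≤_ (size-ᶜ G) (sym (size-ᶜ F)) (maximum (G ᶜ) (intersecting-ᶜ q e a n≡ᶜ G IG))

  -- A left shift moves elements of the complement to the right, so the final segment after `p`
  -- takes the role of the prefix.
  compressed-ᶜ : ∀ d (p : Fin n) → toℕ p ≡ d → InvariantOff (∁ (initSeg n d)) F → Compressed (∁ (initSeg n (suc d))) p (F ᶜ)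
  compressed-ᶜ d p refl off = record
    { invariant = λ x y A Lx x≢p Ly y≢p f → subst (λ B → F B ≡ true) (sym (sw-∁ x y A))
        (off x y (∁ A) (below x Lx x≢p) (below y Ly y≢p) f)
    ; into-L = λ x z A Lx Lz Ax Az f → subst (λ B → F B ≡ true) (sym (sw-∁ x z A))
        (sh x z (∁ A) (<-≤-trans (∈-initSeg (suc d) x (∁-∉ (initSeg n (suc d)) x Lx)) (∉-initSeg (suc d) z (∁-∈ (initSeg n (suc d)) z Lz)))
          (∈-∁ A z Az) (∉-∁ A x Ax) f)
    ; into-p = λ x A Lx x≢p Ax Ap f → subst (λ B → F B ≡ true) (sym (sw-∁ x p A))
        (sh x p (∁ A) (≤∧≢⇒< (s≤s⁻¹ (∈-initSeg (suc d) x (∁-∉ (initSeg n (suc d)) x Lx))) (toℕ-≢ x≢p)) (∈-∁ A p Ap) (∉-∁ A x Ax) f)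
    }
    where
    below : ∀ x → lookup (∁ (initSeg n (suc d))) x ≡ false → x ≢ p → lookup (∁ (initSeg n d)) x ≡ false
    below x Lx x≢p = ∉-∁ (initSeg n d) x (initSeg-∈ d x
      (≤∧≢⇒< (s≤s⁻¹ (∈-initSeg (suc d) x (∁-∉ (initSeg n (suc d)) x Lx))) (toℕ-≢ x≢p)))

  -- Pushing `F ᶜ` at the final segment after `p` makes `p` interchangeable with the elements before
  -- it; the inequality matters when that segment has `e + 2s` elements.
  ascend : ∀ d → d ≤ n → (∀ s → n ≤ d + (e + s + s) → q * e < (e + a) * s) → InvariantOff (∁ (initSeg n d)) F
  ascend zero _ _ x y A Lx Ly f = ⊥-elim (true≢false (∈-∁ (initSeg n zero) x (initSeg-∉ zero x z≤n)) Lx)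
  ascend (suc d) le gap x y A Lx Ly f = subst (λ B → F B ≡ true) (trans (sw-∁ x y (∁ A)) (cong (sw x y) (∁-involutive A)))
    (Gain.push-strict q e a n≡ᶜ a≥1 (F ᶜ) (intersecting-ᶜ q a e n≡ F IF) maximum-ᶜ (∁ (initSeg n (suc d))) p
      (∉-∁ (initSeg n (suc d)) p (initSeg-∈ (suc d) p (s≤s (≤-reflexive p≡))))
      (compressed-ᶜ d p p≡ (ascend d (<⇒≤ le) (λ s h → gap s (≤-trans h (n≤1+n _)))))
      (λ s eq → gap s (≤-reflexive (trans (sym (card-∁ (initSeg n (suc d))))
        (trans (cong₂ _+_ eq (card-initSeg n (suc d) le)) (+-comm (e + s + s) (suc d))))))
      x y (∁ A) Lx Ly (subst (λ B → F B ≡ true) (sym (∁-involutive A)) f))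
    where
    p : Fin n
    p = fromℕ< le
    p≡ : toℕ p ≡ d
    p≡ = Fin.toℕ-fromℕ< le

-- Left shifts, prefix weights and maximal choices

∑-fins-mono-< : ∀ {n} {f g : Fin n → ℕ} (x₀ : Fin n) → (∀ x → f x ≤ g x) → f x₀ < g x₀ → ∑ (fins n) f < ∑ (fins n) g
∑-fins-mono-< {n} {f} {g} x₀ le lt = begin-strict
  ∑ (fins n) f                                             <⟨ n<1+n _ ⟩
  1 + ∑ (fins n) f                                         ≡⟨ cong (_+ ∑ (fins n) f) (sym (∑-fins-≟ x₀)) ⟩
  ∑ (fins n) (λ x → ⟦ does (x Fin.≟ x₀) ⟧) + ∑ (fins n) f  ≡⟨ sym (∑-+ (fins n) _ f) ⟩
  ∑ (fins n) (λ x → ⟦ does (x Fin.≟ x₀) ⟧ + f x)           ≤⟨ ∑-mono (fins n) pointwise ⟩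
  ∑ (fins n) g                                             ∎
  where
  open ≤-Reasoning
  pointwise : ∀ x → ⟦ does (x Fin.≟ x₀) ⟧ + f x ≤ g x
  pointwise x with x Fin.≟ x₀
  ... | yes refl = lt
  ... | no _ = le x

module _ {n : ℕ} (i j : Fin n) (i<j : toℕ i < toℕ j) (A : Subset n) (Aj : lookup A j ≡ true) (Ai : lookup A i ≡ false) where

  private
    A′ = sw i j A
    A′i = trans (sw-at-fst i j A) Aj
    A′j = trans (sw-at-snd i j A) Ai

  shift-prefix-≤ : ∀ s → ∣ A ∩ initSeg n s ∣ ≤ ∣ sw i j A ∩ initSeg n s ∣
  shift-prefix-≤ s = subst (λ B → ∣ B ∩ initSeg n s ∣ ≤ ∣ A′ ∩ initSeg n s ∣) (sw-involutive i j A)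
    (card-sw-∩-≤ i j A′ (initSeg n s) A′i A′j inside)
    where
    inside : lookup (initSeg n s) i ≡ true ⊎ lookup (initSeg n s) j ≡ false
    inside with true⊎false (lookup (initSeg n s) j)
    ... | inj₁ h = inj₁ (initSeg-∈ s i (<-trans i<j (∈-initSeg s j h)))
    ... | inj₂ h = inj₂ h

  shift-prefix-< : ∀ s → toℕ i < s → s ≤ toℕ j → ∣ A ∩ initSeg n s ∣ < ∣ sw i j A ∩ initSeg n s ∣
  shift-prefix-< s i<s s≤j = subst (λ B → ∣ B ∩ initSeg n s ∣ < ∣ A′ ∩ initSeg n s ∣) (sw-involutive i j A)
    (≤-reflexive (card-sw-∩-suc i j A′ (initSeg n s) A′i A′j (initSeg-∈ s i i<s) (initSeg-∉ s j s≤j)))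

-- Equals the sum of `n - toℕ i` over the elements `i` of `A`, written by prefixes so that
-- monotonicity under shifts can be read off termwise.
potential : ∀ {n} → Subset n → ℕ
potential {n} A = ∑ (fins n) (λ x → ∣ A ∩ initSeg n (suc (toℕ x)) ∣)

shift-potential : ∀ {n} (i j : Fin n) → toℕ i < toℕ j → ∀ A → lookup A j ≡ true → lookup A i ≡ false →
  potential A < potential (sw i j A)
shift-potential i j i<j A Aj Ai = ∑-fins-mono-< i (λ x → shift-prefix-≤ i j i<j A Aj Ai (suc (toℕ x)))
  (shift-prefix-< i j i<j A Aj Ai (suc (toℕ i)) ≤-refl i<j)

module _ {n : ℕ} (L : Subset n) (F : Family n) (off : InvariantOff L F) (i j : Fin n)
         (Li : lookup L i ≡ true) (Lj : lookup L j ≡ true) where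

  private
    apart : ∀ {x z} → lookup L x ≡ false → lookup L z ≡ true → z ≢ x
    apart Lx Lz refl = true≢false Lz Lx

  movable-invariant : InvariantOff L (Movable F i j)
  movable-invariant x y A Lx Ly m with movable-elim F i j A m
  ... | (f , Aj) , (Ai , nf) = movable-intro F i j (sw x y A) (off x y A Lx Ly f)
    (trans (sw-elsewhere x y A j (apart Lx Lj) (apart Ly Lj)) Aj)
    (trans (sw-elsewhere x y A i (apart Lx Li) (apart Ly Li)) Ai)
    (≢true⇒false λ g → true≢false (subst (λ B → F B ≡ true)
      (trans (cong (sw x y) (sw-disjoint i j x y A (≢-sym (apart Lx Li)) (≢-sym (apart Lx Lj)) (≢-sym (apart Ly Li)) (≢-sym (apart Ly Lj))))
             (sw-involutive x y (sw i j A)))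
      (off x y _ Lx Ly g)) nf)

  -- As `i` and `j` lie in `L`, their exchange commutes with exchanges outside `L`.
  shift-invariantOff : InvariantOff L (shift F i j)
  shift-invariantOff x y A Lx Ly h with replace-elim F (Movable F i j) (λ B → Movable F i j (sw i j B)) A h
  ... | inj₁ (f , r) = replace-old F (Movable F i j) (λ B → Movable F i j (sw i j B)) _ (off x y A Lx Ly f)
          (≢true⇒false λ m → true≢false (subst (λ B → Movable F i j B ≡ true) (sw-involutive x y A)
            (movable-invariant x y _ Lx Ly m)) r)
  ... | inj₂ u = replace-new F (Movable F i j) (λ B → Movable F i j (sw i j B)) _
          (subst (λ B → Movable F i j B ≡ true)
            (sym (sw-disjoint i j x y A (≢-sym (apart Lx Li)) (≢-sym (apart Lx Lj)) (≢-sym (apart Ly Li)) (≢-sym (apart Ly Lj))))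
            (movable-invariant x y _ Lx Ly u))

prefixWeight : ∀ {n} → ℕ → Family n → ℕ
prefixWeight {n} b = weight (λ A → ∣ A ∩ initSeg n b ∣)

-- Size first, then prefix weight: push-tie decreases neither, so a family made this way can be
-- maximised anew while staying closed under shifts into the prefix.
Heaviest : ∀ {n} → ℕ → ℕ → ℕ → Family n → Set
Heaviest {n} k t b F = Intersecting k t F × Maximum k t F ×
  (∀ (G : Family n) → Intersecting k t G → size F ≤ size G → prefixWeight b G ≤ prefixWeight b F)

module _ {n k t b : ℕ} where

  Heaviest-≥ : (F G : Family n) → Heaviest k t b F → Intersecting k t G → size F ≤ size G →
    prefixWeight b F ≤ prefixWeight b G → Heaviest k t b G
  Heaviest-≥ F G (IF , maxF , heavy) IG s w = IG , (λ H IH → ≤-trans (maxF H IH) s) ,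
    (λ H IH s′ → ≤-trans (heavy H IH (≤-trans s s′)) w)

  -- A shift that changed `F` would raise the potential within the class if both elements lie in the
  -- prefix `d`, would raise the prefix weight if it crosses `b`, and is excluded beyond `d` by
  -- invariance.
  shifted-of-maximal : ∀ d → (∀ (i j : Fin n) → toℕ i < toℕ j → toℕ j < d ⊎ (toℕ i < b × b ≤ toℕ j) ⊎ d ≤ toℕ i) →
    (F : Family n) → Heaviest k t b F → InvariantOff (initSeg n d) F →
    (∀ (G : Family n) → Heaviest k t b G × InvariantOff (initSeg n d) G → weight potential G ≤ weight potential F) →
    Shifted F
  shifted-of-maximal d split F hF@(IF , maxF , heavy) off best i j A i<j Aj Ai f =
    ≢false⇒true λ nf → refute (movable-intro F i j A f Aj Ai nf) nf (split i j i<j)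
    where
    G = shift F i j
    IG = shift-intersecting F i j IF
    sizeG : size F ≤ size G
    sizeG = weight-shift-≥ F i j (λ _ → 1) (λ _ _ _ → ≤-refl)
    refute : Movable F i j A ≡ true → F (sw i j A) ≡ false → _ → ⊥
    refute m nf (inj₁ j<d) = <⇒≱
      (weight-shift-> F i j potential (shift-potential i j i<j) A m)
      (best G (Heaviest-≥ F G hF IG sizeG (weight-shift-≥ F i j _ (λ B Bj Bi → shift-prefix-≤ i j i<j B Bj Bi b)) ,
               shift-invariantOff (initSeg n d) F off i j (initSeg-∈ d i (<-trans i<j j<d)) (initSeg-∈ d j j<d)))
    refute m nf (inj₂ (inj₁ (i<b , b≤j))) = <⇒≱
      (weight-shift-> F i j (λ B → ∣ B ∩ initSeg n b ∣) (λ B Bj Bi → shift-prefix-< i j i<j B Bj Bi b i<b b≤j) A m)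
      (heavy G IG sizeG)
    refute m nf (inj₂ (inj₂ d≤i)) = true≢false
      (off i j A (initSeg-∉ d i d≤i) (initSeg-∉ d j (≤-trans d≤i (<⇒≤ i<j))) f) nf

-- Families invariant on both sides of a prefix

card-∩-∁ : ∀ {n} (A S : Subset n) → ∣ A ∩ S ∣ + ∣ A ∩ ∁ S ∣ ≡ ∣ A ∣
card-∩-∁ [] [] = refl
card-∩-∁ (true ∷ A) (true ∷ S) = cong suc (card-∩-∁ A S)
card-∩-∁ (true ∷ A) (false ∷ S) = trans (+-suc _ _) (cong suc (card-∩-∁ A S))
card-∩-∁ (false ∷ A) (s ∷ S) = card-∩-∁ A S

card-witness : ∀ {n} (A : Subset n) → 1 ≤ ∣ A ∣ → ∃ λ x → lookup A x ≡ true
card-witness {n} A h with ∑-pigeonhole (fins n) (λ _ → 0) (λ x → ⟦ lookup A x ⟧)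
                           (subst₂ _<_ (sym (∑-zero (fins n))) (card-∑ A) h)
... | x , lt = x , positive lt
  where
  positive : ∀ {b} → 0 < ⟦ b ⟧ → b ≡ true
  positive {true} _ = refl

card-∖-witness : ∀ {n} (A S : Subset n) → ∣ A ∩ S ∣ < ∣ A ∣ → ∃ λ x → lookup A x ≡ true × lookup S x ≡ false
card-∖-witness A S h with card-witness (A ∩ ∁ S) (+-cancelˡ-< ∣ A ∩ S ∣ _ _
       (subst₂ _<_ (sym (+-identityʳ _)) (sym (card-∩-∁ A S)) h))
... | x , m with ∧-elim (trans (sym (lookup-zipWith _∧_ x A (∁ S))) m)
... | Ax , Sx = x , Ax , ∁-∈ S x Sx

module _ {n : ℕ} (F : Family n) (T : Subset n) (off : InvariantOff (∁ T) F) where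

  -- The last hypothesis says that `A` and `B` together do not cover `T`; a common element in `T`
  -- can thus be exchanged for one that neither contains.
  exchange-down : ∀ A B → F B ≡ true → 1 ≤ ∣ (A ∩ B) ∩ T ∣ → ∣ A ∩ T ∣ + ∣ B ∩ T ∣ < ∣ T ∣ + ∣ (A ∩ B) ∩ T ∣ →
    ∃ λ x → ∃ λ y → lookup T x ≡ true × lookup T y ≡ true × F (sw x y B) ≡ true × ∣ A ∩ sw x y B ∣ < ∣ A ∩ B ∣
  exchange-down A B fB common room with card-witness ((A ∩ B) ∩ T) common
  ... | x , m with ∧-elim (trans (sym (lookup-zipWith _∧_ x (A ∩ B) T)) m)
  ... | ABx , Tx with ∧-elim (trans (sym (lookup-zipWith _∧_ x A B)) ABx)
  ... | Ax , Bx with ∑-pigeonhole (fins n) (λ z → ⟦ lookup A z ∧ lookup T z ⟧ + ⟦ lookup B z ∧ lookup T z ⟧)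
                      (λ z → ⟦ lookup T z ⟧ + ⟦ (lookup A z ∧ lookup B z) ∧ lookup T z ⟧) sums
    where
    sums : _ < _
    sums = subst₂ _<_ (trans (cong₂ _+_ (card-∩-∑ A T) (card-∩-∑ B T)) (sym (∑-+ (fins n) _ _)))
      (trans (cong₂ _+_ (card-∑ T) (trans (card-∩-∑ (A ∩ B) T)
               (∑-cong (fins n) (λ z → cong (λ b → ⟦ b ∧ lookup T z ⟧) (lookup-zipWith _∧_ z A B)))))
             (sym (∑-+ (fins n) _ _))) room
  ... | y , lt with outside (lookup A y) (lookup B y) (lookup T y) lt
    where
    outside : ∀ a b t → ⟦ a ∧ t ⟧ + ⟦ b ∧ t ⟧ < ⟦ t ⟧ + ⟦ (a ∧ b) ∧ t ⟧ → a ≡ false × b ≡ false × t ≡ true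
    outside false false true _ = refl , refl , refl
    outside true true true (s≤s (s≤s ()))
    outside true false true (s≤s ())
    outside false true true (s≤s ())
    outside true true false ()
    outside true false false ()
    outside false true false ()
    outside false false false ()
  ... | Ay , By , Ty = x , y , Tx , Ty , off x y B (∉-∁ T x Tx) (∉-∁ T y Ty) fB ,
    ≤-reflexive (trans (cong (λ Z → suc ∣ Z ∣) (∩-comm A (sw x y B)))
      (trans (card-sw-∩-suc x y B A Bx By Ax Ay) (cong ∣_∣ (∩-comm B A))))

-- `2 (a + r) < (a + 1 + 2r) + c` amounts to `a ≤ c`.
inside-room : ∀ a r c x y s → a ≤ c → x ≡ a + r → y ≡ a + r → s ≡ suc a + 2 * r → x + y < s + c
inside-room a r c _ _ _ a≤c refl refl refl = ≤-trans (≤-reflexive (lem a r)) (+-monoʳ-≤ (suc a + 2 * r) a≤c)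
  where
  lem : ∀ a r → suc (a + r + (a + r)) ≡ suc a + 2 * r + a
  lem = solve-∀

-- Both outside parts have `q - r` elements, and the claim amounts to `1 < e + c`.
outside-room : ∀ q a e r x y z c → x + r ≡ q → y + r ≡ q → z + (suc a + 2 * r) ≡ q + q + a + e → 1 < e + c → x + y < z + c
outside-room q a e r x y z c hx hy hz big = s≤s⁻¹ (begin-strict
  suc (x + y)         ≡⟨ +-comm 1 (x + y) ⟩
  x + y + 1           <⟨ +-monoʳ-< (x + y) big ⟩
  x + y + (e + c)     ≡⟨ sym (+-assoc (x + y) e c) ⟩
  x + y + e + c       ≡⟨ cong (_+ c) (sym balance) ⟩
  z + 1 + c           ≡⟨ lem z c ⟩
  suc (z + c)         ∎)
  where
  open ≤-Reasoning
  lem : ∀ z c → z + 1 + c ≡ suc (z + c)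
  lem = solve-∀
  lem₁ : ∀ z r a → z + 1 + (r + r + a) ≡ z + (suc a + 2 * r)
  lem₁ = solve-∀
  lem₂ : ∀ x y r a e → x + r + (y + r) + a + e ≡ x + y + e + (r + r + a)
  lem₂ = solve-∀
  balance : z + 1 ≡ x + y + e
  balance = +-cancelʳ-≡ (r + r + a) _ _ (trans (lem₁ z r a) (trans hz
    (trans (cong₂ (λ u v → u + v + a + e) (sym hx) (sym hy)) (lem₂ x y r a e))))

module Contained {n : ℕ} (q a e r : ℕ) (n≡ : n ≡ q + q + a + e) (a+e≥1 : 1 ≤ a + e) (r<q : r < q)
         (F : Family n) (IF : Intersecting (q + a) (suc a) F) (S : Subset n) (cardS : ∣ S ∣ ≡ suc a + 2 * r)
         (into-S : ∀ x z A → lookup S x ≡ false → lookup S z ≡ true → lookup A x ≡ true → lookup A z ≡ false →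
                   F A ≡ true → F (sw z x A) ≡ true)
         (off : InvariantOff S F) (off-∁ : InvariantOff (∁ S) F) where

  cardS∁ : ∀ A → F A ≡ true → ∣ A ∩ S ∣ ≡ a + r → ∣ A ∩ ∁ S ∣ + r ≡ q
  cardS∁ A f h = +-cancelʳ-≡ a _ q (trans (lem a r (∣ A ∩ ∁ S ∣)) (trans (cong (_+ ∣ A ∩ ∁ S ∣) (sym h)) (trans (card-∩-∁ A S) (proj₁ IF A f))))
    where
    lem : ∀ a r x → x + r + a ≡ a + r + x
    lem = solve-∀

  -- As long as `A` and `B` meet in `a + 1` elements, there is room for an exchange inside `S` or
  -- inside its complement; it keeps the trace size of `B` and lowers `∣ A ∩ B ∣`, until the
  -- intersection condition fails.
  descent : ∀ bound A B → F A ≡ true → F B ≡ true → ∣ A ∩ S ∣ ≡ a + r → ∣ B ∩ S ∣ ≡ a + r → ∣ A ∩ B ∣ ≤ bound → ⊥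
  descent zero A B f g _ _ h = <⇒≱ (≤-trans (s≤s z≤n) (proj₂ IF A B f g)) h
  descent (suc bound) A B f g hA hB h = choose (1 ≤? c) (a ≤? c)
    where
    c = ∣ (A ∩ B) ∩ S ∣
    c′ = ∣ (A ∩ B) ∩ ∁ S ∣
    c+c′ : suc a ≤ c + c′
    c+c′ = ≤-trans (proj₂ IF A B f g) (≤-reflexive (sym (card-∩-∁ (A ∩ B) S)))
    recurse : (∃ λ x → ∃ λ y → lookup S x ≡ lookup S y × F (sw x y B) ≡ true × ∣ A ∩ sw x y B ∣ < ∣ A ∩ B ∣) → ⊥
    recurse (x , y , Sxy , g′ , lt) = descent bound A (sw x y B) f g′ hA (trans (card-sw-∩-≡ x y B S Sxy) hB) (s≤s⁻¹ (≤-trans lt h))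
    inside : 1 ≤ c → a ≤ c → ⊥
    inside c≥1 a≤c = from (exchange-down F S off-∁ A B g c≥1
        (inside-room a r c (∣ A ∩ S ∣) (∣ B ∩ S ∣) (∣ S ∣) a≤c hA hB cardS))
      where
      from : _ → ⊥
      from (x , y , Sx , Sy , g′ , lt) = recurse (x , y , trans Sx (sym Sy) , g′ , lt)
    outside : 1 ≤ c′ → 1 < e + c′ → ⊥
    outside c′≥1 big = from (exchange-down F (∁ S) (subst (λ T → InvariantOff T F) (sym (∁-involutive S)) off) A B g c′≥1
      (outside-room q a e r (∣ A ∩ ∁ S ∣) (∣ B ∩ ∁ S ∣) (∣ ∁ S ∣) c′ (cardS∁ A f hA) (cardS∁ B g hB)
        (trans (cong (∣ ∁ S ∣ +_) (sym cardS)) (trans (card-∁ S) n≡)) big))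
      where
      from : _ → ⊥
      from (x , y , Sx , Sy , g′ , lt) = recurse (x , y , trans (∁-∈ S x Sx) (sym (∁-∈ S y Sy)) , g′ , lt)
    choose : Dec (1 ≤ c) → Dec (a ≤ c) → ⊥
    choose (yes c≥1) (yes a≤c) = inside c≥1 a≤c
    -- All `a + 1` common elements lie outside `S`, and `a + e ≥ 1` supplies the second unit
    -- required.
    choose (no c<1) _ = outside (≤-trans (s≤s z≤n) large) (≤-trans (s≤s a+e≥1)
        (≤-trans (≤-reflexive (trans (cong suc (+-comm a e)) (sym (+-suc e a)))) (+-monoʳ-≤ e large)))
      where
      large : suc a ≤ c′
      large = ≤-trans c+c′ (≤-reflexive (cong (_+ c′) (n<1⇒n≡0 (≰⇒> c<1))))
    -- With `c < a` at least two common elements lie outside `S`.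
    choose (yes _) (no c<a) = outside (<⇒≤ two) (≤-trans two (m≤n+m c′ e))
      where
      two : 2 ≤ c′
      two = +-cancelˡ-≤ c 2 c′ (≤-trans (≤-reflexive (+-comm c 2)) (≤-trans (s≤s (≰⇒> c<a)) c+c′))

  -- Shifting raises a member with too small a prefix to prefix size exactly a + r.
  small-prefix : ∀ gap A → F A ≡ true → gap + ∣ A ∩ S ∣ ≡ a + r → ⊥
  small-prefix zero A f h = descent ∣ A ∩ A ∣ A A f f h h ≤-refl
  small-prefix (suc gap) A f h with card-∖-witness A S A∩S<A | card-∖-witness S A S∩A<S
    where
    A∩S<a+r : ∣ A ∩ S ∣ < a + r
    A∩S<a+r = ≤-trans (s≤s (m≤n+m _ gap)) (≤-reflexive h)
    A∩S<A : ∣ A ∩ S ∣ < ∣ A ∣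
    A∩S<A = <-≤-trans A∩S<a+r (≤-trans (+-monoʳ-≤ a (<⇒≤ r<q)) (≤-reflexive (trans (+-comm a q) (sym (proj₁ IF A f)))))
    S∩A<S : ∣ S ∩ A ∣ < ∣ S ∣
    S∩A<S = subst₂ _<_ (cong ∣_∣ (∩-comm A S)) (sym cardS) (<-trans A∩S<a+r (s≤s (+-monoʳ-≤ a (m≤m+n r _))))
  ... | x , Ax , Sx | z , Sz , Az = small-prefix gap (sw z x A)
    (into-S x z A Sx Sz Ax Az f)
    (trans (cong (gap +_) (sym raised)) (trans (+-suc gap _) h))
    where
    raised : suc ∣ A ∩ S ∣ ≡ ∣ sw z x A ∩ S ∣
    raised = trans (cong (λ B → suc ∣ B ∩ S ∣) (sym (sw-involutive z x A)))
      (card-sw-∩-suc z x (sw z x A) S (trans (sw-at-fst z x A) Ax) (trans (sw-at-snd z x A) Az) Sz Sx)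

  contained : ∀ A → F A ≡ true → suc a + r ≤ ∣ A ∩ S ∣
  contained A f = ≰⇒> λ le → small-prefix (a + r ∸ ∣ A ∩ S ∣) A f (m∸n+n≡m le)

-- The extremal prefix length and the containment

least-step : (P : ℕ → Set) → (∀ r → Dec (P r)) → ∀ b → P b → ∃ λ r → r ≤ b × P r × (∀ r′ → r ≡ suc r′ → ¬ P r′)
least-step P P? zero p = 0 , z≤n , p , λ _ ()
least-step P P? (suc b) p with P? b
... | no ¬p = suc b , ≤-refl , p , λ { _ refl → ¬p }
... | yes p′ with least-step P P? b p′
... | r , r≤b , pr , minimal = r , ≤-trans r≤b (n≤1+n b) , pr , minimal

-- The largest of the F_{n,k,t,r} is attained at the least r with q a ≤ (a + e) (r + 1).
choose-r : ∀ q a e → 1 ≤ q → 1 ≤ a + e →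
  ∃ λ r → r < q × q * a ≤ (a + e) * suc r × (1 ≤ a → (a + e) * r < q * a) × (a ≡ 0 → r ≡ 0) × (e ≡ 0 → suc r ≡ q)
choose-r (suc q′) a e _ c≥1 with least-step (λ r → suc q′ * a ≤ (a + e) * suc r) (λ r → _ ≤? _) q′
    (≤-trans (≤-reflexive (*-comm (suc q′) a)) (*-monoˡ-≤ (suc q′) (m≤m+n a e)))
... | r , r≤q′ , p , minimal = r , s≤s r≤q′ , p , below r minimal , a≡0 r minimal , e≡0
  where
  q = suc q′
  below : ∀ r → (∀ r′ → r ≡ suc r′ → ¬ (q * a ≤ (a + e) * suc r′)) → 1 ≤ a → (a + e) * r < q * a
  below zero _ a≥1 = ≤-trans (≤-reflexive (cong suc (*-zeroʳ (a + e)))) (*-mono-≤ {1} {q} (s≤s z≤n) a≥1)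
  below (suc r′) min _ = ≰⇒> (min r′ refl)
  a≡0 : ∀ r → (∀ r′ → r ≡ suc r′ → ¬ (q * a ≤ (a + e) * suc r′)) → a ≡ 0 → r ≡ 0
  a≡0 zero _ _ = refl
  a≡0 (suc r′) min refl = ⊥-elim (min r′ refl (≤-trans (≤-reflexive (*-zeroʳ q)) z≤n))
  e≡0 : e ≡ 0 → suc r ≡ q
  e≡0 refl = ≤-antisym (s≤s r≤q′) (*-cancelˡ-≤ (a + 0) {{>-nonZero c≥1}}
    (≤-trans (≤-reflexive (trans (cong (_* q) (+-identityʳ a)) (*-comm a q))) p))

module Extremal {n : ℕ} (q a e r : ℕ) (n≡ : n ≡ q + q + a + e) (c≥1 : 1 ≤ a + e) (r<q : r < q)
                (upper : q * a ≤ (a + e) * suc r) (lower : 1 ≤ a → (a + e) * r < q * a)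
                (r≡0 : a ≡ 0 → r ≡ 0) (r≡q-1 : e ≡ 0 → suc r ≡ q) where

  k t m : ℕ
  k = q + a
  t = suc a
  m = suc a + 2 * r

  m<n : m < n
  m<n = subst (m <_) (sym n≡) (≤-trans (≤-reflexive (lem a r)) (≤-trans (+-monoˡ-≤ a (+-mono-≤ r<q r<q)) (m≤m+n _ e)))
    where
    lem : ∀ a r → suc (suc a + 2 * r) ≡ suc r + suc r + a
    lem = solve-∀

  last-prefix : ∀ d → n ≤ suc d → (F : Family n) → InvariantOff (initSeg n d) F
  last-prefix d n≤ F x y A Lx Ly f = subst (λ B → F B ≡ true) (sym (sw-fixes x y A (cong (lookup A) x≡y))) f
    where
    at-end : ∀ z → lookup (initSeg n d) z ≡ false → toℕ z ≡ d
    at-end z Lz = ≤-antisym (s≤s⁻¹ (≤-trans (Fin.toℕ<n z) n≤)) (∉-initSeg d z Lz)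
    x≡y : x ≡ y
    x≡y = Fin.toℕ-injective (trans (at-end x Lx) (sym (at-end y Ly)))

  -- `m + 1 = a + 2 (r + 1)` is the one length above `m` at which the push may merely tie.
  H : Family n → Set
  H = Heaviest k t (suc m)

  -- Beyond `m + 1` the length forces `s > r + 1`, so the inequality defining `r` becomes strict.
  strict-above : ∀ s → suc (suc m) ≤ a + s + s → q * a < (a + e) * s
  strict-above s h = begin-strict
    q * a                    ≤⟨ upper ⟩
    (a + e) * suc r          <⟨ *-monoʳ-< (a + e) {{>-nonZero c≥1}} r+1<s ⟩
    (a + e) * s              ∎
    where
    open ≤-Reasoning
    lem₁ : ∀ a r → suc (suc (suc a + 2 * r)) ≡ a + (suc r + suc r + 1)
    lem₁ = solve-∀
    r+1<s : suc r < s
    r+1<s = ≰⇒> λ s≤ → <⇒≱ (m<m+n (suc r + suc r) (s≤s z≤n))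
      (≤-trans (+-cancelˡ-≤ a _ _ (≤-trans (≤-reflexive (sym (lem₁ a r))) (≤-trans h (≤-reflexive (+-assoc a s s)))))
               (+-mono-≤ s≤ s≤))

  odd-gap : ∀ s → m ≤ a + s + s → a + s + s < suc m → q * a < (a + e) * s
  odd-gap s h h′ = ⊥-elim (even≢odd s r (+-cancelˡ-≡ a _ _
      (trans (lem₁ a s) (trans (≤-antisym (s≤s⁻¹ h′) h) (lem₂ a r)))))
    where
    lem₁ : ∀ a s → a + 2 * s ≡ a + s + s
    lem₁ = solve-∀
    lem₂ : ∀ a r → suc a + 2 * r ≡ a + suc (2 * r)
    lem₂ = solve-∀

  -- The hypothesis forces `q ≤ r + s`; subtracting `(a + e) r < q a`, the minimality of `r`, from
  -- `(a + e) q ≤ (a + e) (r + s)` leaves the claim.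
  dual-gap : 1 ≤ a → ∀ s → n ≤ m + (e + s + s) → q * e < (e + a) * s
  dual-gap a≥1 s h = +-cancelˡ-< ((a + e) * r) _ _ (begin-strict
    (a + e) * r + q * e      <⟨ +-monoˡ-< (q * e) (lower a≥1) ⟩
    q * a + q * e            ≡⟨ lem₁ q a e ⟩
    (a + e) * q              ≤⟨ *-monoʳ-≤ (a + e) q≤r+s ⟩
    (a + e) * (r + s)        ≡⟨ lem₂ a e r s ⟩
    (a + e) * r + (e + a) * s ∎)
    where
    open ≤-Reasoning
    lem₁ : ∀ q a e → q * a + q * e ≡ (a + e) * q
    lem₁ = solve-∀
    lem₂ : ∀ a e r s → (a + e) * (r + s) ≡ (a + e) * r + (e + a) * s
    lem₂ = solve-∀
    lem₃ : ∀ q a e → q + q + a + e ≡ q + q + (a + e)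
    lem₃ = solve-∀
    lem₄ : ∀ a e r s → suc a + 2 * r + (e + s + s) ≡ suc (r + s + (r + s)) + (a + e)
    lem₄ = solve-∀
    q≤r+s : q ≤ r + s
    q≤r+s = ≮⇒≥ λ lt → <⇒≱ (≤-trans (≤-reflexive (cong suc (sym (+-suc (r + s) (r + s))))) (+-mono-≤ lt lt))
      (+-cancelʳ-≤ (a + e) _ _ (≤-trans (≤-reflexive (trans (sym (lem₃ q a e)) (sym n≡))) (≤-trans h (≤-reflexive (lem₄ a e r s)))))

  StableHeaviest : ℕ → Family n → Set
  StableHeaviest d F = H F × InvariantOff (initSeg n d) F

  split-n : ∀ (i j : Fin n) → toℕ i < toℕ j → toℕ j < n ⊎ (toℕ i < suc m × suc m ≤ toℕ j) ⊎ n ≤ toℕ i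
  split-n i j _ = inj₁ (Fin.toℕ<n j)

  split-m : ∀ (i j : Fin n) → toℕ i < toℕ j → toℕ j < suc m ⊎ (toℕ i < suc m × suc m ≤ toℕ j) ⊎ suc m ≤ toℕ i
  split-m i j _ with toℕ j <? suc m | toℕ i <? suc m
  ... | yes j<m | _ = inj₁ j<m
  ... | no j≮m | yes i<m = inj₂ (inj₁ (i<m , ≮⇒≥ j≮m))
  ... | no _ | no i≮m = inj₂ (inj₂ (≮⇒≥ i≮m))

  heaviest-suffices : (F : Family n) → Intersecting k t F → (∀ G → H G → size F ≤ size G → ⊥) → ⊥
  heaviest-suffices F IF k₀ = maximise (λ G → Intersecting k t G) (λ _ → 1) F IF λ G₁ I₁ max₁ →
    maximise (λ G → Intersecting k t G × size G₁ ≤ size G) (λ A → ∣ A ∩ initSeg n (suc m) ∣) G₁ (I₁ , ≤-refl)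
      λ G₂ (I₂ , s₂) max₂ → k₀ G₂
        (I₂ , (λ G IG → ≤-trans (max₁ G IG) s₂) , (λ G IG s → max₂ G (IG , ≤-trans s₂ s)))
        (≤-trans (max₁ F IF) s₂)

  shifted-suffices : ∀ d → (∀ (i j : Fin n) → toℕ i < toℕ j → toℕ j < d ⊎ (toℕ i < suc m × suc m ≤ toℕ j) ⊎ d ≤ toℕ i) →
    (F : Family n) → StableHeaviest d F → (∀ G → StableHeaviest d G → Shifted G → ⊥) → ⊥
  shifted-suffices d split F hF k₀ = maximise (StableHeaviest d) potential F hF λ G hG max →
    k₀ G hG (shifted-of-maximal d split G (proj₁ hG) (proj₂ hG) max)

  -- If nothing lies beyond the prefix of length `m + 1`, invariance is trivial; `e = 0` falls under
  -- this, since then `n = m + 1`. Otherwise strict pushes lead down to `m + 2`, and one tie push to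
  -- `m + 1` yields a family that is again heaviest.
  stable-suffices : (F : Family n) → H F → (∀ G → StableHeaviest (suc m) G → ⊥) → ⊥
  stable-suffices F hF k₀ with suc (suc m) ≤? n | 1 ≤? e
  ... | no m+2≰n | _ = k₀ F (hF , last-prefix (suc m) (≤-trans (n≤1+n n) (≰⇒> m+2≰n)) F)
  ... | yes m+2≤n | no e<1 = ⊥-elim (<⇒≱ m+2≤n (≤-trans (≤-reflexive n≡) (≤-reflexive
          (trans (cong₂ (λ x y → x + x + a + y) (sym (r≡q-1 e≡0)) e≡0) (lem a r)))))
    where
    e≡0 = n<1⇒n≡0 (≰⇒> e<1)
    lem : ∀ a r → suc r + suc r + a + 0 ≡ suc (suc a + 2 * r)
    lem = solve-∀
  ... | yes m+2≤n | yes e≥1 = shifted-suffices n split-n F (hF , last-prefix n (n≤1+n n) F) tie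
    where
    tie : ∀ G → StableHeaviest n G → Shifted G → ⊥
    tie G (hG@(IG , maxG , heavy) , offG) sh = conclude
        (Gain.push-tie q a e n≡ e≥1 G IG maxG (initSeg n (suc m)) p
          (initSeg-∉ (suc m) p (≤-reflexive (sym p≡)))
          (shifted-compressed G (suc m) p p≡ sh down) (suc r)
          (trans (card-initSeg n (suc m) (<⇒≤ m+2≤n)) (lem a r))
          (≤-trans (s≤s z≤n) (≤-reflexive (sym (card-initSeg n (suc m) (<⇒≤ m+2≤n)))))
          upper)
      where
      lem : ∀ a r → suc (suc a + 2 * r) ≡ a + suc r + suc r
      lem = solve-∀
      p : Fin n
      p = fromℕ< m+2≤n
      p≡ : toℕ p ≡ suc m
      p≡ = Fin.toℕ-fromℕ< m+2≤n
      down : InvariantOff (initSeg n (suc (suc m))) G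
      down = descend q a e n≡ e≥1 G IG maxG sh (n ∸ suc (suc m)) (suc (suc m)) (≤-reflexive (m∸n+n≡m m+2≤n))
        (λ s h _ → strict-above s h) (subst (λ d → InvariantOff (initSeg n d) G) (sym (m∸n+n≡m m+2≤n)) offG)
      conclude : _ → ⊥
      conclude (G′ , IG′ , s , w , off′) = k₀ G′ (Heaviest-≥ {b = suc m} G G′ hG IG′ s w , off′)

  m-invariant : (F : Family n) → StableHeaviest (suc m) F → Shifted F → InvariantOff (initSeg n m) F
  m-invariant F ((IF , maxF , _) , off) sh with 1 ≤? e
  ... | yes e≥1 = descend q a e n≡ e≥1 F IF maxF sh 1 m m<n odd-gap off
  ... | no e<1 = last-prefix m (≤-reflexive (trans n≡ (trans (cong₂ (λ x y → x + x + a + y) (sym (r≡q-1 e≡0)) e≡0) (lem a r)))) F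
    where
    e≡0 = n<1⇒n≡0 (≰⇒> e<1)
    lem : ∀ a r → suc r + suc r + a + 0 ≡ suc (suc a + 2 * r)
    lem = solve-∀

  -- For `a = 0` also `r = 0`, and the prefix is a single element.
  m-invariant-∁ : (F : Family n) → Intersecting k t F → Maximum k t F → Shifted F → InvariantOff (∁ (initSeg n m)) F
  m-invariant-∁ F IF maxF sh with 1 ≤? a
  ... | yes a≥1 = ascend q a e n≡ a≥1 F IF maxF sh m (<⇒≤ m<n) (dual-gap a≥1)
  ... | no a<1 = λ x y A Lx Ly f → subst (λ B → F B ≡ true)
      (sym (sw-fixes x y A (cong (lookup A) (Fin.toℕ-injective (trans (at-start x Lx) (sym (at-start y Ly))))))) f
    where
    a≡0 = n<1⇒n≡0 (≰⇒> a<1)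
    at-start : ∀ x → lookup (∁ (initSeg n m)) x ≡ false → toℕ x ≡ 0
    at-start x Lx = n<1⇒n≡0 (≤-trans (∈-initSeg m x (∁-∉ (initSeg n m) x Lx))
      (≤-reflexive (cong₂ (λ x y → suc x + 2 * y) a≡0 (r≡0 a≡0))))

  -- Deciding the inequality first leaves `⊥` as the goal, as the maximisation steps require.
  extremal-size : (F : Family n) → Intersecting k t F → size F ≤ cardF n k t r
  extremal-size F IF with size F ≤? cardF n k t r
  ... | yes le = le
  ... | no larger = ⊥-elim (heaviest-suffices F IF λ G₁ h₁ s₁ → stable-suffices G₁ h₁ λ G₂ h₂ →
      shifted-suffices (suc m) split-m G₂ h₂ λ G₃ h₃@((I₃ , max₃ , _) , _) sh₃ →
        larger (≤-trans s₁ (≤-trans (max₃ G₁ (proj₁ h₁)) (final G₃ h₃ sh₃))))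
    where
    final : (G : Family n) → StableHeaviest (suc m) G → Shifted G → size G ≤ cardF n k t r
    final G hG@((IG , maxG , _) , _) sh = ≤-trans (size-mono {F = G} {inF n k t r} inside)
      (≤-reflexive (trans (∑-cong (allSubsets n) (λ A → *-identityʳ ⟦ inF n k t r A ⟧)) (sym (length-filterᵇ (inF n k t r) (allSubsets n)))))
      where
      inside : ∀ A → G A ≡ true → inF n k t r A ≡ true
      inside A g = ∧-intro (T-true (≡⇒≡ᵇ ∣ A ∣ k (proj₁ IG A g)))
        (not-intro (≢true⇒false λ lt → <⇒≱ (<ᵇ⇒< _ _ (true-T lt))
          (Contained.contained q a e r n≡ c≥1 r<q G IG (initSeg n m) (card-initSeg n m (<⇒≤ m<n))
            (λ x z B Lx Lz → sh z x B (<-≤-trans (∈-initSeg m z Lz) (∉-initSeg m x Lx)))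
            (m-invariant G hG sh) (m-invariant-∁ G IG maxG sh) A g)))

-- The complete intersection theorem in terms of `fMax`

cardF-size : ∀ n k t r → cardF n k t r ≡ size (inF n k t r)
cardF-size n k t r = trans (length-filterᵇ (inF n k t r) (allSubsets n))
  (∑-cong (allSubsets n) (λ A → sym (*-identityʳ ⟦ inF n k t r A ⟧)))

inF-elim : ∀ n k t r A → inF n k t r A ≡ true → ∣ A ∣ ≡ k × t + r ≤ ∣ A ∩ initSeg n (t + 2 * r) ∣
inF-elim n k t r A h with ∧-elim {∣ A ∣ ≡ᵇ k} h
... | p , q = ≡ᵇ⇒≡ ∣ A ∣ k (true-T p) , ≮⇒≥ λ lt → true≢false (T-true (<⇒<ᵇ lt)) (not-elim q)

inF-intro : ∀ n k t r A → ∣ A ∣ ≡ k → t + r ≤ ∣ A ∩ initSeg n (t + 2 * r) ∣ → inF n k t r A ≡ true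
inF-intro n k t r A p q = ∧-intro (T-true (≡⇒≡ᵇ ∣ A ∣ k p)) (not-intro (≢true⇒false λ lt → <⇒≱ (<ᵇ⇒< _ _ (true-T lt)) q))

∈⇒≤foldr-⊔ : ∀ {x} xs → x ∈ xs → x ≤ foldr _⊔_ 0 xs
∈⇒≤foldr-⊔ (y ∷ ys) (here refl) = m≤m⊔n y _
∈⇒≤foldr-⊔ (y ∷ ys) (there h) = ≤-trans (∈⇒≤foldr-⊔ ys h) (m≤n⊔m y _)

admissible-intro : ∀ n t r → t + 2 * r ≤ n → T (admissible n t r)
admissible-intro n t r h = true-T (not-intro (≢true⇒false λ lt → <⇒≱ (<ᵇ⇒< n (t + 2 * r) (true-T lt)) h))

cardF≤fMax : ∀ n k t r → t + 2 * r ≤ n → cardF n k t r ≤ fMax n k t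
cardF≤fMax n k t r h = ∈⇒≤foldr-⊔ _ (∈-map⁺ (cardF n k t) (∈-filter⁺ (λ s → T? (admissible n t s))
  (∈-upTo⁺ (s≤s (≤-trans (m≤m+n r (r + 0)) (≤-trans (m≤n+m (2 * r) t) h)))) (admissible-intro n t r h)))

-- Positivity excludes the initial value 0 of the fold.
fMax-attained : ∀ n k t → 1 ≤ fMax n k t → ∃ λ r → t + 2 * r ≤ n × fMax n k t ≡ cardF n k t r
fMax-attained n k t h with foldr-selective ⊔-sel 0 (map (cardF n k t) (filterᵇ (admissible n t) (upTo (suc n))))
... | inj₁ z = ⊥-elim (<⇒≢ h (sym z))
... | inj₂ i with ∈-map⁻ (cardF n k t) i
... | r , r∈ , eq = r , ≮⇒≥ (λ lt → true≢false (T-true (<⇒<ᵇ lt))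
        (not-elim (T-true (proj₂ (∈-filter⁻ (λ s → T? (admissible n t s)) {xs = upTo (suc n)} r∈))))) , eq

card-sum-≤ : ∀ {n} (A B : Subset n) → ∣ A ∣ + ∣ B ∣ ≤ n + ∣ A ∩ B ∣
card-sum-≤ A B = ≤-trans (m≤n+m _ ∣ ∁ A ∩ ∁ B ∣) (≤-reflexive (card-∁∩∁ A B))

-- If 2k ≥ n + t then every k-set lies in F_{n,k,t,n-k}.
dense-case : ∀ n k t → k ≤ n → n + t ≤ k + k → (F : Family n) → Intersecting k t F → size F ≤ fMax n k t
dense-case n k t k≤n dense F IF = ≤-trans (≤-trans (size-mono {F = F} {inF n k t (n ∸ k)} inside)
    (≤-reflexive (sym (cardF-size n k t (n ∸ k))))) (cardF≤fMax n k t (n ∸ k) prefix)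
  where
  r = n ∸ k
  k+r : k + r ≡ n
  k+r = m+[n∸m]≡n k≤n
  t+r≤k : t + r ≤ k
  t+r≤k = +-cancelʳ-≤ k _ _ (≤-trans (≤-reflexive (lem t r k)) (≤-trans (≤-reflexive (cong (_+ t) k+r)) dense))
    where
    lem : ∀ t r k → t + r + k ≡ k + r + t
    lem = solve-∀
  prefix : t + 2 * r ≤ n
  prefix = ≤-trans (≤-reflexive (lem t r)) (≤-trans (+-monoˡ-≤ r t+r≤k) (≤-reflexive k+r))
    where
    lem : ∀ t r → t + 2 * r ≡ t + r + r
    lem = solve-∀
  inside : ∀ A → F A ≡ true → inF n k t r A ≡ true
  inside A f = inF-intro n k t r A (proj₁ IF A f) (+-cancelˡ-≤ n _ _ (begin
    n + (t + r)                       ≡⟨ cong (_+ (t + r)) (sym k+r) ⟩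
    k + r + (t + r)                   ≡⟨ lem k t r ⟩
    k + (t + 2 * r)                   ≡⟨ cong₂ _+_ (sym (proj₁ IF A f)) (sym (card-initSeg n _ prefix)) ⟩
    ∣ A ∣ + ∣ initSeg n (t + 2 * r) ∣  ≤⟨ card-sum-≤ A _ ⟩
    n + ∣ A ∩ initSeg n (t + 2 * r) ∣  ∎))
    where
    open ≤-Reasoning
    lem : ∀ k t r → k + r + (t + r) ≡ k + (t + 2 * r)
    lem = solve-∀

-- For t = 1 and n = 2k an intersecting family contains at most one of A and its complement.
half-case : ∀ n k → 1 ≤ n → n ≡ k + k → (F : Family n) → Intersecting k 1 F → size F ≤ fMax n k 1
half-case n k n≥1 n≡ F (Fk , Ft) = ≤-trans halves (≤-trans (≤-reflexive (sym (cardF-size n k 1 0))) (cardF≤fMax n k 1 0 n≥1))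
  where
  G : Family n
  G = inF n k 1 0
  S = initSeg n 1
  complementary : ∀ A → ∣ A ∣ ≡ k → ∣ ∁ A ∣ ≡ k
  complementary A h = +-cancelʳ-≡ k _ k (trans (cong (∣ ∁ A ∣ +_) (sym h)) (trans (card-∁ A) n≡))
  star : ∀ A → ∣ A ∣ ≡ k → G A ≡ true ⊎ G (∁ A) ≡ true
  star A h with 1 ≤? ∣ A ∩ S ∣
  ... | yes p = inj₁ (inF-intro n k 1 0 A h p)
  ... | no p = inj₂ (inF-intro n k 1 0 (∁ A) (complementary A h)
      (≤-reflexive (sym (trans (cong ∣_∣ (∩-comm (∁ A) S)) (trans (cong (_+ ∣ S ∩ ∁ A ∣) (sym (trans (cong ∣_∣ (∩-comm S A)) (n<1⇒n≡0 (≰⇒> p)))))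
        (trans (card-∩-∁ S A) (card-initSeg n 1 n≥1)))))))
  disjoint : ∀ A → F A ≡ true → F (∁ A) ≡ true → ⊥
  disjoint A f g = <⇒≱ (Ft A (∁ A) f g) (≤-reflexive (+-cancelˡ-≡ ∣ A ∣ _ 0
    (trans (cong (_+ ∣ A ∩ ∁ A ∣) (sym (cong ∣_∣ (∩-idem A)))) (trans (card-∩-∁ A A) (sym (+-identityʳ _))))))
  pointwise : ∀ A → ⟦ F A ⟧ * 1 + ⟦ F (∁ A) ⟧ * 1 ≤ ⟦ G A ⟧ * 1 + ⟦ G (∁ A) ⟧ * 1
  pointwise A with F A in f | F (∁ A) in g
  ... | true | true = ⊥-elim (disjoint A f g)
  ... | false | false = z≤n
  ... | true | false = one (star A (Fk A f))
    where
    one : G A ≡ true ⊎ G (∁ A) ≡ true → 1 ≤ ⟦ G A ⟧ * 1 + ⟦ G (∁ A) ⟧ * 1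
    one (inj₁ h) rewrite h = s≤s z≤n
    one (inj₂ h) rewrite h = m≤n+m 1 _
  ... | false | true = one (star A (trans (cong ∣_∣ (sym (∁-involutive A))) (complementary (∁ A) (Fk (∁ A) g))))
    where
    one : G A ≡ true ⊎ G (∁ A) ≡ true → 1 ≤ ⟦ G A ⟧ * 1 + ⟦ G (∁ A) ⟧ * 1
    one (inj₁ h) rewrite h = s≤s z≤n
    one (inj₂ h) rewrite h = m≤n+m 1 _
  halves : size F ≤ size G
  halves = ≮⇒≥ λ lt → <⇒≱ (+-mono-< lt lt) (subst₂ _≤_
    (trans (∑-+ (allSubsets n) _ _) (cong (size F +_) (size-ᶜ F)))
    (trans (∑-+ (allSubsets n) _ _) (cong (size G +_) (size-ᶜ G)))
    (∑-mono (allSubsets n) pointwise))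

-- Outside the dense case `e = n - 2k + a` is a natural number; `a + e = 0` means `t = 1` and
-- `n = 2k`.
complete-intersection : ∀ n k t → 1 ≤ t → t ≤ k → k ≤ n → (F : Family n) → Intersecting k t F → size F ≤ fMax n k t
complete-intersection n k (suc a) _ a<k k≤n F IF with n + suc a ≤? k + k
... | yes dense = dense-case n k (suc a) k≤n dense F IF
... | no sparse = by-excess (1 ≤? a + e)
  where
  q = k ∸ a
  q+a : q + a ≡ k
  q+a = m∸n+n≡m (<⇒≤ a<k)
  q≥1 : 1 ≤ q
  q≥1 = m<n⇒0<n∸m a<k
  2q+a≤n : q + q + a ≤ n
  2q+a≤n = +-cancelʳ-≤ a _ _ (s≤s⁻¹ (≤-trans (≤-reflexive (cong suc (trans (lem q a) (cong₂ _+_ q+a q+a))))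
    (≤-trans (≰⇒> sparse) (≤-reflexive (+-suc n a)))))
    where
    lem : ∀ q a → q + q + a + a ≡ q + a + (q + a)
    lem = solve-∀
  e = n ∸ (q + q + a)
  n≡ : n ≡ q + q + a + e
  n≡ = sym (m+[n∸m]≡n 2q+a≤n)
  by-excess : Dec (1 ≤ a + e) → size F ≤ fMax n k (suc a)
  by-excess (yes c≥1) with choose-r q a e q≥1 c≥1
  ... | r , r<q , upper , lower , r≡0 , r≡q-1 =
    ≤-trans (≤-trans (Extremal.extremal-size q a e r n≡ c≥1 r<q upper lower r≡0 r≡q-1 F
                       (subst (λ j → Intersecting j (suc a) F) (sym q+a) IF))
                     (≤-reflexive (cong (λ j → cardF n j (suc a) r) q+a)))
            (cardF≤fMax n k (suc a) r (<⇒≤ (Extremal.m<n q a e r n≡ c≥1 r<q upper lower r≡0 r≡q-1)))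
  by-excess (no c<1) = subst (λ b → size F ≤ fMax n k (suc b)) (sym a≡0)
    (half-case n k (≤-trans (≤-trans (s≤s z≤n) a<k) k≤n)
      (trans n≡ (trans (cong₂ (λ x y → q + q + x + y) a≡0 e≡0) (trans (lem q) (cong₂ _+_ q≡k q≡k)))) F
      (subst (λ b → Intersecting k (suc b) F) a≡0 IF))
    where
    a+e≡0 = n<1⇒n≡0 (≰⇒> c<1)
    a≡0 = m+n≡0⇒m≡0 a a+e≡0
    e≡0 = m+n≡0⇒n≡0 a a+e≡0
    q≡k : q ≡ k
    q≡k = cong (k ∸_) a≡0
    lem : ∀ q → q + q + 0 + 0 ≡ q + q
    lem = solve-∀

-- The `k`-sets and the permutations acting on them

ofCard : ∀ {n} → ℕ → Family n
ofCard k A = ∣ A ∣ ≡ᵇ k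

ofCard-intro : ∀ {n k} (A : Subset n) → ∣ A ∣ ≡ k → ofCard k A ≡ true
ofCard-intro {k = k} A h = T-true (≡⇒≡ᵇ ∣ A ∣ k h)

ofCard-elim : ∀ {n k} (A : Subset n) → ofCard k A ≡ true → ∣ A ∣ ≡ k
ofCard-elim {k = k} A h = ≡ᵇ⇒≡ ∣ A ∣ k (true-T h)

nC0≡1 : ∀ n → n C 0 ≡ 1
nC0≡1 n = trans (nCk≡nC[n∸k] {0} {n} z≤n) (nCn≡1 n)

size-ofCard : ∀ n k → size {n} (ofCard k) ≡ n C k
size-ofCard zero zero = refl
size-ofCard zero (suc k) = sym (k>n⇒nCk≡0 {0} {suc k} (s≤s z≤n))
size-ofCard (suc n) zero = trans (∑-subsets-suc n _) (trans (cong₂ _+_ (trans (size-ofCard n 0) (nC0≡1 n)) (∑-zero (allSubsets n)))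
  (sym (nC0≡1 (suc n))))
size-ofCard (suc n) (suc k) = trans (∑-subsets-suc n _) (trans (cong₂ _+_ (size-ofCard n (suc k)) (size-ofCard n k))
  (trans (+-comm (n C suc k) (n C k)) (nCk+nC[k+1]≡[n+1]C[k+1] n k)))

-- A permutation is coded by the successive positions at which the elements are inserted.
Code : ℕ → Set
Code zero = ⊤
Code (suc n) = Fin (suc n) × Code n

act : ∀ {n} → Code n → Subset n → Subset n
act {zero} _ A = A
act {suc n} (i , c) (a ∷ A) = insertAt (act c A) i a

codes : ∀ n → List (Code n)
codes zero = tt ∷ []
codes (suc n) = cartesianProduct (fins (suc n)) (codes n)

∑-cartesianProduct : {X Y : Set} (xs : List X) (ys : List Y) (f : X × Y → ℕ) →
  ∑ (cartesianProduct xs ys) f ≡ ∑ xs (λ x → ∑ ys (λ y → f (x , y)))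
∑-cartesianProduct [] ys f = refl
∑-cartesianProduct (x ∷ xs) ys f = trans (∑-++ (map (x ,_) ys) _ f)
  (cong₂ _+_ (∑-map (x ,_) ys f) (∑-cartesianProduct xs ys f))

card-∷ : ∀ {n} a (A : Subset n) → ∣ a ∷ A ∣ ≡ ⟦ a ⟧ + ∣ A ∣
card-∷ true A = refl
card-∷ false A = refl

insertAt-∩ : ∀ {n} (A B : Subset n) i a b → insertAt A i a ∩ insertAt B i b ≡ insertAt (A ∩ B) i (a ∧ b)
insertAt-∩ A B zero a b = refl
insertAt-∩ (x ∷ A) (y ∷ B) (suc i) a b = cong (x ∧ y ∷_) (insertAt-∩ A B i a b)

card-insertAt : ∀ {n} (A : Subset n) i a → ∣ insertAt A i a ∣ ≡ ⟦ a ⟧ + ∣ A ∣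
card-insertAt A zero a = card-∷ a A
card-insertAt (x ∷ A) (suc i) a = trans (card-∷ x (insertAt A i a)) (trans (cong (⟦ x ⟧ +_) (card-insertAt A i a))
  (trans (lem ⟦ x ⟧ ⟦ a ⟧ ∣ A ∣) (cong (⟦ a ⟧ +_) (sym (card-∷ x A)))))
  where
  lem : ∀ x a y → x + (a + y) ≡ a + (x + y)
  lem = solve-∀

act-∩ : ∀ {n} (c : Code n) (A B : Subset n) → act c A ∩ act c B ≡ act c (A ∩ B)
act-∩ {zero} c A B = refl
act-∩ {suc n} (i , c) (a ∷ A) (b ∷ B) = trans (insertAt-∩ (act c A) (act c B) i a b)
  (cong (λ Z → insertAt Z i (a ∧ b)) (act-∩ c A B))

card-act : ∀ {n} (c : Code n) (A : Subset n) → ∣ act c A ∣ ≡ ∣ A ∣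
card-act {zero} c A = refl
card-act {suc n} (i , c) (a ∷ A) = trans (card-insertAt (act c A) i a) (trans (cong (⟦ a ⟧ +_) (card-act c A)) (sym (card-∷ a A)))

same : Bool → Bool → Bool
same true b = b
same false b = not b

-- Insertion at `i` is a bijection onto the subsets whose bit at `i` is `a`.
∑-insertAt : ∀ {n} (i : Fin (suc n)) a (f : Subset (suc n) → ℕ) →
  ∑ (allSubsets n) (λ A → f (insertAt A i a)) ≡ ∑ (allSubsets (suc n)) (λ A → ⟦ same a (lookup A i) ⟧ * f A)
∑-insertAt {n} zero true f = sym (trans (∑-subsets-suc n _)
  (cong₂ _+_ (∑-zero (allSubsets n)) (∑-cong (allSubsets n) (λ A → +-identityʳ _))))
∑-insertAt {n} zero false f = sym (trans (∑-subsets-suc n _)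
  (trans (cong₂ _+_ (∑-cong (allSubsets n) (λ A → +-identityʳ _)) (∑-zero (allSubsets n))) (+-identityʳ _)))
∑-insertAt {suc n} (suc i) a f = trans (∑-subsets-suc n _)
  (trans (cong₂ _+_ (∑-insertAt i a (λ A → f (false ∷ A))) (∑-insertAt i a (λ A → f (true ∷ A))))
         (sym (∑-subsets-suc (suc n) _)))

∑-same : ∀ {n} (A : Subset n) a → ∑ (fins n) (λ i → ⟦ same a (lookup A i) ⟧) ≡ (if a then ∣ A ∣ else n ∸ ∣ A ∣)
∑-same A true = sym (card-∑ A)
∑-same {n} A false = trans (∑-cong (fins n) (λ i → cong ⟦_⟧ (sym (lookup-∁ A i))))
  (trans (sym (card-∑ (∁ A))) (trans (sym (m+n∸n≡m ∣ ∁ A ∣ ∣ A ∣)) (cong (_∸ ∣ A ∣) (card-∁ A))))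

card≤n : ∀ {n} (A : Subset n) → ∣ A ∣ ≤ n
card≤n A = ≤-trans (m≤n+m ∣ A ∣ ∣ ∁ A ∣) (≤-reflexive (card-∁ A))

-- The stabiliser of a k-set in the symmetric group has k! (n - k)! elements.
stabiliser : ℕ → ℕ → ℕ
stabiliser n k = k ! * (n ∸ k) !

-- By induction: a set `B` of the right size arises by inserting the head bit `a` at any position
-- where `B` carries `a`, and the number of these positions is the factor by which the stabiliser
-- grows.
∑-orbit : ∀ {n} (A : Subset n) (h : Subset n → ℕ) →
  ∑ (codes n) (λ c → h (act c A)) ≡ stabiliser n ∣ A ∣ * weight h (ofCard ∣ A ∣)
∑-orbit [] h = lem (h [])
  where
  lem : ∀ x → x + 0 ≡ 1 * (1 * x + 0)
  lem = solve-∀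
∑-orbit {suc n} (a ∷ A) h = begin
  ∑ (codes (suc n)) (λ c → h (act c (a ∷ A)))
    ≡⟨ ∑-cartesianProduct X (codes n) _ ⟩
  ∑ X (λ i → ∑ (codes n) (λ c → h (insertAt (act c A) i a)))
    ≡⟨ ∑-cong X (λ i → ∑-orbit A (λ B → h (insertAt B i a))) ⟩
  ∑ X (λ i → κ * weight (λ B → h (insertAt B i a)) (ofCard s))
    ≡⟨ ∑-cong X (λ i → cong (κ *_) (∑-cong (allSubsets n) (λ B → cong (λ b → ⟦ b ⟧ * h (insertAt B i a)) (card-shift B i)))) ⟩
  ∑ X (λ i → κ * ∑ (allSubsets n) (λ B → ⟦ ofCard (⟦ a ⟧ + s) (insertAt B i a) ⟧ * h (insertAt B i a)))
    ≡⟨ ∑-cong X (λ i → cong (κ *_) (∑-insertAt i a (λ B → ⟦ ofCard (⟦ a ⟧ + s) B ⟧ * h B))) ⟩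
  ∑ X (λ i → κ * ∑ S (λ B → ⟦ same a (lookup B i) ⟧ * (⟦ ofCard (⟦ a ⟧ + s) B ⟧ * h B)))
    ≡⟨ ∑-*ˡ X κ _ ⟩
  κ * ∑ X (λ i → ∑ S (λ B → ⟦ same a (lookup B i) ⟧ * (⟦ ofCard (⟦ a ⟧ + s) B ⟧ * h B)))
    ≡⟨ cong (κ *_) (∑-swap X S _) ⟩
  κ * ∑ S (λ B → ∑ X (λ i → ⟦ same a (lookup B i) ⟧ * (⟦ ofCard (⟦ a ⟧ + s) B ⟧ * h B)))
    ≡⟨ cong (κ *_) (∑-cong S (λ B → trans (∑-*ʳ X (λ i → ⟦ same a (lookup B i) ⟧) _) (count B))) ⟩
  κ * ∑ S (λ B → (⟦ ofCard (⟦ a ⟧ + s) B ⟧ * h B) * places a)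
    ≡⟨ cong (κ *_) (∑-*ʳ S _ (places a)) ⟩
  κ * (weight h (ofCard (⟦ a ⟧ + s)) * places a)
    ≡⟨ rearrange κ _ (places a) ⟩
  places a * κ * weight h (ofCard (⟦ a ⟧ + s))
    ≡⟨ cong₂ _*_ (stabiliser-step a) (cong (λ k → weight h (ofCard k)) (sym (card-∷ a A))) ⟩
  stabiliser (suc n) ∣ a ∷ A ∣ * weight h (ofCard ∣ a ∷ A ∣) ∎
  where
  open ≡-Reasoning
  X = fins (suc n)
  S = allSubsets (suc n)
  s = ∣ A ∣
  κ = stabiliser n s
  places : Bool → ℕ
  places b = if b then suc s else suc (n ∸ s)
  rearrange : ∀ x y z → x * (y * z) ≡ z * x * y
  rearrange = solve-∀
  +-≡ᵇ : ∀ b x y → (x ≡ᵇ y) ≡ (⟦ b ⟧ + x ≡ᵇ ⟦ b ⟧ + y)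
  +-≡ᵇ true x y = refl
  +-≡ᵇ false x y = refl
  card-shift : ∀ B i → ofCard s B ≡ ofCard (⟦ a ⟧ + s) (insertAt B i a)
  card-shift B i = trans (+-≡ᵇ a ∣ B ∣ s) (cong (_≡ᵇ ⟦ a ⟧ + s) (sym (card-insertAt B i a)))
  places-≡ : ∀ b (B : Subset (suc n)) → ∣ B ∣ ≡ ⟦ b ⟧ + s → (if b then ∣ B ∣ else suc n ∸ ∣ B ∣) ≡ places b
  places-≡ true B eq = eq
  places-≡ false B eq = trans (cong (suc n ∸_) eq) (+-∸-assoc 1 (card≤n A))
  count : ∀ B → ∑ X (λ i → ⟦ same a (lookup B i) ⟧) * (⟦ ofCard (⟦ a ⟧ + s) B ⟧ * h B) ≡ (⟦ ofCard (⟦ a ⟧ + s) B ⟧ * h B) * places a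
  count B with ofCard (⟦ a ⟧ + s) B in eq
  ... | false = *-zeroʳ (∑ X (λ i → ⟦ same a (lookup B i) ⟧))
  ... | true = trans (*-comm _ (1 * h B)) (cong (1 * h B *_) (trans (∑-same B a) (places-≡ a B (ofCard-elim B eq))))
  stabiliser-step : ∀ b → places b * κ ≡ stabiliser (suc n) ∣ b ∷ A ∣
  stabiliser-step true = sym (*-assoc (suc s) (s !) ((n ∸ s) !))
  stabiliser-step false = trans (lem (suc (n ∸ s)) (s !) ((n ∸ s) !)) (cong (λ x → s ! * x !) (sym (+-∸-assoc 1 (card≤n A))))
    where
    lem : ∀ x y z → x * (y * z) ≡ y * (x * z)
    lem = solve-∀

-- Fractional colourings of the complement graph

card-map-fromList : {X : Set} (P : X → Bool) (xs : List X) → ∣ Vec.map P (fromList xs) ∣ ≡ ∑ xs (λ x → ⟦ P x ⟧)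
card-map-fromList P [] = refl
card-map-fromList P (x ∷ xs) = trans (card-∷ (P x) (Vec.map P (fromList xs))) (cong (⟦ P x ⟧ +_) (card-map-fromList P xs))

length-∑ : {X : Set} (xs : List X) → length xs ≡ ∑ xs (λ _ → 1)
length-∑ [] = refl
length-∑ (x ∷ xs) = cong suc (length-∑ xs)

KSet-≡ : ∀ {n k} {u v : KSet n k} → proj₁ u ≡ proj₁ v → u ≡ v
KSet-≡ {u = A , p} {.A , q} refl = cong (A ,_) (≡-irrelevant p q)

Compl-small : ∀ {n k t} (u v : KSet n k) → Compl (KAdj n k t) u v → t ≤ ∣ proj₁ u ∩ proj₁ v ∣ → ⊥
Compl-small u v (u≢v , nonadj) h = nonadj ((λ eq → u≢v (KSet-≡ eq)) , h)

-- A shared colour `c` sends both sets into `F`, and `act c` preserves intersection sizes; so the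
-- two sets already meet in at least `t` elements.
translates-colouring : ∀ {n} k t (F : Family n) → Intersecting k t F →
  BFoldColouring (Compl (KAdj n k t)) (stabiliser n k * size F) (length (codes n))
translates-colouring {n} k t F (Fk , Ft) = colour , folds , proper
  where
  colour : KSet n k → Subset (length (codes n))
  colour (A , _) = Vec.map (λ c → F (act c A)) (fromList (codes n))
  restrict : ∀ A → ⟦ ofCard k A ⟧ * ⟦ F A ⟧ ≡ ⟦ F A ⟧ * 1
  restrict A with F A in f
  ... | false = *-zeroʳ ⟦ ofCard k A ⟧
  ... | true rewrite ofCard-intro A (Fk A f) = refl
  folds : ∀ v → ∣ colour v ∣ ≡ stabiliser n k * size F
  folds (A , refl) = trans (card-map-fromList (λ c → F (act c A)) (codes n))
    (trans (∑-orbit A (λ B → ⟦ F B ⟧)) (cong (stabiliser n k *_) (∑-cong (allSubsets n) restrict)))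
  proper : ∀ u v → Compl (KAdj n k t) u v → Empty (colour u ∩ colour v)
  proper u@(A , p) v@(B , q) adj (x , x∈) with x∈p∩q⁻ (colour u) (colour v) x∈
  ... | x∈u , x∈v = Compl-small {k = k} {t} u v adj (≤-trans
    (Ft (act c A) (act c B) (trans (sym (lookup-map x (λ c → F (act c A)) (fromList (codes n)))) ([]=⇒lookup x∈u))
                            (trans (sym (lookup-map x (λ c → F (act c B)) (fromList (codes n)))) ([]=⇒lookup x∈v)))
    (≤-reflexive (trans (cong ∣_∣ (act-∩ c A B)) (card-act c (A ∩ B)))))
    where
    c : Code n
    c = lookup (fromList (codes n)) x

card-∩-submodular : ∀ {n} (A B S : Subset n) → ∣ A ∩ S ∣ + ∣ B ∩ S ∣ ≤ ∣ S ∣ + ∣ (A ∩ B) ∩ S ∣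
card-∩-submodular [] [] [] = z≤n
card-∩-submodular (true ∷ A) (true ∷ B) (true ∷ S) = s≤s (subst₂ _≤_ (sym (+-suc _ _)) (sym (+-suc _ _)) (s≤s (card-∩-submodular A B S)))
card-∩-submodular (true ∷ A) (false ∷ B) (true ∷ S) = s≤s (card-∩-submodular A B S)
card-∩-submodular (false ∷ A) (true ∷ B) (true ∷ S) = ≤-trans (≤-reflexive (+-suc _ _)) (s≤s (card-∩-submodular A B S))
card-∩-submodular (false ∷ A) (false ∷ B) (true ∷ S) = m≤n⇒m≤1+n (card-∩-submodular A B S)
card-∩-submodular (true ∷ A) (true ∷ B) (false ∷ S) = card-∩-submodular A B S
card-∩-submodular (true ∷ A) (false ∷ B) (false ∷ S) = card-∩-submodular A B S
card-∩-submodular (false ∷ A) (true ∷ B) (false ∷ S) = card-∩-submodular A B S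
card-∩-submodular (false ∷ A) (false ∷ B) (false ∷ S) = card-∩-submodular A B S

module _ {n k t : ℕ} (1≤t : 1 ≤ t) (t≤k : t ≤ k) (k≤n : k ≤ n) where

  -- A colour class has no two vertices adjacent in the complement graph, hence is `t`-intersecting,
  -- and `complete-intersection` bounds its size.
  colouring-lower : ∀ b m → BFoldColouring (Compl (KAdj n k t)) b m → (n C k) * b ≤ m * fMax n k t
  colouring-lower b m (colour , folds , proper) = begin
    (n C k) * b                                      ≡⟨ cong (_* b) (sym (size-ofCard n k)) ⟩
    size (ofCard {n} k) * b                          ≡⟨ sym (weight-const (ofCard {n} k) {λ A → ∑ (fins m) (λ j → ⟦ member j A ⟧)} b total) ⟩
    ∑ S (λ A → ⟦ ofCard k A ⟧ * ∑ (fins m) (λ j → ⟦ member j A ⟧))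
      ≤⟨ ∑-mono S (λ A → ⟦⟧*≤ (ofCard k A) _) ⟩
    ∑ S (λ A → ∑ (fins m) (λ j → ⟦ member j A ⟧))     ≡⟨ ∑-swap S (fins m) _ ⟩
    ∑ (fins m) (λ j → ∑ S (λ A → ⟦ member j A ⟧))     ≤⟨ ∑-mono (fins m) bound ⟩
    ∑ (fins m) (λ j → 1 * fMax n k t)                 ≡⟨ ∑-*ʳ (fins m) (λ _ → 1) (fMax n k t) ⟩
    ∑ (fins m) (λ _ → 1) * fMax n k t                 ≡⟨ cong (_* fMax n k t) (∑-fins-1 m) ⟩
    m * fMax n k t                                    ∎
    where
    open ≤-Reasoning
    S = allSubsets n
    ⟦⟧*≤ : ∀ b m → ⟦ b ⟧ * m ≤ m
    ⟦⟧*≤ true m = ≤-reflexive (+-identityʳ m)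
    ⟦⟧*≤ false m = z≤n
    member : Fin m → Family n
    member j A with ∣ A ∣ ≟ k
    ... | yes p = lookup (colour (A , p)) j
    ... | no _ = false
    member-elim : ∀ j A → member j A ≡ true → Σ (∣ A ∣ ≡ k) λ p → lookup (colour (A , p)) j ≡ true
    member-elim j A h with ∣ A ∣ ≟ k
    ... | yes p = p , h
    total : ∀ A → ofCard k A ≡ true → ∑ (fins m) (λ j → ⟦ member j A ⟧) ≡ b
    total A h with ∣ A ∣ ≟ k
    ... | yes p = trans (sym (card-∑ (colour (A , p)))) (folds (A , p))
    ... | no ¬p = ⊥-elim (¬p (ofCard-elim A h))
    meet : ∀ j A B → member j A ≡ true → member j B ≡ true → t ≤ ∣ A ∩ B ∣
    meet j A B h h′ with member-elim j A h | member-elim j B h′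
    ... | p , x | q , y = ≮⇒≥ λ lt → proper (A , p) (B , q)
      -- If `A` and `B` coincide, `t ≤ k` already gives the bound.
      ((λ eq → <⇒≱ lt (≤-trans t≤k (≤-reflexive (trans (sym p) (cong ∣_∣ (trans (sym (∩-idem A)) (cong (A ∩_) (cong proj₁ eq)))))))) ,
       (λ adj → <⇒≱ lt (proj₂ adj)))
      (j , x∈p∩q⁺ (lookup⇒[]= j _ x , lookup⇒[]= j _ y))
    bound : ∀ j → ∑ S (λ A → ⟦ member j A ⟧) ≤ 1 * fMax n k t
    bound j = ≤-trans (≤-reflexive (∑-cong S (λ A → sym (*-identityʳ ⟦ member j A ⟧))))
      (≤-trans (complete-intersection n k t 1≤t t≤k k≤n (member j)
                 ((λ A h → proj₁ (member-elim j A h)) , meet j)) (≤-reflexive (sym (+-identityʳ _))))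

  -- The initial segment of length `k` belongs to the family with `r = 0`.
  fMax-positive : 1 ≤ fMax n k t
  fMax-positive = ≤-trans (≤-trans (size-positive (inF n k t 0) (initSeg n k)
      (inF-intro n k t 0 (initSeg n k) (card-initSeg n k k≤n) meets)) (≤-reflexive (sym (cardF-size n k t 0))))
    (cardF≤fMax n k t 0 t+0≤n)
    where
    t+0≤n : t + 0 ≤ n
    t+0≤n = ≤-trans (≤-reflexive (+-identityʳ t)) (≤-trans t≤k k≤n)
    T₀ = initSeg n (t + 0)
    meets : t + 0 ≤ ∣ initSeg n k ∩ T₀ ∣
    meets = ≤-trans (≤-reflexive (sym (trans (cong ∣_∣ (∩-idem T₀)) (card-initSeg n (t + 0) t+0≤n))))
      (card-∩-mono T₀ T₀ (initSeg n k) T₀ (λ i h _ → ∧-intro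
        (initSeg-∈ k i (<-≤-trans (∈-initSeg (t + 0) i h) (≤-trans (≤-reflexive (+-identityʳ t)) t≤k))) h))

  -- Because `2 (t + r) - (t + 2r) = t`.
  inF-intersecting : ∀ r → t + 2 * r ≤ n → Intersecting k t (inF n k t r)
  inF-intersecting r h = (λ A f → proj₁ (inF-elim n k t r A f)) , meet
    where
    m = t + 2 * r
    S = initSeg n m
    meet : ∀ A B → inF n k t r A ≡ true → inF n k t r B ≡ true → t ≤ ∣ A ∩ B ∣
    meet A B f g = ≤-trans (+-cancelˡ-≤ m _ _ (begin
      m + t                             ≡⟨ lem t r ⟩
      (t + r) + (t + r)                 ≤⟨ +-mono-≤ (proj₂ (inF-elim n k t r A f)) (proj₂ (inF-elim n k t r B g)) ⟩
      ∣ A ∩ S ∣ + ∣ B ∩ S ∣               ≤⟨ card-∩-submodular A B S ⟩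
      ∣ S ∣ + ∣ (A ∩ B) ∩ S ∣            ≡⟨ cong (_+ ∣ (A ∩ B) ∩ S ∣) (card-initSeg n m h) ⟩
      m + ∣ (A ∩ B) ∩ S ∣                ∎)) (≤-trans (m≤m+n _ _) (≤-reflexive (card-∩-∁ (A ∩ B) S)))
      where
      open ≤-Reasoning
      lem : ∀ t r → t + 2 * r + t ≡ (t + r) + (t + r)
      lem = solve-∀

  -- The number of colours comes from `∑-orbit` for the constant 1, as `κ` times the number of
  -- `k`-sets, with the same `κ` as in the size of the colour sets.
  optimal-colouring : ∃ λ κ → 1 ≤ κ × BFoldColouring (Compl (KAdj n k t)) (κ * fMax n k t) (κ * (n C k))
  optimal-colouring with fMax-attained n k t fMax-positive
  ... | r , h , eq = stabiliser n k , *-mono-≤ (1≤n! k) (1≤n! (n ∸ k)) ,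
    subst₂ (BFoldColouring (Compl (KAdj n k t))) (cong (stabiliser n k *_) (trans (sym (cardF-size n k t r)) (sym eq))) colours
      (translates-colouring k t (inF n k t r) (inF-intersecting r h))
    where
    colours : length (codes n) ≡ stabiliser n k * (n C k)
    colours = trans (length-∑ (codes n)) (trans (∑-orbit (initSeg n k) (λ _ → 1))
      (trans (cong (λ j → stabiliser n j * size {n} (ofCard j)) (card-initSeg n k k≤n)) (cong (stabiliser n k *_) (size-ofCard n k))))

-- The two sides differ by `q * (κ * q)`.
scaled-ratio : ∀ κ p q N → 1 ≤ q → 1 ≤ κ * q → κ * p * q * N < (p * N + q) * (κ * q)
scaled-ratio κ p q N q≥1 b≥1 = <-≤-trans (m<m+n _ (*-mono-≤ q≥1 b≥1)) (≤-reflexive (lem κ p q N))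
  where
  lem : ∀ κ p q N → κ * p * q * N + q * (κ * q) ≡ (p * N + q) * (κ * q)
  lem = solve-∀

-- The infimum is attained, so one colouring serves every `N`.
frac-chromatic : {V : Set} (Adj : V → V → Set) (p q : ℕ) → 1 ≤ q →
  (∀ b m → BFoldColouring Adj b m → p * b ≤ m * q) →
  (∃ λ κ → 1 ≤ κ × BFoldColouring Adj (κ * q) (κ * p)) → FracChromaticIs Adj p q
frac-chromatic Adj p q q≥1 lower (κ , κ≥1 , colouring) =
  (λ b m _ → lower b m) ,
  (λ N _ → κ * q , κ * p , *-mono-≤ κ≥1 q≥1 , colouring , scaled-ratio κ p q N q≥1 (*-mono-≤ κ≥1 q≥1))

theorem3p9 : (n k t : ℕ) → 1 ≤ t → t ≤ k → k ≤ n →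
    FracCliqueCoverIs (KAdj n k t) (n C k) (fMax n k t)
theorem3p9 n k t 1≤t t≤k k≤n = frac-chromatic (Compl (KAdj n k t)) (n C k) (fMax n k t)
  (fMax-positive 1≤t t≤k k≤n) (colouring-lower 1≤t t≤k k≤n) (optimal-colouring 1≤t t≤k k≤n)
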